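{- For every $\alpha>1$ there is an $\epsilon>0$ such that the following holds: if there is an $\alpha$-approximation algorithm for the traveling salesman problem, then there is an $(\alpha+2\cdot(1-\epsilon))$-approximation algorithm for Capacitated Vehicle Routing. For $\alpha=\frac32$ one can take $\epsilon>\frac{1}{3000}$.
   Context: A semi-metric $c$ on a set $X$ is a symmetric function $c:X\times X\to\mathbb{R}_{\ge 0}$ with $c(x,x)=0$ satisfying the triangle inequality (distinct points may have distance $0$). Traveling salesman problem: given a finite set with a semi-metric $c$, find a cycle visiting every element exactly once of minimum total cost. Capacitated Vehicle Routing: an instance $(V,s,c,d)$ consists of a finite set $V$ of customers, a depot $s\notin V$, a semi-metric $c$ on $\{s\}\cup V$, and a demand $d(v)\in[0,1]$ for each $v\in V$. A feasible solution is a set $\mathcal{Q}$ of tours such that every $Q\in\mathcal{Q}$ is a cycle containing $s$ whose other vertices are customers (a tour with a single customer $v$ goes from $s$ to $v$ and back, with cost $2c(s,v)$), every customer belongs to exactly one tour, and $\sum_{v\in V(Q)\setminus\{s\}}d(v)\le 1$ for all $Q\in\mathcal{Q}$. The cost of a tour $Q$ is $c(Q)=\sum_{\{v,w\}\in E(Q)}c(v,w)$, and the task is to minimize $c(\mathcal{Q})=\sum_{Q\in\mathcal{Q}}c(Q)$. A $\beta$-approximation algorithm for a minimization problem is a polynomial-time algorithm that, for every instance, returns a feasible solution of cost at most $\beta$ times the minimum cost of a feasible solution.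
   Formalization: The semi-metric c and the demands d(v) in the instances of both problems take rational values (written in binary) instead of real ones; α and ε are real. -}

module Defs where

open import Data.Bool using (Bool; true; false)
open import Data.Fin using (Fin; zero; suc; toℕ)
open import Data.Integer as ℤ using ()
open import Data.List using (List; []; _∷_; _++_; map; concat; concatMap; foldr; length; allFin)
open import Data.List.NonEmpty using (List⁺; toList)
open import Data.List.Relation.Binary.Permutation.Propositional using (_↭_)
open import Data.List.Relation.Unary.All using (All)
open import Data.Maybe using (Maybe)
open import Data.Nat as ℕ using (ℕ; zero; suc)
import Data.Nat.Properties as ℕₚ
open import Data.Nat.Binary as ℕᵇ using (ℕᵇ; 2[1+_]; 1+[2_])
open import Data.Product using (∃; ∃-syntax; _×_; _,_; proj₁; proj₂)
open import Data.Rational as ℚ using (ℚ; 0ℚ; 1ℚ; ½; ∣_∣; _≤_; _<_; ↥_; ↧ₙ_)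
import Data.Rational.Properties as ℚₚ
open import Data.Rational.Solver using (module +-*-Solver)
open import Data.Vec using (Vec; lookup; updateAt; replicate)
import Data.Vec as Vec
open import Relation.Binary.PropositionalEquality using (_≡_; refl; sym; trans; cong; cong₂; subst)

------------------------------------------------------------------------
-- Real numbers: Cauchy sequences of rationals with a modulus.  Equality of
-- reals is never needed below, so no setoid structure is given.

IsCauchy : (ℕ → ℚ) → Set
IsCauchy x = ∀ e → 0ℚ < e → ∃[ N ] ∀ m n → N ℕ.≤ m → N ℕ.≤ n → ∣ x m ℚ.- x n ∣ ≤ e

record ℝ : Set where
  constructor mkℝ
  field
    seq    : ℕ → ℚ
    cauchy : IsCauchy seq

open ℝ public

infix 4 _≤ℝ_ _<ℝ_

_≤ℝ_ : ℝ → ℝ → Set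
x ≤ℝ y = ∀ e → 0ℚ < e → ∃[ N ] ∀ n → N ℕ.≤ n → seq x n ≤ seq y n ℚ.+ e

_<ℝ_ : ℝ → ℝ → Set
x <ℝ y = ∃[ e ] 0ℚ < e × ∃[ N ] ∀ n → N ℕ.≤ n → seq x n ℚ.+ e ≤ seq y n

fromℚ : ℚ → ℝ
fromℚ q = mkℝ (λ _ → q) λ e 0<e → 0 , λ _ _ _ _ →
  subst (_≤ e) (sym (cong ∣_∣ (ℚₚ.+-inverseʳ q))) (ℚₚ.<⇒≤ 0<e)

private
  ½*-pos : ∀ {e} → 0ℚ < e → 0ℚ < ½ ℚ.* e
  ½*-pos {e} 0<e = ℚₚ.positive⁻¹ (½ ℚ.* e) {{ℚₚ.pos*pos⇒pos ½ e {{ℚ.positive 0<e}}}}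

  halves : ∀ e → ½ ℚ.* e ℚ.+ ½ ℚ.* e ≡ e
  halves e = trans (sym (ℚₚ.*-distribʳ-+ e ½ ½)) (ℚₚ.*-identityˡ e)

  +-regroup : ∀ a b c d → (a ℚ.+ b) ℚ.- (c ℚ.+ d) ≡ (a ℚ.- c) ℚ.+ (b ℚ.- d)
  +-regroup = solve 4 (λ a b c d → (a :+ b) :- (c :+ d) := (a :- c) :+ (b :- d)) refl
    where open +-*-Solver

  *-regroup : ∀ a b c d → a ℚ.* b ℚ.- c ℚ.* d ≡ a ℚ.* (b ℚ.- d) ℚ.+ (a ℚ.- c) ℚ.* d
  *-regroup = solve 4 (λ a b c d → a :* b :- c :* d := a :* (b :- d) :+ (a :- c) :* d) refl
    where open +-*-Solver

  -‿regroup : ∀ a b → (ℚ.- a) ℚ.- (ℚ.- b) ≡ ℚ.- (a ℚ.- b)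
  -‿regroup = solve 2 (λ a b → (:- a) :- (:- b) := :- (a :- b)) refl
    where open +-*-Solver

  split : ∀ a b → a ≡ (a ℚ.- b) ℚ.+ b
  split = solve 2 (λ a b → a := (a :- b) :+ b) refl
    where open +-*-Solver

  max-l : ∀ {M N k} → M ℕ.⊔ N ℕ.≤ k → M ℕ.≤ k
  max-l {M} {N} = ℕₚ.≤-trans (ℕₚ.m≤m⊔n M N)

  max-r : ∀ {M N k} → M ℕ.⊔ N ℕ.≤ k → N ℕ.≤ k
  max-r {M} {N} = ℕₚ.≤-trans (ℕₚ.m≤n⊔m M N)

  0<1 : 0ℚ < 1ℚ
  0<1 = ℚₚ.positive⁻¹ 1ℚ

  *-mono : ∀ {a b c d} → 0ℚ ≤ b → 0ℚ ≤ c → a ≤ c → b ≤ d → a ℚ.* b ≤ c ℚ.* d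
  *-mono {a} {b} {c} {d} 0≤b 0≤c a≤c b≤d = ℚₚ.≤-trans
    (ℚₚ.*-monoʳ-≤-nonNeg b {{ℚ.nonNegative 0≤b}} a≤c)
    (ℚₚ.*-monoˡ-≤-nonNeg c {{ℚ.nonNegative 0≤c}} b≤d)

  bound : (x : ℝ) → ∃[ B ] ∃[ N ] 0ℚ < B × (∀ n → N ℕ.≤ n → ∣ seq x n ∣ ≤ B)
  bound x = let (N , h) = cauchy x 1ℚ 0<1 in
      1ℚ ℚ.+ ∣ seq x N ∣ , N
    , ℚₚ.<-≤-trans 0<1 (subst (_≤ 1ℚ ℚ.+ ∣ seq x N ∣) (ℚₚ.+-identityʳ 1ℚ)
        (ℚₚ.+-monoʳ-≤ 1ℚ (ℚₚ.0≤∣p∣ (seq x N))))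
    , λ n N≤n → ℚₚ.≤-trans
        (ℚₚ.≤-reflexive (cong ∣_∣ (split (seq x n) (seq x N))))
        (ℚₚ.≤-trans (ℚₚ.∣p+q∣≤∣p∣+∣q∣ (seq x n ℚ.- seq x N) (seq x N))
                    (ℚₚ.+-monoˡ-≤ ∣ seq x N ∣ (h n N N≤n ℕₚ.≤-refl)))

  divide : ∀ e B → 0ℚ < e → 0ℚ < B → ∃[ δ ] 0ℚ < δ × B ℚ.* δ ≡ e
  divide e B 0<e 0<B =
      1/B ℚ.* e
    , ℚₚ.positive⁻¹ (1/B ℚ.* e) {{ℚₚ.pos*pos⇒pos 1/B {{ℚₚ.1/pos⇒pos B}} e}}
    , trans (sym (ℚₚ.*-assoc B 1/B e))
            (trans (cong (ℚ._* e) (ℚₚ.*-inverseʳ B)) (ℚₚ.*-identityˡ e))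
    where
    instance
      _ = ℚ.positive 0<B
      _ = ℚ.positive 0<e
      _ = ℚₚ.pos⇒nonZero B
    1/B = ℚ.1/ B

infixl 6 _+ℝ_ _-ℝ_
infixl 7 _*ℝ_
infix  8 -ℝ_

_+ℝ_ : ℝ → ℝ → ℝ
x +ℝ y = mkℝ (λ n → seq x n ℚ.+ seq y n) λ e 0<e →
  let (M , f) = cauchy x (½ ℚ.* e) (½*-pos 0<e)
      (N , g) = cauchy y (½ ℚ.* e) (½*-pos 0<e)
  in M ℕ.⊔ N , λ m n hm hn → ℚₚ.≤-trans
       (ℚₚ.≤-reflexive (cong ∣_∣ (+-regroup (seq x m) (seq y m) (seq x n) (seq y n))))
       (ℚₚ.≤-trans (ℚₚ.∣p+q∣≤∣p∣+∣q∣ (seq x m ℚ.- seq x n) (seq y m ℚ.- seq y n))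
       (ℚₚ.≤-trans (ℚₚ.+-mono-≤ (f m n (max-l hm) (max-l hn)) (g m n (max-r hm) (max-r hn)))
                   (ℚₚ.≤-reflexive (halves e))))

-ℝ_ : ℝ → ℝ
-ℝ x = mkℝ (λ n → ℚ.- seq x n) λ e 0<e →
  let (N , f) = cauchy x e 0<e
  in N , λ m n hm hn → subst (_≤ e)
       (sym (trans (cong ∣_∣ (-‿regroup (seq x m) (seq x n))) (ℚₚ.∣-p∣≡∣p∣ (seq x m ℚ.- seq x n))))
       (f m n hm hn)

_-ℝ_ : ℝ → ℝ → ℝ
x -ℝ y = x +ℝ -ℝ y

_*ℝ_ : ℝ → ℝ → ℝ
x *ℝ y = mkℝ (λ n → seq x n ℚ.* seq y n) λ e 0<e →
  let (A , K , 0<A , bx)  = bound x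
      (B , L , 0<B , by)  = bound y
      (δ , 0<δ , eq)      = divide e (A ℚ.+ B) 0<e (ℚₚ.+-mono-< 0<A 0<B)
      (M , f)             = cauchy x δ 0<δ
      (N , g)             = cauchy y δ 0<δ
  in (K ℕ.⊔ L) ℕ.⊔ (M ℕ.⊔ N) , λ m n hm hn →
       let xm = seq x m ; xn = seq x n ; ym = seq y m ; yn = seq y n in
       ℚₚ.≤-trans (ℚₚ.≤-reflexive (cong ∣_∣ (*-regroup xm ym xn yn)))
       (ℚₚ.≤-trans (ℚₚ.∣p+q∣≤∣p∣+∣q∣ (xm ℚ.* (ym ℚ.- yn)) ((xm ℚ.- xn) ℚ.* yn))
       (ℚₚ.≤-trans (ℚₚ.≤-reflexive (cong₂ ℚ._+_ (ℚₚ.∣p*q∣≡∣p∣*∣q∣ xm (ym ℚ.- yn))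
                                                (ℚₚ.∣p*q∣≡∣p∣*∣q∣ (xm ℚ.- xn) yn)))
       (ℚₚ.≤-trans (ℚₚ.+-mono-≤
          (*-mono (ℚₚ.0≤∣p∣ (ym ℚ.- yn)) (ℚₚ.<⇒≤ 0<A)
                  (bx m (max-l {K} (max-l {K ℕ.⊔ L} hm)))
                  (g m n (max-r {M} (max-r {K ℕ.⊔ L} hm)) (max-r {M} (max-r {K ℕ.⊔ L} hn))))
          (*-mono (ℚₚ.0≤∣p∣ yn) (ℚₚ.<⇒≤ 0<δ)
                  (f m n (max-l {M} (max-r {K ℕ.⊔ L} hm)) (max-l {M} (max-r {K ℕ.⊔ L} hn)))
                  (by n (max-r {K} (max-l {K ℕ.⊔ L} hn)))))
       (ℚₚ.≤-reflexive (trans (cong (A ℚ.* δ ℚ.+_) (ℚₚ.*-comm δ B))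
                       (trans (sym (ℚₚ.*-distribʳ-+ δ A B)) eq))))))

------------------------------------------------------------------------
-- Model of computation.  A program uses a fixed number of stacks over a fixed
-- finite alphabet, and each step inspects or changes the top of one stack.
-- This is a structured form of the multi-tape Turing machine (a tape is a pair
-- of stacks), and either simulates the other with constant overhead per step.

data Symbol : Set where
  bit0 bit1 comma semicolon : Symbol

Word : Set
Word = List Symbol

-- A test looks at the top symbol, which is `nothing` on an empty stack.
Test : Set
Test = Maybe Symbol → Bool

data Command (k : ℕ) : Set where
  skip  : Command k
  push  : Fin k → Symbol → Command k
  pop   : Fin k → Command k
  _⨾_   : Command k → Command k → Command k
  if    : Fin k → Test → Command k → Command k → Command k
  while : Fin k → Test → Command k → Command k

Store : ℕ → Set
Store = Vec Word

top : ∀ {k} → Store k → Fin k → Maybe Symbol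
top σ i = Data.List.head (lookup σ i)

-- ⟨ p , σ ⟩⇓ τ in[ t ] : started in store σ, p halts in store τ after t steps.
data ⟨_,_⟩⇓_in[_] {k : ℕ} : Command k → Store k → Store k → ℕ → Set where
  ⇓skip : ∀ {σ} → ⟨ skip , σ ⟩⇓ σ in[ 1 ]
  ⇓push : ∀ {σ i a} → ⟨ push i a , σ ⟩⇓ updateAt σ i (a ∷_) in[ 1 ]
  ⇓pop  : ∀ {σ i} → ⟨ pop i , σ ⟩⇓ updateAt σ i (Data.List.drop 1) in[ 1 ]
  ⇓seq  : ∀ {σ τ υ p q s t} →
          ⟨ p , σ ⟩⇓ τ in[ s ] → ⟨ q , τ ⟩⇓ υ in[ t ] →
          ⟨ p ⨾ q , σ ⟩⇓ υ in[ s ℕ.+ t ]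
  ⇓then : ∀ {σ τ i b p q t} → b (top σ i) ≡ true →
          ⟨ p , σ ⟩⇓ τ in[ t ] → ⟨ if i b p q , σ ⟩⇓ τ in[ suc t ]
  ⇓else : ∀ {σ τ i b p q t} → b (top σ i) ≡ false →
          ⟨ q , σ ⟩⇓ τ in[ t ] → ⟨ if i b p q , σ ⟩⇓ τ in[ suc t ]
  ⇓loop : ∀ {σ τ υ i b p s t} → b (top σ i) ≡ true →
          ⟨ p , σ ⟩⇓ τ in[ s ] → ⟨ while i b p , τ ⟩⇓ υ in[ t ] →
          ⟨ while i b p , σ ⟩⇓ υ in[ suc (s ℕ.+ t) ]
  ⇓exit : ∀ {σ i b p} → b (top σ i) ≡ false →
          ⟨ while i b p , σ ⟩⇓ σ in[ 1 ]

record Program : Set where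
  field
    extraStacks : ℕ
    body        : Command (suc extraStacks)

-- The input is the initial content of stack zero, the other stacks being
-- empty; the output is the final content of stack zero.
_on_outputs_in[_] : Program → Word → Word → ℕ → Set
P on u outputs v in[ t ] =
  ∃[ τ ] ⟨ body , u Vec.∷ replicate extraStacks [] ⟩⇓ τ in[ t ] × Vec.head τ ≡ v
  where open Program P

------------------------------------------------------------------------
-- Minimization problems and approximation algorithms

record MinimizationProblem : Set₁ where
  field
    Instance       : Set
    Feasible       : Instance → Set
    cost           : {I : Instance} → Feasible I → ℚ
    encodeInstance : Instance → Word
    encodeSolution : {I : Instance} → Feasible I → Word

  IsMinimum : {I : Instance} → Feasible I → Set
  IsMinimum {I} O = (S : Feasible I) → cost O ≤ cost S

record ApproximationAlgorithm (β : ℝ) (Π : MinimizationProblem) : Set where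
  open MinimizationProblem Π
  field
    program            : Program
    coefficient degree : ℕ
    correct : (I : Instance) →
      ∃[ S ] ∃[ t ]
        program on encodeInstance I outputs encodeSolution {I} S in[ t ] ×
        t ℕ.≤ coefficient ℕ.* suc (length (encodeInstance I)) ℕ.^ degree ×
        ∃[ O ] IsMinimum {I} O × fromℚ (cost S) ≤ℝ β *ℝ fromℚ (cost O)

------------------------------------------------------------------------
-- Encodings

-- Least significant bit first, in the bijective binary system of
-- Data.Nat.Binary (digits "1" and "2"), of length ⌊log₂ (n + 1)⌋.
bits : ℕᵇ → Word
bits ℕᵇ.zero  = []
bits 2[1+ x ] = bit1 ∷ bits x
bits 1+[2 x ] = bit0 ∷ bits x

encodeℕ : ℕ → Word
encodeℕ n = bits (ℕᵇ.fromℕ n) ++ comma ∷ []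

-- Used for nonnegative rationals only, so the sign is omitted.
encodeℚ : ℚ → Word
encodeℚ q = encodeℕ ℤ.∣ ↥ q ∣ ++ encodeℕ (↧ₙ q)

encodeFins : ∀ {n} → List (Fin n) → Word
encodeFins = concatMap (λ i → encodeℕ (toℕ i))

encodeMatrix : ∀ n → (Fin n → Fin n → ℚ) → Word
encodeMatrix n c = concatMap (λ i → concatMap (λ j → encodeℚ (c i j)) (allFin n)) (allFin n)

------------------------------------------------------------------------
-- Semi-metrics and cycles.  Problem data are rational, as instances are
-- inputs of algorithms.

record SemiMetric (X : Set) : Set where
  field
    dist        : X → X → ℚ
    nonnegative : ∀ x y → 0ℚ ≤ dist x y
    symmetric   : ∀ x y → dist x y ≡ dist y x
    self        : ∀ x → dist x x ≡ 0ℚ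
    triangle    : ∀ x y z → dist x z ≤ dist x y ℚ.+ dist y z

sumℚ : List ℚ → ℚ
sumℚ = foldr ℚ._+_ 0ℚ

pathCost : {X : Set} → (X → X → ℚ) → X → List X → X → ℚ
pathCost c x []       z = c x z
pathCost c x (y ∷ ys) z = c x y ℚ.+ pathCost c y ys z

-- The list gives the vertices in cyclic order; a cycle on two vertices x, y
-- uses the edge {x, y} twice.
cycleCost : {X : Set} → (X → X → ℚ) → List X → ℚ
cycleCost c []       = 0ℚ
cycleCost c (x ∷ xs) = pathCost c x xs x

------------------------------------------------------------------------
-- Traveling salesman problem

record TSPInstance : Set where
  field
    size   : ℕ
    metric : SemiMetric (Fin size)
  open SemiMetric metric public

record TSPTour (I : TSPInstance) : Set where
  open TSPInstance I
  field
    order       : List (Fin size)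
    hamiltonian : order ↭ allFin size

TSP : MinimizationProblem
TSP = record
  { Instance       = TSPInstance
  ; Feasible       = TSPTour
  ; cost           = λ {I} T → cycleCost (TSPInstance.dist I) (TSPTour.order T)
  ; encodeInstance = λ I → let open TSPInstance I in encodeℕ size ++ encodeMatrix size dist
  ; encodeSolution = λ T → encodeFins (TSPTour.order T)
  }

------------------------------------------------------------------------
-- Capacitated Vehicle Routing.  V = Fin customers; the set {s} ∪ V is
-- Fin (suc customers), with s = zero and the customer v embedded as suc v.

record CVRPInstance : Set where
  field
    customers : ℕ
    metric    : SemiMetric (Fin (suc customers))
    demand    : Fin customers → ℚ
    demand≥0  : ∀ v → 0ℚ ≤ demand v
    demand≤1  : ∀ v → demand v ≤ 1ℚ
  open SemiMetric metric public

  Tour : Set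
  Tour = List⁺ (Fin customers)

  tourCost : Tour → ℚ
  tourCost Q = cycleCost dist (zero ∷ map suc (toList Q))

  tourDemand : Tour → ℚ
  tourDemand Q = sumℚ (map demand (toList Q))

record CVRPSolution (I : CVRPInstance) : Set where
  open CVRPInstance I
  field
    tours     : List Tour
    partition : concat (map toList tours) ↭ allFin customers
    capacity  : All (λ Q → tourDemand Q ≤ 1ℚ) tours

CVRP : MinimizationProblem
CVRP = record
  { Instance       = CVRPInstance
  ; Feasible       = CVRPSolution
  ; cost           = λ {I} S → sumℚ (map (CVRPInstance.tourCost I) (CVRPSolution.tours S))
  ; encodeInstance = λ I → let open CVRPInstance I in
      encodeℕ customers ++ encodeMatrix (suc customers) dist ++
      concatMap (λ v → encodeℚ (demand v)) (allFin customers)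
  ; encodeSolution = λ S →
      concatMap (λ Q → encodeFins (toList Q) ++ semicolon ∷ []) (CVRPSolution.tours S)
  }

{-# OPTIONS --safe #-}
-- One algorithm gives ε = 1/96 for every α.  Fix a threshold a < 1/2 and call a customer big if its
-- demand exceeds a.  Big customers are matched greedily into pairs that fit into one tour and whose
-- distance is small compared with their distances to the depot; pairs and unmatched big customers
-- get tours of their own.  The small customers are split optimally into consecutive segments of the
-- traveling salesman tour; averaging over equidistant cut positions shows that this costs at most
-- the traveling salesman tour plus 1/(1-a) times the radial cost Σ 2 d(v) c(s,v).
--
-- The share of an optimal tour P in the excess over the traveling salesman tour is at most 2 c(P):
-- two unmatched customers of P are far apart, a matched one costs at most 5/8 c(P), and the demands
-- in P sum up to at most 1.  The share is bounded away from 2 c(P) unless P has a single big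
-- customer, which is unmatched and has demand close to a.  As this cannot happen for both a = 2/5
-- and a = 4/9, the better one of the two solutions gains a constant factor.
--
-- Running times: data are binary trees in prefix code, and a function is polynomial-time computable
-- if a fixed program on three stacks replaces the code of the argument by the code of the value in
-- polynomial time.  These functions are closed under composition, pairing, case distinction, and
-- folds whose intermediate states have polynomial size.
module Submission where

-- In the analysis, customers of demand at most a in a tour P pay at most d(v)/(1-a) times c(P),
-- because 2 c(s,v) is at most c(P), and an unmatched big customer pays at most c(P). One unmatched
-- big customer of demand about a together with small demands of sum 1-a is therefore charged up to
-- 2 c(P), whatever the threshold is; moving the threshold from 2/5 to 4/9 destroys this
-- coincidence. Thresholds of the form p/(2p+1) give the cuts the spacing (p+1)/(2p+1), so that
-- everything stays in natural numbers. For 2/5 a good tour pays at most 47/48 of 2 c(P); the other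
-- solution may gain nothing on it, and the plain average of both gains 1/96. The matching only has
-- to be maximal, which is why a greedy one suffices. The averaged cuts exist but are never
-- computed: the dynamic program is at least as good as any of them. Instances are rational, so
-- common denominators are cleared before any comparison. The definition of an approximation
-- algorithm also demands that the minimum be attained; this is shown by enumeration, outside the
-- algorithm.

open import Defs
open import Data.Bool using (true; false; Bool; if_then_else_; _∧_; not; T)
open import Data.Bool.Properties using (T?; T-∧)
open import Data.Fin using (Fin; zero; suc; toℕ; _↑ˡ_; _↑ʳ_)
open import Data.List using ([]; _∷_; length; List; _++_; foldl; [_]; map; concat; concatMap; foldr; reverse;
  filterᵇ; replicate; tabulate; allFin; _ʳ++_)
open import Data.List.Membership.Propositional using (_∈_)
open import Data.List.NonEmpty as List⁺ using (toList; List⁺)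
open import Data.List.Properties using (++-assoc; ++-identityʳ; foldl-++; reverse-involutive; reverse-foldl;
  length-++; map-++; concat-++; filter-none; reverse-map; map-id; map-cong; map-∘; length-map; ʳ++-defn;
  map-tabulate; map-cong-local; reverse-++; ∷-injective; concatMap-map; concatMap-++; length-replicate;
  length-tabulate; length-reverse)
open import Data.Nat.ListAction using (sum)
open import Data.Nat.Tactic.RingSolver using (solve-∀)
open import Data.Product using (∃-syntax; _×_; _,_; proj₁; proj₂)
open import Data.Sum using (inj₁; inj₂; _⊎_)
open import Data.Unit using (⊤; tt)
open import Function using (flip; _∘_)
open import Relation.Binary.PropositionalEquality using (_≡_; refl; sym; trans; cong; subst;
  module ≡-Reasoning; cong₂; _≢_; setoid; resp₂; subst₂)
open import Relation.Nullary using (yes; no; contradiction; does; Dec)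

-- Stack programs that move and copy coded trees.

module StackMachine where

  open import Data.Maybe using (just; nothing)
  open import Data.Nat using (ℕ; zero; suc; _+_; _*_; _≤_; z≤n; s≤s)
  open import Data.Nat.Properties using (≤-refl; ≤-trans; ≤-reflexive; +-mono-≤; +-monoʳ-≤; +-suc; +-assoc;
      *-monoʳ-≤; *-distribʳ-+; m≤m+n; n≤1+n; *-identityʳ; *-comm)
  open import Data.Vec using ([]; _∷_; lookup; updateAt)

  -- Only an upper bound on the number of steps is kept, so that times can be rounded up to simple
  -- expressions when runs are composed.
  Run : ∀ {k} → Command k → Store k → Store k → ℕ → Set
  Run p σ τ b = ∃[ t ] ⟨ p , σ ⟩⇓ τ in[ t ] × t ≤ b

  within : ∀ {k} {p : Command k} {σ τ a b} → a ≤ b → Run p σ τ a → Run p σ τ b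
  within a≤b (t , r , t≤a) = t , r , ≤-trans t≤a a≤b

  skip-run : ∀ {k} {σ : Store k} → Run skip σ σ 1
  skip-run = 1 , ⇓skip , ≤-refl

  push-run : ∀ {k} {σ : Store k} {i a} → Run (push i a) σ (updateAt σ i (a ∷_)) 1
  push-run = 1 , ⇓push , ≤-refl

  pop-run : ∀ {k} {σ : Store k} {i} → Run (pop i) σ (updateAt σ i (Data.List.drop 1)) 1
  pop-run = 1 , ⇓pop , ≤-refl

  infixr 4 _⨾ʳ_
  _⨾ʳ_ : ∀ {k} {p q : Command k} {σ τ υ a b} → Run p σ τ a → Run q τ υ b → Run (p ⨾ q) σ υ (a + b)
  (s , r , s≤) ⨾ʳ (t , r′ , t≤) = s + t , ⇓seq r r′ , +-mono-≤ s≤ t≤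

  then-run : ∀ {k} {σ τ : Store k} {i b p q a} → b (top σ i) ≡ true →
             Run p σ τ a → Run (if i b p q) σ τ (suc a)
  then-run e (t , r , t≤) = suc t , ⇓then e r , s≤s t≤

  else-run : ∀ {k} {σ τ : Store k} {i b p q a} → b (top σ i) ≡ false →
             Run q σ τ a → Run (if i b p q) σ τ (suc a)
  else-run e (t , r , t≤) = suc t , ⇓else e r , s≤s t≤

  loop-run : ∀ {k} {σ τ υ : Store k} {i b p a c} → b (top σ i) ≡ true →
             Run p σ τ a → Run (while i b p) τ υ c → Run (while i b p) σ υ (suc (a + c))
  loop-run e (s , r , s≤) (t , r′ , t≤) = suc (s + t) , ⇓loop e r r′ , s≤s (+-mono-≤ s≤ t≤)

  exit-run : ∀ {k} {σ : Store k} {i b p} → b (top σ i) ≡ false → Run (while i b p) σ σ 1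
  exit-run e = 1 , ⇓exit e , ≤-refl

  total : ∀ {k} → Store k → ℕ
  total []      = 0
  total (u ∷ σ) = length u + total σ

  private
    total-push : ∀ {k} (σ : Store k) i a → total (updateAt σ i (a ∷_)) ≡ suc (total σ)
    total-push (u ∷ σ) zero    a = refl
    total-push (u ∷ σ) (suc i) a = trans (cong (length u +_) (total-push σ i a)) (+-suc (length u) (total σ))

    total-pop : ∀ {k} (σ : Store k) i → total (updateAt σ i (Data.List.drop 1)) ≤ total σ
    total-pop ([] ∷ σ)      zero    = ≤-refl
    total-pop ((x ∷ u) ∷ σ) zero    = n≤1+n _
    total-pop (u ∷ σ)       (suc i) = +-monoʳ-≤ (length u) (total-pop σ i)

  -- A step pushes at most one symbol. Time bounds thus yield size bounds, both for the values of
  -- `Poly` functions and for the answers of an arbitrary program.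
  total-grows : ∀ {k} {p : Command k} {σ τ t} → ⟨ p , σ ⟩⇓ τ in[ t ] → total τ ≤ total σ + t
  total-grows {σ = σ} ⇓skip = m≤m+n _ 1
  total-grows {σ = σ} (⇓push {i = i} {a}) = ≤-reflexive (trans (total-push σ i a) (solve-suc (total σ)))
    where
    solve-suc : ∀ n → suc n ≡ n + 1
    solve-suc = solve-∀
  total-grows {σ = σ} (⇓pop {i = i}) = ≤-trans (total-pop σ i) (m≤m+n _ 1)
  total-grows {σ = σ} (⇓seq {s = s} {t} r r′) =
    ≤-trans (total-grows r′) (≤-trans (+-mono-≤ (total-grows r) ≤-refl) (≤-reflexive (+-assoc (total σ) s t)))
  total-grows {σ = σ} (⇓then e r) = ≤-trans (total-grows r) (+-monoʳ-≤ (total σ) (n≤1+n _))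
  total-grows {σ = σ} (⇓else e r) = ≤-trans (total-grows r) (+-monoʳ-≤ (total σ) (n≤1+n _))
  total-grows {σ = σ} (⇓loop {s = s} {t} e r r′) =
    ≤-trans (total-grows r′) (≤-trans (+-mono-≤ (total-grows r) ≤-refl)
      (≤-trans (≤-reflexive (+-assoc (total σ) s t)) (+-monoʳ-≤ (total σ) (n≤1+n _))))
  total-grows (⇓exit e) = m≤m+n _ 1

  -- Prefix code of binary trees; t ▹ u is the result of moving the code of t symbol by symbol onto u.

  data Tree : Set where
    leaf : Tree
    node : Tree → Tree → Tree

  size : Tree → ℕ
  size leaf       = 1
  size (node a b) = suc (size a + size b)

  1≤size : ∀ t → 1 ≤ size t
  1≤size leaf       = s≤s z≤n
  1≤size (node a b) = s≤s z≤n

  infixr 5 _◂_ _▹_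

  _◂_ : Tree → Word → Word
  leaf     ◂ u = bit0 ∷ u
  node a b ◂ u = bit1 ∷ a ◂ b ◂ u

  _▹_ : Tree → Word → Word
  leaf     ▹ u = bit0 ∷ u
  node a b ▹ u = b ▹ a ▹ bit1 ∷ u

  length-◂ : ∀ t u → length (t ◂ u) ≡ size t + length u
  length-◂ leaf       u = refl
  length-◂ (node a b) u = cong suc (trans (length-◂ a _)
    (trans (cong (size a +_) (length-◂ b u)) (sym (+-assoc (size a) (size b) (length u)))))

  is0 is1 isComma isBit nonEmpty : Test
  is0 (just bit0) = true
  is0 _           = false
  is1 (just bit1) = true
  is1 _           = false
  isComma (just comma) = true
  isComma _            = false
  isBit (just bit0) = true
  isBit (just bit1) = true
  isBit _           = false
  nonEmpty (just _) = true
  nonEmpty nothing  = false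

  -- A test yields a single bit, so three tests are spent on telling the four symbols apart; the
  -- last branch is the default.
  by-symbol : ∀ {k} → Fin k → (Symbol → Command k) → Command k
  by-symbol i p = if i is1 (p bit1) (if i is0 (p bit0) (if i isComma (p comma) (p semicolon)))

  pour : ∀ {k} → Fin k → Fin k → Test → Command k
  pour i j b = while i b (by-symbol i λ a → pop i ⨾ push j a)

  -- S u v is a store with u and v on the stacks i and j, all other stacks being fixed.
  module Pour {k} (i j : Fin k) (b : Test) (S : Word → Word → Store k)
    (topS  : ∀ u v → lookup (S u v) i ≡ u)
    (popS  : ∀ a u v → updateAt (S (a ∷ u) v) i (Data.List.drop 1) ≡ S u v)
    (pushS : ∀ a u v → updateAt (S u v) j (a ∷_) ≡ S u (a ∷ v)) where

    private
      move : ∀ a {u v} → Run (pop i ⨾ push j a) (S (a ∷ u) v) (S u (a ∷ v)) 2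
      move a {u} {v} = subst (λ σ → Run (pop i ⨾ push j a) (S (a ∷ u) v) σ 2) (pushS a u v)
        (subst (λ σ → Run (pop i) (S (a ∷ u) v) σ 1) (popS a u v) pop-run ⨾ʳ push-run)

      top≡ : ∀ (c : Test) {a u v} → c (top (S (a ∷ u) v) i) ≡ c (just a)
      top≡ c {a} {u} {v} = cong (λ w → c (Data.List.head w)) (topS (a ∷ u) v)

      body-run : ∀ a {u v} → Run (by-symbol i λ a → pop i ⨾ push j a) (S (a ∷ u) v) (S u (a ∷ v)) 5
      body-run bit1      = within (s≤s (s≤s (s≤s z≤n))) (then-run (top≡ is1) (move bit1))
      body-run bit0      = within (s≤s (s≤s (s≤s (s≤s z≤n))))
          (else-run (top≡ is1) (then-run (top≡ is0) (move bit0)))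
      body-run comma     = else-run (top≡ is1) (else-run (top≡ is0) (then-run (top≡ isComma) (move comma)))
      body-run semicolon = else-run (top≡ is1) (else-run (top≡ is0) (else-run (top≡ isComma) (move semicolon)))

    step : ∀ {a u v τ n} → b (just a) ≡ true →
           Run (pour i j b) (S u (a ∷ v)) τ n → Run (pour i j b) (S (a ∷ u) v) τ (6 + n)
    step e r = loop-run (trans (top≡ b) e) (body-run _) r

    stop : ∀ {u v} → b (Data.List.head u) ≡ false → Run (pour i j b) (S u v) (S u v) 1
    stop {u} {v} e = exit-run (trans (cong (λ w → b (Data.List.head w)) (topS u v)) e)

    module _ (b0 : b (just bit0) ≡ true) (b1 : b (just bit1) ≡ true) where
      private
        node-time : ∀ x y n → 6 * x + (6 * y + (6 + n)) ≡ 6 * suc (y + x) + n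
        node-time = solve-∀

        node-time′ : ∀ x y n → 6 + (6 * x + (6 * y + n)) ≡ 6 * suc (x + y) + n
        node-time′ = solve-∀

      pour-▹ : ∀ t {u v τ n} → Run (pour i j b) (S u (t ◂ v)) τ n →
               Run (pour i j b) (S (t ▹ u) v) τ (6 * size t + n)
      pour-▹ leaf       r = step b0 r
      pour-▹ (node x y) {n = n} r = within (≤-reflexive (node-time (size y) (size x) n))
          (pour-▹ y (pour-▹ x (step b1 r)))

      pour-◂ : ∀ t {u v τ n} → Run (pour i j b) (S u (t ▹ v)) τ n →
               Run (pour i j b) (S (t ◂ u) v) τ (6 * size t + n)
      pour-◂ leaf       r = step b0 r
      pour-◂ (node x y) {n = n} r = within (≤-reflexive (node-time′ (size x) (size y) n))
          (step b1 (pour-◂ x (pour-◂ y r)))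

  -- The three working stacks: data, put-aside trees (each on top of a semicolon), and a
  -- temporary one, which is empty between operations.

  St : Word → Word → Word → Store 3
  St u v w = u ∷ v ∷ w ∷ []

  #0 #1 #2 : Fin 3
  #0 = zero
  #1 = suc zero
  #2 = suc (suc zero)

  -- Tree sizes are positive and absorb additive constants, which leaves time bounds that are plain
  -- multiples of the size.
  affine : ∀ a b {s} → 1 ≤ s → a * s + b ≤ s * (a + b)
  affine a b {s} 1≤s = ≤-trans (+-monoʳ-≤ (a * s) (≤-trans (≤-reflexive (sym (*-identityʳ b)))
      (*-monoʳ-≤ b 1≤s)))
    (≤-reflexive (trans (sym (*-distribʳ-+ s a b)) (*-comm (a + b) s)))

  -- Stack 2 counts the subtrees that are still to be read.
  grab : Command 3
  grab = while #2 nonEmpty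
    (if #0 is1 (pop #0 ⨾ (push #1 bit1 ⨾ push #2 comma)) (pop #0 ⨾ (push #1 bit0 ⨾ pop #2)))

  -- A node replaces one awaited subtree by two. The remaining run of the loop is a parameter of the
  -- statement, because both subtrees are read by the same loop.
  grab-run : ∀ t {u v w τ n} → Run grab (St u (t ▹ v) w) τ n →
             Run grab (St (t ◂ u) v (comma ∷ w)) τ (5 * size t + n)
  grab-run leaf r = loop-run refl (else-run refl (pop-run ⨾ʳ push-run ⨾ʳ pop-run)) r
  grab-run (node x y) {n = n} r = within (≤-reflexive (time (size x) (size y) n))
    (loop-run refl (then-run refl (pop-run ⨾ʳ push-run ⨾ʳ push-run)) (grab-run x (grab-run y r)))
    where
    time : ∀ x y n → 5 + (5 * x + (5 * y + n)) ≡ 5 * suc (x + y) + n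
    time = solve-∀

  stash : Command 3
  stash = push #1 semicolon ⨾ (push #2 comma ⨾ grab)

  stash-run : ∀ t {u v} → Run stash (St (t ◂ u) v []) (St u (t ▹ semicolon ∷ v) []) (size t * 8)
  stash-run t = within (≤-trans (≤-reflexive (time (size t))) (affine 5 3 (1≤size t)))
    (push-run ⨾ʳ push-run ⨾ʳ grab-run t (exit-run refl))
    where
    time : ∀ s → 1 + (1 + (5 * s + 1)) ≡ 5 * s + 3
    time = solve-∀

  unstash : Command 3
  unstash = pour #1 #0 isBit ⨾ pop #1

  unstash-run : ∀ t {u v w} → Run unstash (St u (t ▹ semicolon ∷ v) w) (St (t ◂ u) v w) (size t * 8)
  unstash-run t {w = w} = within (≤-trans (≤-reflexive (+-assoc (6 * size t) 1 1)) (affine 6 2 (1≤size t)))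
    (pour-▹ refl refl t (stop refl) ⨾ʳ pop-run)
    where open Pour #1 #0 isBit (λ u v → St v u w) (λ _ _ → refl) (λ _ _ _ → refl) (λ _ _ _ → refl)

  restash : Command 3
  restash = push #1 semicolon ⨾ pour #2 #1 isBit

  restash-run : ∀ t {u v} → Run restash (St u v (t ◂ [])) (St u (t ▹ semicolon ∷ v) []) (size t * 8)
  restash-run t {u} = within (≤-trans (≤-reflexive (time (size t))) (affine 6 2 (1≤size t)))
    (push-run ⨾ʳ pour-◂ refl refl t (stop refl))
    where
    open Pour #2 #1 isBit (λ w v → St u v w) (λ _ _ → refl) (λ _ _ _ → refl) (λ _ _ _ → refl)
    time : ∀ s → 1 + (6 * s + 1) ≡ 6 * s + 2
    time = solve-∀

  clear : Command 3
  clear = while #1 isBit (pop #1)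

  clear-run : ∀ t {u v w τ n} → Run clear (St u v w) τ n → Run clear (St u (t ▹ v) w) τ (2 * size t + n)
  clear-run leaf r = loop-run refl pop-run r
  clear-run (node x y) {n = n} r = within (≤-reflexive (time (size y) (size x) n))
    (clear-run y (clear-run x (loop-run refl pop-run r)))
    where
    time : ∀ x y n → 2 * x + (2 * y + (2 + n)) ≡ 2 * suc (y + x) + n
    time = solve-∀

  discard : Command 3
  discard = stash ⨾ (clear ⨾ pop #1)

  discard-run : ∀ t {u v} → Run discard (St (t ◂ u) v []) (St u v []) (size t * 12)
  discard-run t = within (≤-trans (≤-reflexive (time (size t))) (affine 10 2 (1≤size t)))
    (stash-run t ⨾ʳ clear-run t (exit-run refl) ⨾ʳ pop-run)
    where
    time : ∀ s → s * 8 + (2 * s + 1 + 1) ≡ 10 * s + 2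
    time = solve-∀

  pour₂ : Command 3
  pour₂ = while #1 isBit
    (if #1 is1 (pop #1 ⨾ (push #0 bit1 ⨾ push #2 bit1)) (pop #1 ⨾ (push #0 bit0 ⨾ push #2 bit0)))

  pour₂-run : ∀ t {u v w τ n} → Run pour₂ (St (t ◂ u) v (t ◂ w)) τ n → Run pour₂ (St u (t ▹ v) w) τ
      (5 * size t + n)
  pour₂-run leaf r = loop-run refl (else-run refl (pop-run ⨾ʳ push-run ⨾ʳ push-run)) r
  pour₂-run (node x y) {n = n} r = within (≤-reflexive (time (size y) (size x) n))
    (pour₂-run y (pour₂-run x (loop-run refl (then-run refl (pop-run ⨾ʳ push-run ⨾ʳ push-run)) r)))
    where
    time : ∀ x y n → 5 * x + (5 * y + (5 + n)) ≡ 5 * suc (y + x) + n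
    time = solve-∀

  -- `pour₂` leaves one copy on stack 0 and one on the temporary stack. The latter reaches stack 0
  -- by way of stack 1, since each transfer reverses the code.
  dup : Command 3
  dup = stash ⨾ (pour₂ ⨾ (pop #1 ⨾ (restash ⨾ unstash)))

  dup-run : ∀ t {u v} → Run dup (St (t ◂ u) v []) (St (t ◂ t ◂ u) v []) (size t * 31)
  dup-run t = within (≤-trans (≤-reflexive (time (size t))) (affine 29 2 (1≤size t)))
    (stash-run t ⨾ʳ pour₂-run t (exit-run refl) ⨾ʳ pop-run ⨾ʳ restash-run t ⨾ʳ unstash-run t)
    where
    time : ∀ s → s * 8 + (5 * s + 1 + (1 + (s * 8 + s * 8))) ≡ 29 * s + 2
    time = solve-∀

  swap : Command 3
  swap = stash ⨾ (stash ⨾ (pour #1 #2 isBit ⨾ (pop #1 ⨾ (unstash ⨾ (restash ⨾ unstash)))))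

  swap-run : ∀ s t {u v} → Run swap (St (s ◂ t ◂ u) v []) (St (t ◂ s ◂ u) v []) ((size s + size t) * 32)
  swap-run s t {u} {v} = within (time (size s) (size t) (1≤size s))
    (stash-run s ⨾ʳ stash-run t ⨾ʳ pour-▹ refl refl t (stop refl) ⨾ʳ pop-run
      ⨾ʳ unstash-run s ⨾ʳ restash-run t ⨾ʳ unstash-run t)
    where
    open Pour #1 #2 isBit (λ v w → St u v w) (λ _ _ → refl) (λ _ _ _ → refl) (λ _ _ _ → refl)
    exact : ∀ s t → s * 8 + (t * 8 + (6 * t + 1 + (1 + (s * 8 + (t * 8 + t * 8))))) ≡ (16 * s + 2) + 30 * t
    exact = solve-∀
    total′ : ∀ s t → (32 * s) + 32 * t ≡ (s + t) * 32
    total′ = solve-∀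
    16s+2≤ : ∀ s → 1 ≤ s → 16 * s + 2 ≤ 32 * s
    16s+2≤ s 1≤s = ≤-trans (affine 16 2 1≤s) (≤-trans (≤-reflexive (*-comm s 18))
        (≤-trans (m≤m+n (18 * s) (14 * s)) (≤-reflexive (sym (*-distribʳ-+ s 18 14)))))
    time : ∀ s t → 1 ≤ s → s * 8 + (t * 8 + (6 * t + 1 + (1 + (s * 8 + (t * 8 + t * 8))))) ≤ (s + t) * 32
    time s t 1≤s = ≤-trans (≤-reflexive (exact s t)) (≤-trans (+-mono-≤ (16s+2≤ s 1≤s)
       (≤-trans (m≤m+n (30 * t) (2 * t)) (≤-reflexive (sym (*-distribʳ-+ t 30 2))))) (≤-reflexive (total′ s t)))

  pushTree : Tree → Command 3
  pushTree leaf       = push #0 bit0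
  pushTree (node s t) = pushTree t ⨾ (pushTree s ⨾ push #0 bit1)

  pushTree-run : ∀ t {u v w} → Run (pushTree t) (St u v w) (St (t ◂ u) v w) (size t)
  pushTree-run leaf       = push-run
  pushTree-run (node s t) = within (≤-reflexive (reorder (size t) (size s)))
    (pushTree-run t ⨾ʳ pushTree-run s ⨾ʳ push-run)
    where
    reorder : ∀ t s → t + (s + 1) ≡ suc (s + t)
    reorder = solve-∀

-- Polynomial-time functions on coded data and their closure properties.

module PolyTime where

  open StackMachine
  open import Data.Nat using (ℕ; zero; suc; _+_; _*_; _^_; _≤_; z≤n; s≤s)
  open import Data.Nat.Properties
  open import Data.Vec using ([]; _∷_)

  infixl 6 _⊕_
  infixl 7 _⊗_
  infixr 8 _⊙_

  -- Syntax for polynomials: every expression is monotone and composition is a constructor, so the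
  -- time bound of a composite program can be written down directly.
  data Bound : Set where
    K   : ℕ → Bound
    X   : Bound
    _⊕_ : Bound → Bound → Bound
    _⊗_ : Bound → Bound → Bound
    _⊙_ : Bound → Bound → Bound

  ⟦_⟧ : Bound → ℕ → ℕ
  ⟦ K k ⟧   n = k
  ⟦ X ⟧     n = n
  ⟦ p ⊕ q ⟧ n = ⟦ p ⟧ n + ⟦ q ⟧ n
  ⟦ p ⊗ q ⟧ n = ⟦ p ⟧ n * ⟦ q ⟧ n
  ⟦ p ⊙ q ⟧ n = ⟦ p ⟧ (⟦ q ⟧ n)

  mono : ∀ p {m n} → m ≤ n → ⟦ p ⟧ m ≤ ⟦ p ⟧ n
  mono (K k)   m≤n = ≤-refl
  mono X       m≤n = m≤n
  mono (p ⊕ q) m≤n = +-mono-≤ (mono p m≤n) (mono q m≤n)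
  mono (p ⊗ q) m≤n = *-mono-≤ (mono p m≤n) (mono q m≤n)
  mono (p ⊙ q) m≤n = mono p (mono q m≤n)

  power : ℕ → Bound
  power zero    = K 1
  power (suc k) = X ⊗ power k

  ⟦power⟧ : ∀ k n → ⟦ power k ⟧ n ≡ n ^ k
  ⟦power⟧ zero    n = refl
  ⟦power⟧ (suc k) n = cong (n *_) (⟦power⟧ k n)

  private
    1≤^ : ∀ n k → 1 ≤ suc n ^ k
    1≤^ n k = m^n>0 (suc n) k

    ^-monoʳ : ∀ n {j k} → j ≤ k → suc n ^ j ≤ suc n ^ k
    ^-monoʳ n = ^-monoʳ-≤ (suc n)

    *-^ : ∀ a b k → (a * b) ^ k ≡ a ^ k * b ^ k
    *-^ a b zero    = refl
    *-^ a b (suc k) = trans (cong (a * b *_) (*-^ a b k)) (interchange a b (a ^ k) (b ^ k))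
      where
      interchange : ∀ a b c d → a * b * (c * d) ≡ a * c * (b * d)
      interchange = solve-∀

  -- An approximation algorithm has to name a coefficient and a degree. Powers of `suc n` may be
  -- raised to a larger exponent, so sums, products and compositions stay below a monomial.
  monomial : ∀ p → ∃[ c ] ∃[ k ] ∀ n → ⟦ p ⟧ n ≤ c * suc n ^ k
  monomial (K k) = k , 0 , λ n → ≤-reflexive (sym (*-identityʳ k))
  monomial X     = 1 , 1 , λ n → ≤-trans (n≤1+n n) (≤-reflexive (sym (trans (*-identityˡ _) (*-identityʳ _))))
  monomial (p ⊕ q) with monomial p | monomial q
  ... | c , k , hp | d , l , hq = c + d , k + l , λ n → ≤-trans
    (+-mono-≤ (≤-trans (hp n) (*-monoʳ-≤ c (^-monoʳ n (m≤m+n k l))))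
              (≤-trans (hq n) (*-monoʳ-≤ d (^-monoʳ n (m≤n+m l k)))))
    (≤-reflexive (sym (*-distribʳ-+ (suc n ^ (k + l)) c d)))
  monomial (p ⊗ q) with monomial p | monomial q
  ... | c , k , hp | d , l , hq = c * d , k + l , λ n → ≤-trans (*-mono-≤ (hp n) (hq n))
    (≤-reflexive (trans (interchange c (suc n ^ k) d (suc n ^ l))
        (cong (c * d *_) (sym (^-distribˡ-+-* (suc n) k l)))))
    where
    interchange : ∀ a b c d → a * b * (c * d) ≡ a * c * (b * d)
    interchange = solve-∀
  monomial (p ⊙ q) with monomial p | monomial q
  -- This uses 1 + d (n+1)^l ≤ (1 + d) (n+1)^l, raised to the power k.
  ... | c , k , hp | d , l , hq = c * suc d ^ k , l * k , λ n → ≤-trans (hp (⟦ q ⟧ n)) (≤-trans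
    (*-monoʳ-≤ c (^-monoˡ-≤ k (+-mono-≤ (1≤^ n l) (hq n))))
    (≤-reflexive (trans (cong (c *_) (trans (*-^ (suc d) (suc n ^ l) k)
        (cong (suc d ^ k *_) (^-*-assoc (suc n) l k))))
                        (sym (*-assoc c (suc d ^ k) _)))))

  -- Definitions written with this eliminator have the form for which `caseP` builds a program.
  caseList : {A B : Set} → List A → B → (A → List A → B) → B
  caseList []       n c = n
  caseList (x ∷ xs) n c = c x xs

  -- A data type and its coding by trees, both depending on a parameter ι : Ix such as a
  -- problem instance; programs do not depend on ι.
  record Code (Ix : Set) : Set₁ where
    field
      Car : Ix → Set
      enc : ∀ {ι} → Car ι → Tree

  open Code public using (Car)

  encList : {A : Set} → (A → Tree) → List A → Tree
  encList e []       = leaf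
  encList e (x ∷ xs) = node (e x) (encList e xs)

  -- Both truth values get codes of the same size, so that the size of a list of bits depends on its length only.
  bitTree : Bool → Tree
  bitTree b = if b then node (node leaf leaf) leaf else node leaf (node leaf leaf)

  module _ {Ix : Set} where

    enc : (A : Code Ix) → ∀ {ι} → Car A ι → Tree
    enc A = Code.enc A

    sz : (A : Code Ix) → ∀ {ι} → Car A ι → ℕ
    sz A a = size (enc A a)

    1≤sz : ∀ (A : Code Ix) {ι} (a : Car A ι) → 1 ≤ sz A a
    1≤sz A a = 1≤size (enc A a)

    𝟙 𝔹 : Code Ix
    𝟙 = record { Car = λ _ → ⊤ ; enc = λ _ → leaf }
    𝔹 = record { Car = λ _ → Bool ; enc = bitTree }

    infixl 2 _⊠_
    _⊠_ : Code Ix → Code Ix → Code Ix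
    A ⊠ B = record { Car = λ ι → Car A ι × Car B ι ; enc = λ p → node (enc A (proj₁ p)) (enc B (proj₂ p)) }

    𝕃 : Code Ix → Code Ix
    𝕃 A = record { Car = λ ι → List (Car A ι) ; enc = encList (enc A) }

    -- The rest `u` of stack 0 and all of stack 1 are arbitrary and come back unchanged, so programs
    -- can run on top of stored data. Program and bound are uniform in ι; only the value may depend
    -- on it.
    record Poly (A B : Code Ix) (f : ∀ ι → Car A ι → Car B ι) : Set where
      field
        prog  : Command 3
        bound : Bound
        run   : ∀ ι a u v → Run prog (St (enc A a ◂ u) v []) (St (enc B (f ι a) ◂ u) v []) (⟦ bound ⟧ (sz A a))

    open Poly public

    module _ {A B : Code Ix} {f : ∀ ι → Car A ι → Car B ι} where

      growth : Poly A B f → Bound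
      growth F = X ⊕ bound F

      -- On otherwise empty stacks the total content is just the code, so the value exceeds the
      -- argument by at most the running time.
      out-size : (F : Poly A B f) → ∀ ι a → sz B (f ι a) ≤ ⟦ growth F ⟧ (sz A a)
      out-size F ι a with run F ι a [] []
      ... | t , r , t≤ = ≤-trans
        (≤-reflexive (sym (total-one (enc B (f ι a)))))
        (≤-trans (total-grows r) (+-mono-≤ (≤-reflexive (total-one (enc A a))) t≤))
        where
        total-one : ∀ t → total (St (t ◂ []) [] []) ≡ size t
        total-one t = trans (+-identityʳ _) (trans (length-◂ t []) (+-identityʳ _))

      ext : ∀ {g : ∀ ι → Car A ι → Car B ι} → (∀ ι a → f ι a ≡ g ι a) → Poly A B f → Poly A B g
      ext f≡g F = record { prog = prog F ; bound = bound F ; run = λ ι a u v →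
        subst (λ b → Run (prog F) (St (enc A a ◂ u) v []) (St (enc B b ◂ u) v []) (⟦ bound F ⟧ (sz A a)))
            (f≡g ι a) (run F ι a u v) }

      -- For changes of type that leave the code alone, such as regarding a pair as a cons cell.
      recode : (∀ ι a → enc A a ≡ enc B (f ι a)) → Poly A B f
      recode e = record { prog = skip ; bound = K 1 ; run = λ ι a u v →
        subst (λ t → Run skip (St (enc A a ◂ u) v []) (St (t ◂ u) v []) 1) (e ι a) skip-run }

    idP : ∀ {A} → Poly A A (λ _ a → a)
    idP = recode (λ _ _ → refl)

    infixr 9 _∘P_
    _∘P_ : ∀ {A B C g f} → Poly B C g → Poly A B f → Poly A C (λ ι a → g ι (f ι a))
    _∘P_ {A} {f = f} G F = record
      { prog  = prog F ⨾ prog G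
      ; bound = bound F ⊕ bound G ⊙ growth F
      ; run   = λ ι a u v → run F ι a u v ⨾ʳ within (mono (bound G) (out-size F ι a)) (run G ι (f ι a) u v) }

    ⟨_,_⟩P : ∀ {A B C f g} → Poly A B f → Poly A C g → Poly A (B ⊠ C) (λ ι a → f ι a , g ι a)
    ⟨_,_⟩P {A} {B} {C} {f} {g} F G = record
      { prog  = dup ⨾ (prog F ⨾ (stash ⨾ (prog G ⨾ (unstash ⨾ push #0 bit1))))
      ; bound = X ⊗ K 31 ⊕ (bound F ⊕ (growth F ⊗ K 8 ⊕ (bound G ⊕ (growth F ⊗ K 8 ⊕ K 1))))
      ; run   = λ ι a u v →
            dup-run (enc A a)
          ⨾ʳ run F ι a _ _
          ⨾ʳ within (*-monoˡ-≤ 8 (out-size F ι a)) (stash-run (enc B (f ι a)))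
          ⨾ʳ run G ι a _ _
          ⨾ʳ within (*-monoˡ-≤ 8 (out-size F ι a)) (unstash-run (enc B (f ι a)))
          ⨾ʳ push-run }

    fstP : ∀ {A B} → Poly (A ⊠ B) A (λ _ → proj₁)
    fstP {A} {B} = record
      { prog  = pop #0 ⨾ (stash ⨾ (discard ⨾ unstash))
      ; bound = K 1 ⊕ (X ⊗ K 8 ⊕ (X ⊗ K 12 ⊕ X ⊗ K 8))
      ; run   = λ { ι (a , b) u v →
           let a≤ = ≤-trans (m≤m+n (sz A a) (sz B b)) (n≤1+n _)
               b≤ = ≤-trans (m≤n+m (sz B b) (sz A a)) (n≤1+n _) in
           pop-run
        ⨾ʳ within (*-monoˡ-≤ 8 a≤) (stash-run (enc A a))
        ⨾ʳ within (*-monoˡ-≤ 12 b≤) (discard-run (enc B b))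
        ⨾ʳ within (*-monoˡ-≤ 8 a≤) (unstash-run (enc A a)) } }

    sndP : ∀ {A B} → Poly (A ⊠ B) B (λ _ → proj₂)
    sndP {A} {B} = record
      { prog  = pop #0 ⨾ discard
      ; bound = K 1 ⊕ X ⊗ K 12
      ; run   = λ { ι (a , b) u v → pop-run ⨾ʳ
          within (*-monoˡ-≤ 12 (≤-trans (m≤m+n (sz A a) (sz B b)) (n≤1+n _))) (discard-run (enc A a)) } }

    constP : ∀ {A B} (c : ∀ ι → Car B ι) t → (∀ ι → t ≡ enc B (c ι)) → Poly A B (λ ι _ → c ι)
    constP {A} {B} c t e = record
      { prog  = discard ⨾ pushTree t
      ; bound = X ⊗ K 12 ⊕ K (size t)
      ; run   = λ ι a u v → discard-run (enc A a) ⨾ʳ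
          subst (λ s → Run (pushTree t) (St u v []) (St (s ◂ u) v []) (size t)) (e ι) (pushTree-run t) }

    ifP : ∀ {A B c f g} → Poly A 𝔹 c → Poly A B f → Poly A B g →
          Poly A B (λ ι a → if c ι a then f ι a else g ι a)
    ifP {A} {B} {c} {f} {g} C F G = record
      { prog  = dup ⨾ (prog C ⨾ (pop #0 ⨾ branches))
      ; bound = X ⊗ K 31 ⊕ (bound C ⊕ (K 50 ⊕ (bound F ⊕ bound G)))
      ; run   = λ ι a u v → dup-run (enc A a) ⨾ʳ run C ι a _ _ ⨾ʳ branch ι a u v (c ι a) }
      where
      -- Both truth values have codes starting with `bit1`, which is popped first; the next bit
      -- decides. Each branch then discards two subtrees of sizes 3 and 1, and with pop and test
      -- this takes at most 1 + 1 + 36 + 12 = 50 steps.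
      branches : Command 3
      branches = if #0 is1 (discard ⨾ (discard ⨾ prog F)) (discard ⨾ (discard ⨾ prog G))
      branch : ∀ ι a u v b → Run (pop #0 ⨾ branches)
        (St (enc 𝔹 {ι} b ◂ enc A a ◂ u) v [])
        (St (enc B (if b then f ι a else g ι a) ◂ u) v [])
        (50 + (⟦ bound F ⟧ (sz A a) + ⟦ bound G ⟧ (sz A a)))
      branch ι a u v true  = pop-run ⨾ʳ then-run refl (discard-run (node leaf leaf) ⨾ʳ discard-run leaf ⨾ʳ
        within (m≤m+n _ _) (run F ι a u v))
      branch ι a u v false = pop-run ⨾ʳ else-run refl (discard-run leaf ⨾ʳ discard-run (node leaf leaf) ⨾ʳ
        within (m≤n+m _ (⟦ bound F ⟧ (sz A a))) (run G ι a u v))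

    private
      cons-run : ∀ {p q u v σ m d} x l a → size (node x l) + size a ≤ m →
        Run p (St (node a (node x l) ◂ u) v []) σ d →
        Run (if #0 is1 (swap ⨾ (push #0 bit1 ⨾ p)) q) (St (node x l ◂ a ◂ u) v []) σ (2 + (m * 32 + d))
      cons-run {m = m} {d} x l a ≤m r = within (≤-reflexive (cong suc (+-suc (m * 32) d)))
        (then-run refl (within (*-monoˡ-≤ 32 ≤m) (swap-run (node x l) a) ⨾ʳ push-run ⨾ʳ r))

    -- A cons cell has the code of a pair.
    caseP : ∀ {A E B l n c} → Poly A (𝕃 E) l → Poly A B n → Poly (A ⊠ E ⊠ 𝕃 E) B c →
            Poly A B (λ ι a → caseList (l ι a) (n ι a) (λ x xs → c ι ((a , x) , xs)))
    caseP {A} {E} {B} {l} {n} {c} L N C = record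
      { prog  = dup ⨾ (prog L ⨾ if #0 is1 (swap ⨾ (push #0 bit1 ⨾ prog C′)) (pop #0 ⨾ prog N))
      ; bound = X ⊗ K 31 ⊕ (bound L ⊕ (K 2 ⊕ (V ⊗ K 32 ⊕ (bound C′ ⊙ V ⊕ bound N))))
      ; run   = λ ι a u v → dup-run (enc A a) ⨾ʳ run L ι a _ _ ⨾ʳ branch ι a u v (l ι a) (out-size L ι a) }
      where
      c′ : ∀ ι → Car (A ⊠ (E ⊠ 𝕃 E)) ι → Car B ι
      c′ ι (a , x , xs) = c ι ((a , x) , xs)
      C′ : Poly (A ⊠ (E ⊠ 𝕃 E)) B c′
      C′ = C ∘P ⟨ ⟨ fstP , fstP ∘P sndP ⟩P , sndP ∘P sndP ⟩P
      V : Bound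
      V = K 1 ⊕ X ⊕ growth L
      branch : ∀ ι a u v l → sz (𝕃 E) l ≤ ⟦ growth L ⟧ (sz A a) →
        Run (if #0 is1 (swap ⨾ (push #0 bit1 ⨾ prog C′)) (pop #0 ⨾ prog N))
        (St (enc (𝕃 E) l ◂ enc A a ◂ u) v [])
        (St (enc B (caseList l (n ι a) (λ x xs → c ι ((a , x) , xs))) ◂ u) v [])
        (⟦ K 2 ⊕ (V ⊗ K 32 ⊕ (bound C′ ⊙ V ⊕ bound N)) ⟧ (sz A a))
      branch ι a u v [] _ = within (s≤s (s≤s (≤-trans (m≤n+m _ (⟦ bound C′ ⊙ V ⟧ (sz A a)))
          (m≤n+m _ (⟦ V ⊗ K 32 ⟧ (sz A a))))))
        (else-run refl (pop-run ⨾ʳ run N ι a u v))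
      branch ι a u v (x ∷ xs) l≤ = within
        (s≤s (s≤s (+-monoʳ-≤ (⟦ V ⟧ (sz A a) * 32) (m≤m+n _ _))))
        (cons-run {p = prog C′} (enc E x) (enc (𝕃 E) xs) (enc A a) sum≤
          (within (mono (bound C′) node≤) (run C′ ι (a , x , xs) u v)))
        where
        node≤ : suc (sz A a + sz (𝕃 E) (x ∷ xs)) ≤ ⟦ V ⟧ (sz A a)
        node≤ = s≤s (+-monoʳ-≤ (sz A a) l≤)
        sum≤ : sz (𝕃 E) (x ∷ xs) + sz A a ≤ ⟦ V ⟧ (sz A a)
        sum≤ = ≤-trans (≤-reflexive (+-comm (sz (𝕃 E) (x ∷ xs)) (sz A a))) (≤-trans (n≤1+n _) node≤)

    length≤sz : ∀ (E : Code Ix) {ι} (l : List (Car E ι)) → length l ≤ sz (𝕃 E) l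
    length≤sz E []      = z≤n
    length≤sz E (x ∷ l) = s≤s (≤-trans (length≤sz E l) (m≤n+m _ _))

    sz-++ : ∀ (E : Code Ix) {ι} (k l : List (Car E ι)) → sz (𝕃 E) (k ++ l) + 1 ≡ sz (𝕃 E) k + sz (𝕃 E) l
    sz-++ E []      l = +-comm _ 1
    sz-++ E (x ∷ k) l = cong suc (trans (+-assoc (sz E x) _ 1) (trans (cong (sz E x +_) (sz-++ E k l))
        (sym (+-assoc (sz E x) _ _))))

    sz-suffix : ∀ (E : Code Ix) {ι} (k l : List (Car E ι)) → sz (𝕃 E) l ≤ sz (𝕃 E) (k ++ l)
    sz-suffix E k l = +-cancelˡ-≤ 1 _ _ (≤-trans (+-monoˡ-≤ (sz (𝕃 E) l) (1≤sz (𝕃 E) k))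
      (≤-reflexive (trans (sym (sz-++ E k l)) (+-comm _ 1))))

    private
      fold-body : Command 3 → Command 3
      fold-body p = pop #0 ⨾ (stash ⨾ (swap ⨾ (unstash ⨾ (push #0 bit1 ⨾ (p ⨾ swap)))))

      fold-body-run : ∀ {p u v a c d} x l s s′ → size x ≤ a → size l ≤ a → size s ≤ c → size s′ ≤ c →
        Run p (St (node x s ◂ l ◂ u) v []) (St (s′ ◂ l ◂ u) v []) d →
        Run (fold-body p) (St (node x l ◂ s ◂ u) v []) (St (l ◂ s′ ◂ u) v [])
          (1 + (a * 8 + ((a + c) * 32 + (a * 8 + (1 + (d + (c + a) * 32))))))
      fold-body-run x l s s′ x≤ l≤ s≤ s′≤ r =
           pop-run
        ⨾ʳ within (*-monoˡ-≤ 8 x≤) (stash-run x)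
        ⨾ʳ within (*-monoˡ-≤ 32 (+-mono-≤ l≤ s≤)) (swap-run l s)
        ⨾ʳ within (*-monoˡ-≤ 8 x≤) (unstash-run x)
        ⨾ʳ push-run
        ⨾ʳ r
        ⨾ʳ within (*-monoˡ-≤ 32 (+-mono-≤ s′≤ l≤)) (swap-run s′ l)

    sz-prefix : ∀ (E : Code Ix) {ι} (k l : List (Car E ι)) → sz (𝕃 E) k ≤ sz (𝕃 E) (k ++ l)
    sz-prefix E k l = +-cancelʳ-≤ 1 _ _ (≤-trans (+-monoʳ-≤ (sz (𝕃 E) k) (1≤sz (𝕃 E) l))
        (≤-reflexive (sym (sz-++ E k l))))

    -- The bound only has to hold for the intermediate states, one for each prefix of the list.
    foldP : ∀ {Γ E S l i st} → Poly Γ (𝕃 E) l → Poly Γ S i → Poly (Γ ⊠ E ⊠ S) S st → (b : Bound) →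
      (∀ ι γ l₁ l₂ → l ι γ ≡ l₁ ++ l₂ → sz S (foldl (λ s x → st ι ((γ , x) , s)) (i ι γ) l₁) ≤ ⟦ b ⟧ (sz Γ γ)) →
      Poly Γ S (λ ι γ → foldl (λ s x → st ι ((γ , x) , s)) (i ι γ) (l ι γ))
    foldP {Γ} {E} {S} {l} {i} {st} L I F b bounded = record
      { prog  = prog init ⨾ (pop #0 ⨾ (loop ⨾ (pop #0 ⨾ prog result)))
      ; bound = bound init ⊕ (K 1 ⊕ (growth L ⊗ (K 1 ⊕ Tᵢ) ⊕ K 1 ⊕ (K 1 ⊕ bound result ⊙ V)))
      ; run   = λ ι γ u v →
             run init ι γ u v
          ⨾ʳ pop-run
          ⨾ʳ within (+-monoˡ-≤ 1 (*-monoˡ-≤ _ (≤-trans (length≤sz E (l ι γ)) (out-size L ι γ))))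
               (loop-runs ι γ u v [] (l ι γ) refl)
          ⨾ʳ pop-run
          ⨾ʳ within (mono (bound result) (s≤s (+-monoʳ-≤ (sz Γ γ)
              (bounded ι γ (l ι γ) [] (sym (++-identityʳ (l ι γ)))))))
               (run result ι (γ , foldl (λ s x → st ι ((γ , x) , s)) (i ι γ) (l ι γ)) u v) }
      where
      init : Poly Γ (𝕃 E ⊠ (Γ ⊠ S)) (λ ι γ → l ι γ , γ , i ι γ)
      init = ⟨ L , ⟨ idP , I ⟩P ⟩P
      F′ : Poly (E ⊠ (Γ ⊠ S)) (Γ ⊠ S) (λ ι p → proj₁ (proj₂ p) , st ι ((proj₁ (proj₂ p) , proj₁ p) , proj₂
          (proj₂ p)))
      F′ = ⟨ fstP ∘P sndP , F ∘P ⟨ ⟨ fstP ∘P sndP , fstP ⟩P , sndP ∘P sndP ⟩P ⟩P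
      result : Poly (Γ ⊠ S) S (λ _ → proj₂)
      result = sndP
      body loop : Command 3
      body = fold-body (prog F′)
      loop = while #0 is1 body
      V Tᵢ : Bound
      V = K 1 ⊕ X ⊕ b
      Tᵢ = K 1 ⊕ (growth L ⊗ K 8 ⊕ ((growth L ⊕ V) ⊗ K 32 ⊕
          (growth L ⊗ K 8 ⊕ (K 1 ⊕ (bound F′ ⊙ (K 1 ⊕ (growth L ⊕ V)) ⊕ (V ⊕ growth L) ⊗ K 32)))))

      state : ∀ ι γ → List (Car E ι) → Car (Γ ⊠ S) ι
      state ι γ l₁ = γ , foldl (λ s x → st ι ((γ , x) , s)) (i ι γ) l₁

      state-snoc : ∀ ι γ l₁ x → proj₂ (state ι γ (l₁ ++ x ∷ [])) ≡ st ι ((γ , x) , proj₂ (state ι γ l₁))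
      state-snoc ι γ l₁ x = foldl-++ _ (i ι γ) l₁ (x ∷ [])

      iteration : ∀ ι γ u v l₁ x l₂ → l ι γ ≡ l₁ ++ x ∷ l₂ →
        Run body (St (enc (𝕃 E) (x ∷ l₂) ◂ enc (Γ ⊠ S) (state ι γ l₁) ◂ u) v [])
                 (St (enc (𝕃 E) l₂ ◂ enc (Γ ⊠ S) (state ι γ (l₁ ++ x ∷ [])) ◂ u) v []) (⟦ Tᵢ ⟧ (sz Γ γ))
      iteration ι γ u v l₁ x l₂ eq = subst
        (λ z → Run body (St (enc (𝕃 E) (x ∷ l₂) ◂ enc (Γ ⊠ S) (state ι γ l₁) ◂ u) v [])
                        (St (enc (𝕃 E) l₂ ◂ enc (Γ ⊠ S) (γ , z) ◂ u) v []) (⟦ Tᵢ ⟧ (sz Γ γ)))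
        (sym (state-snoc ι γ l₁ x))
        (fold-body-run {p = prog F′} (enc E x) (enc (𝕃 E) l₂) (enc (Γ ⊠ S) (state ι γ l₁))
          (enc (Γ ⊠ S) (γ , st ι ((γ , x) , proj₂ (state ι γ l₁)))) x≤ l₂≤ s≤ s′≤
          (within (mono (bound F′) (s≤s (+-mono-≤ x≤ s≤))) (run F′ ι (x , state ι γ l₁) _ _)))
        where
        xl≤ : suc (sz E x + sz (𝕃 E) l₂) ≤ ⟦ growth L ⟧ (sz Γ γ)
        xl≤ = ≤-trans (sz-suffix E l₁ (x ∷ l₂)) (≤-trans (≤-reflexive (cong (sz (𝕃 E)) (sym eq)))
            (out-size L ι γ))
        x≤ : sz E x ≤ ⟦ growth L ⟧ (sz Γ γ)
        x≤ = ≤-trans (≤-trans (m≤m+n _ _) (n≤1+n _)) xl≤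
        l₂≤ : sz (𝕃 E) l₂ ≤ ⟦ growth L ⟧ (sz Γ γ)
        l₂≤ = ≤-trans (≤-trans (m≤n+m _ (sz E x)) (n≤1+n _)) xl≤
        s≤ : sz (Γ ⊠ S) (state ι γ l₁) ≤ ⟦ V ⟧ (sz Γ γ)
        s≤ = s≤s (+-monoʳ-≤ (sz Γ γ) (bounded ι γ l₁ (x ∷ l₂) eq))
        s′≤ : sz (Γ ⊠ S) (γ , st ι ((γ , x) , proj₂ (state ι γ l₁))) ≤ ⟦ V ⟧ (sz Γ γ)
        s′≤ = s≤s (+-monoʳ-≤ (sz Γ γ) (subst (λ z → sz S z ≤ ⟦ b ⟧ (sz Γ γ)) (state-snoc ι γ l₁ x)
          (bounded ι γ (l₁ ++ x ∷ []) l₂ (trans eq (sym (++-assoc l₁ (x ∷ []) l₂))))))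

      loop-runs : ∀ ι γ u v l₁ l₂ → l ι γ ≡ l₁ ++ l₂ →
        Run loop (St (enc (𝕃 E) l₂ ◂ enc (Γ ⊠ S) (state ι γ l₁) ◂ u) v [])
                 (St (leaf ◂ enc (Γ ⊠ S) (state ι γ (l ι γ)) ◂ u) v []) (length l₂ * suc (⟦ Tᵢ ⟧ (sz Γ γ)) + 1)
      loop-runs ι γ u v l₁ [] eq rewrite trans eq (++-identityʳ l₁) = exit-run refl
      loop-runs ι γ u v l₁ (x ∷ l₂) eq = within (≤-reflexive (cong suc (sym (+-assoc (⟦ Tᵢ ⟧ (sz Γ γ)) _ 1))))
        (loop-run refl (iteration ι γ u v l₁ x l₂ eq)
          (loop-runs ι γ u v (l₁ ++ x ∷ []) l₂ (trans eq (sym (++-assoc l₁ (x ∷ []) l₂)))))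

    -- If the increment depends on the parameter and the element but not on the state, the
    -- increments sum up to a polynomial. A factor on the size of the state would permit exponential
    -- growth.
    foldP⁺ : ∀ {Γ E S l i st} → Poly Γ (𝕃 E) l → Poly Γ S i → Poly (Γ ⊠ E ⊠ S) S st → (k : Bound) →
      (∀ ι γ x s → sz S (st ι ((γ , x) , s)) ≤ sz S s + ⟦ k ⟧ (sz Γ γ + sz E x)) →
      Poly Γ S (λ ι γ → foldl (λ s x → st ι ((γ , x) , s)) (i ι γ) (l ι γ))
    foldP⁺ {Γ} {E} {S} {l} {i} {st} L I F k grows = foldP L I F (growth I ⊕ growth L ⊗ k ⊙ (X ⊕ growth L))
        bounded
      where
      fold≤ : ∀ ι γ m s l → sz (𝕃 E) l ≤ m →
        sz S (foldl (λ s x → st ι ((γ , x) , s)) s l) ≤ sz S s + length l * ⟦ k ⟧ (sz Γ γ + m)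
      fold≤ ι γ m s []      _  = ≤-reflexive (sym (+-identityʳ _))
      fold≤ ι γ m s (x ∷ l) l≤ = ≤-trans (fold≤ ι γ m _ l (≤-trans (≤-trans (m≤n+m _ (sz E x)) (n≤1+n _)) l≤))
        (≤-trans (+-monoˡ-≤ _ (≤-trans (grows ι γ x s) (+-monoʳ-≤ (sz S s) (mono k (+-monoʳ-≤ (sz Γ γ)
          (≤-trans (≤-trans (m≤m+n (sz E x) _) (n≤1+n _)) l≤)))))) (≤-reflexive (+-assoc (sz S s) _ _)))
      bounded : ∀ ι γ l₁ l₂ → l ι γ ≡ l₁ ++ l₂ → _
      bounded ι γ l₁ l₂ eq = ≤-trans (fold≤ ι γ (⟦ growth L ⟧ (sz Γ γ)) (i ι γ) l₁ l₁≤)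
        (+-mono-≤ (out-size I ι γ) (*-monoˡ-≤ _ (≤-trans (length≤sz E l₁) l₁≤)))
        where
        l₁≤ : sz (𝕃 E) l₁ ≤ ⟦ growth L ⟧ (sz Γ γ)
        l₁≤ = ≤-trans (sz-prefix E l₁ l₂)
          (≤-trans (≤-reflexive (cong (sz (𝕃 E)) (sym eq))) (out-size L ι γ))

-- List functions in polynomial time.

module PolyLists where

  open StackMachine
  open PolyTime
  open import Data.Nat using (suc; _+_; _≤_; s≤s)
  open import Data.Nat.Properties

  tail : {A : Set} → List A → List A
  tail l = caseList l [] (λ _ xs → xs)

  module _ {Ix : Set} where

    private variable
      Γ A B C E S : Code Ix

    v0 : Poly (Γ ⊠ A) A (λ _ → proj₂)
    v0 = sndP

    v1 : Poly (Γ ⊠ A ⊠ B) A (λ _ γ → proj₂ (proj₁ γ))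
    v1 = sndP ∘P fstP

    v2 : Poly (Γ ⊠ A ⊠ B ⊠ C) A (λ _ γ → proj₂ (proj₁ (proj₁ γ)))
    v2 = sndP ∘P fstP ∘P fstP

    v3 : Poly (Γ ⊠ A ⊠ B ⊠ C ⊠ E) A (λ _ γ → proj₂ (proj₁ (proj₁ (proj₁ γ))))
    v3 = sndP ∘P fstP ∘P fstP ∘P fstP

    trueP : Poly Γ 𝔹 (λ _ _ → true)
    trueP = constP (λ _ → true) (bitTree true) (λ _ → refl)

    falseP : Poly Γ 𝔹 (λ _ _ → false)
    falseP = constP (λ _ → false) (bitTree false) (λ _ → refl)

    unitP : Poly Γ 𝟙 (λ _ _ → tt)
    unitP = constP (λ _ → tt) leaf (λ _ → refl)

    andP : ∀ {p q} → Poly Γ 𝔹 p → Poly Γ 𝔹 q → Poly Γ 𝔹 (λ ι γ → p ι γ ∧ q ι γ)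
    andP {p = p} {q} P Q = ext eq (ifP P Q falseP)
      where
      eq : ∀ ι γ → (if p ι γ then q ι γ else false) ≡ p ι γ ∧ q ι γ
      eq ι γ with p ι γ
      ... | true  = refl
      ... | false = refl

    notP : ∀ {p} → Poly Γ 𝔹 p → Poly Γ 𝔹 (λ ι γ → not (p ι γ))
    notP {p = p} P = ext eq (ifP P falseP trueP)
      where
      eq : ∀ ι γ → (if p ι γ then false else true) ≡ not (p ι γ)
      eq ι γ with p ι γ
      ... | true  = refl
      ... | false = refl

    letP : ∀ {a b} → Poly Γ A a → Poly (Γ ⊠ A) B b → Poly Γ B (λ ι γ → b ι (γ , a ι γ))
    letP P Q = Q ∘P ⟨ idP , P ⟩P

    nilP : Poly Γ (𝕃 A) (λ _ _ → [])
    nilP = constP (λ _ → []) leaf (λ _ → refl)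

    consP : ∀ {a l} → Poly Γ A a → Poly Γ (𝕃 A) l → Poly Γ (𝕃 A) (λ ι γ → a ι γ ∷ l ι γ)
    consP {A = A} P L = recode {f = λ ι p → proj₁ p ∷ proj₂ p} (λ _ _ → refl) ∘P ⟨ P , L ⟩P

    private
      cons≤ : ∀ g x s → suc (x + s) ≤ s + suc (g + x)
      cons≤ g x s = ≤-trans (s≤s (≤-trans (≤-reflexive (+-comm x s)) (+-monoʳ-≤ s (m≤n+m x g))))
          (≤-reflexive (sym (+-suc s (g + x))))

    abstract
      ʳ++P : ∀ {k l} → Poly Γ (𝕃 A) k → Poly Γ (𝕃 A) l → Poly Γ (𝕃 A) (λ ι γ → foldl (flip _∷_) (l ι γ) (k ι γ))
      ʳ++P {Γ} {A} P Q = foldP⁺ P Q (consP v1 v0) (K 1 ⊕ X) (λ ι γ x s → cons≤ (sz Γ γ) (sz A x) (sz (𝕃 A) s))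

    reverseP : ∀ {l} → Poly Γ (𝕃 A) l → Poly Γ (𝕃 A) (λ ι γ → reverse (l ι γ))
    reverseP L = ʳ++P L nilP

    private
      ++-fold : ∀ {A : Set} (k l : List A) → foldl (flip _∷_) l (reverse k) ≡ k ++ l
      ++-fold k l = trans (reverse-foldl (flip _∷_) l k) (append k)
        where
        append : ∀ k → foldr _∷_ l k ≡ k ++ l
        append []      = refl
        append (x ∷ k) = cong (x ∷_) (append k)

    abstract
      ++P : ∀ {k l} → Poly Γ (𝕃 A) k → Poly Γ (𝕃 A) l → Poly Γ (𝕃 A) (λ ι γ → k ι γ ++ l ι γ)
      ++P {k = k} {l} P Q = ext (λ ι γ → ++-fold (k ι γ) (l ι γ)) (ʳ++P (reverseP P) Q)

    private
      foldl-concat : ∀ {A : Set} (s : List A) ls → foldl _++_ s ls ≡ s ++ concat ls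
      foldl-concat s []       = sym (++-identityʳ s)
      foldl-concat s (l ∷ ls) = trans (foldl-concat (s ++ l) ls) (++-assoc s l (concat ls))

      foldl-map : ∀ {A B : Set} (f : A → B) s l → foldl (λ s x → f x ∷ s) s l ≡ foldl (flip _∷_) s (map f l)
      foldl-map f s []      = refl
      foldl-map f s (x ∷ l) = foldl-map f (f x ∷ s) l

    abstract
      concatP : ∀ {l} → Poly Γ (𝕃 (𝕃 A)) l → Poly Γ (𝕃 A) (λ ι γ → concat (l ι γ))
      concatP {Γ} {A} {l} L = ext (λ ι γ → foldl-concat [] (l ι γ))
        (foldP⁺ L nilP (++P v0 v1) X (λ ι γ x s → ≤-trans (≤-trans (m≤m+n _ 1) (≤-reflexive (sz-++ A s x)))
           (+-monoʳ-≤ (sz (𝕃 A) s) (m≤n+m (sz (𝕃 A) x) (sz Γ γ)))))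

      mapP : ∀ {l f} → Poly Γ (𝕃 A) l → Poly (Γ ⊠ A) B f → Poly Γ (𝕃 B) (λ ι γ → map (λ x → f ι (γ , x))
          (l ι γ))
      mapP {Γ} {A} {B} {l} {f} L F = ext (λ ι γ → trans
          (cong reverse (foldl-map (λ x → f ι (γ , x)) [] (l ι γ))) (reverse-involutive _))
        (reverseP (foldP⁺ L nilP (consP (F ∘P fstP) v0) (K 1 ⊕ growth F ⊙ (K 1 ⊕ X)) (λ ι γ x s →
          ≤-trans (s≤s (≤-trans (+-comm-≤ (sz B (f ι (γ , x))) (sz (𝕃 B) s))
              (+-monoʳ-≤ (sz (𝕃 B) s) (out-size F ι (γ , x)))))
                  (≤-reflexive (sym (+-suc (sz (𝕃 B) s) _))))))
        where
        +-comm-≤ : ∀ m n → m + n ≤ n + m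
        +-comm-≤ m n = ≤-reflexive (+-comm m n)

    concatMapP : ∀ {l f} → Poly Γ (𝕃 A) l → Poly (Γ ⊠ A) (𝕃 B) f → Poly Γ (𝕃 B)
        (λ ι γ → concatMap (λ x → f ι (γ , x)) (l ι γ))
    concatMapP L F = concatP (mapP L F)

    private
      filter-concat : ∀ {A : Set} (p : A → Bool) l → concatMap (λ x → if p x then [ x ] else []) l ≡ filterᵇ p l
      filter-concat p []      = refl
      filter-concat p (x ∷ l) with p x
      ... | true  = cong (x ∷_) (filter-concat p l)
      ... | false = filter-concat p l

    abstract
      filterP : ∀ {l p} → Poly Γ (𝕃 A) l → Poly (Γ ⊠ A) 𝔹 p → Poly Γ (𝕃 A) (λ ι γ → filterᵇ (λ x → p ι (γ , x))
          (l ι γ))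
      filterP {l = l} {p} L P = ext (λ ι γ → filter-concat (λ x → p ι (γ , x)) (l ι γ))
        (concatMapP L (ifP P (consP v0 nilP) nilP))

    tailP : ∀ {l} → Poly Γ (𝕃 A) l → Poly Γ (𝕃 A) (λ ι γ → tail (l ι γ))
    tailP L = caseP L nilP v0

    -- A right fold is a left fold over the reversed list, so its intermediate states belong to
    -- suffixes instead of prefixes.
    foldrP : ∀ {l i st} → Poly Γ (𝕃 E) l → Poly Γ S i → Poly (Γ ⊠ E ⊠ S) S st → (b : Bound) →
      (∀ ι γ l₁ l₂ → l ι γ ≡ l₁ ++ l₂ → sz S (foldr (λ x s → st ι ((γ , x) , s)) (i ι γ) l₂) ≤ ⟦ b ⟧ (sz Γ γ)) →
      Poly Γ S (λ ι γ → foldr (λ x s → st ι ((γ , x) , s)) (i ι γ) (l ι γ))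
    foldrP {Γ} {E} {S} {l} {i} {st} L I F b bounded =
      ext (λ ι γ → fold≡ ι γ (l ι γ))
          (foldP (reverseP L) I F b λ ι γ l₁ l₂ eq → subst (λ z → sz S z ≤ ⟦ b ⟧ (sz Γ γ))
            (trans (sym (fold≡ ι γ (reverse l₁))) (cong (foldl (λ s x → st ι ((γ , x) , s)) (i ι γ))
                (reverse-involutive l₁)))
            (bounded ι γ (reverse l₂) (reverse l₁)
              (trans (sym (reverse-involutive (l ι γ))) (trans (cong reverse eq) (reverse-++ l₁ l₂)))))
      where
      open import Data.List.Properties using (reverse-++)
      fold≡ : ∀ ι γ l → foldl (λ s x → st ι ((γ , x) , s)) (i ι γ) (reverse l) ≡ foldr
          (λ x s → st ι ((γ , x) , s)) (i ι γ) l
      fold≡ ι γ l = reverse-foldl (λ s x → st ι ((γ , x) , s)) (i ι γ) l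

-- Binary arithmetic in polynomial time.

module PolyArithmetic where

  open StackMachine
  open PolyTime
  open PolyLists
  open import Data.Nat using (ℕ; zero; suc; _+_; _*_; _^_; _≤_; _<_; z≤n; s≤s; _≤ᵇ_; _≡ᵇ_)
  open import Data.Nat.Binary as ℕᵇ using (ℕᵇ; 2[1+_]; 1+[2_])
  import Data.Nat.Binary.Properties as ℕᵇₚ
  open import Data.Nat.Properties

  -- Bijective binary numerals, least significant digit first; the digit is 2 for true and 1 for false.

  digit : Bool → ℕ
  digit b = if b then 2 else 1

  val : List Bool → ℕ
  val []       = 0
  val (b ∷ bs) = digit b + 2 * val bs

  digitsᵇ : ℕᵇ → List Bool
  digitsᵇ ℕᵇ.zero  = []
  digitsᵇ 2[1+ x ] = true ∷ digitsᵇ x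
  digitsᵇ 1+[2 x ] = false ∷ digitsᵇ x

  1≤digit : ∀ b → 1 ≤ digit b
  1≤digit true  = s≤s z≤n
  1≤digit false = ≤-refl

  digits : ℕ → List Bool
  digits n = digitsᵇ (ℕᵇ.fromℕ n)

  private
    val-digitsᵇ : ∀ x → val (digitsᵇ x) ≡ ℕᵇ.toℕ x
    val-digitsᵇ ℕᵇ.zero  = refl
    val-digitsᵇ 2[1+ x ] = trans (cong (λ z → 2 + 2 * z) (val-digitsᵇ x)) (double (ℕᵇ.toℕ x))
      where
      double : ∀ n → 2 + 2 * n ≡ 2 * suc n
      double = solve-∀
    val-digitsᵇ 1+[2 x ] = cong (λ z → 1 + 2 * z) (val-digitsᵇ x)

    fromDigits : List Bool → ℕᵇ
    fromDigits []           = ℕᵇ.zero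
    fromDigits (true ∷ bs)  = 2[1+ fromDigits bs ]
    fromDigits (false ∷ bs) = 1+[2 fromDigits bs ]

    digitsᵇ-fromDigits : ∀ bs → digitsᵇ (fromDigits bs) ≡ bs
    digitsᵇ-fromDigits []           = refl
    digitsᵇ-fromDigits (true ∷ bs)  = cong (true ∷_) (digitsᵇ-fromDigits bs)
    digitsᵇ-fromDigits (false ∷ bs) = cong (false ∷_) (digitsᵇ-fromDigits bs)

  val-digits : ∀ n → val (digits n) ≡ n
  val-digits n = trans (val-digitsᵇ (ℕᵇ.fromℕ n)) (ℕᵇₚ.toℕ-fromℕ n)

  -- Bijective numeration has no leading zeros: each digit list is the numeral of its value.
  -- Therefore `valP` changes no code and results need no normalization.
  digits-val : ∀ bs → digits (val bs) ≡ bs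
  digits-val bs = trans
    (cong digitsᵇ (trans (cong ℕᵇ.fromℕ (trans (cong val (sym (digitsᵇ-fromDigits bs)))
        (val-digitsᵇ (fromDigits bs))))
                         (ℕᵇₚ.fromℕ-toℕ (fromDigits bs))))
    (digitsᵇ-fromDigits bs)

  len : ℕ → ℕ
  len n = length (digits n)

  private
    2^length≤ : ∀ bs → 2 ^ length bs ≤ suc (val bs)
    2^length≤ []       = ≤-refl
    2^length≤ (b ∷ bs) = ≤-trans (*-monoʳ-≤ 2 (2^length≤ bs))
      (≤-trans (≤-reflexive (double (val bs))) (s≤s (+-monoˡ-≤ (2 * val bs) (1≤digit b))))
      where
      double : ∀ v → 2 * suc v ≡ suc (1 + 2 * v)
      double = solve-∀

    <2^length : ∀ bs → suc (val bs) < 2 ^ suc (length bs)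
    <2^length []       = ≤-refl
    <2^length (b ∷ bs) = ≤-trans (s≤s (s≤s (+-monoˡ-≤ (2 * val bs) (digit≤2 b))))
      (≤-trans (≤-reflexive (double (val bs))) (*-monoʳ-≤ 2 (<2^length bs)))
      where
      double : ∀ v → suc (suc (2 + 2 * v)) ≡ 2 * suc (suc v)
      double = solve-∀
      digit≤2 : ∀ b → digit b ≤ 2
      digit≤2 true  = ≤-refl
      digit≤2 false = s≤s z≤n

    -- Together with `len-lower` this identifies `len n` as the integer part of log₂ (n + 1).
    len-upper : ∀ n → 2 ^ len n ≤ suc n
    len-upper n = ≤-trans (2^length≤ (digits n)) (s≤s (≤-reflexive (val-digits n)))

    len-lower : ∀ n → suc n < 2 ^ suc (len n)
    len-lower n = subst (λ m → suc m < 2 ^ suc (len n)) (val-digits n) (<2^length (digits n))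

    2^-cancel-< : ∀ a b → 2 ^ a < 2 ^ b → a < b
    2^-cancel-< a b lt = ≰⇒> (λ b≤a → <-irrefl refl (<-≤-trans lt (^-monoʳ-≤ 2 b≤a)))

  len-≤ : ∀ k n → suc n < 2 ^ suc k → len n ≤ k
  len-≤ k n lt = s≤s⁻¹ (2^-cancel-< (len n) (suc k) (≤-<-trans (len-upper n) lt))
    where open import Data.Nat using (s≤s⁻¹)

  -- The general bound for sums would double the length, but multiplication doubles its accumulator
  -- at every digit and needs an additive bound.
  len-double : ∀ n → len (n + n) ≤ suc (len n)
  len-double n = len-≤ (suc (len n)) (n + n) (≤-trans (≤-trans (m≤n+m _ 2) (≤-reflexive (double n)))
    (*-monoʳ-≤ 2 (len-lower n)))
    where
    double : ∀ n → 2 + suc (suc (n + n)) ≡ 2 * suc (suc n)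
    double = solve-∀

  private
    -- The form of the hypothesis serves sums and products alike, as 1 + m + n and 1 + mn are both
    -- at most (1 + m)(1 + n).
    len-product : ∀ k m n → suc k ≤ suc m * suc n → len k ≤ suc (len m + len n)
    len-product k m n k≤ = len-≤ _ k (≤-<-trans k≤ (<-≤-trans (*-mono-< (len-lower m) (len-lower n))
      (≤-reflexive (trans (sym (^-distribˡ-+-* 2 (suc (len m)) (suc (len n))))
          (cong (2 ^_) (cong suc (+-suc (len m) (len n))))))))

  len-+ : ∀ m n → len (m + n) ≤ suc (len m + len n)
  len-+ m n = len-product (m + n) m n (≤-trans (m≤m+n _ (m * n)) (≤-reflexive (expand m n)))
    where
    expand : ∀ m n → suc (m + n) + m * n ≡ suc m * suc n
    expand = solve-∀

  len-* : ∀ m n → len (m * n) ≤ suc (len m + len n)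
  len-* m n = len-product (m * n) m n (≤-trans (s≤s (m≤n+m _ (m + n))) (≤-reflexive (expand m n)))
    where
    expand : ∀ m n → suc (m + n + m * n) ≡ suc m * suc n
    expand = solve-∀

  module _ {Ix : Set} where

    ℕ₂ : Code Ix
    ℕ₂ = record { Car = λ _ → ℕ ; enc = λ n → encList bitTree (digits n) }

    sz-bits : ∀ {ι : Ix} (bs : List Bool) → sz (𝕃 𝔹) {ι} bs ≡ 1 + length bs * 6
    sz-bits {ι} []           = refl
    sz-bits {ι} (true ∷ bs)  = cong (6 +_) (sz-bits {ι} bs)
    sz-bits {ι} (false ∷ bs) = cong (6 +_) (sz-bits {ι} bs)

    sz-ℕ₂ : ∀ {ι} n → sz ℕ₂ {ι} n ≡ 1 + len n * 6
    sz-ℕ₂ {ι} n = sz-bits {ι} (digits n)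

    private
      sz-step : ∀ {ι} k m n → len k ≤ suc (len m + len n) → sz ℕ₂ {ι} k ≤ sz ℕ₂ {ι} m + (5 + sz ℕ₂ {ι} n)
      sz-step {ι} k m n k≤ rewrite sz-ℕ₂ {ι} k | sz-ℕ₂ {ι} m | sz-ℕ₂ {ι} n =
        ≤-trans (s≤s (*-monoˡ-≤ 6 k≤)) (≤-reflexive (expand (len m) (len n)))
        where
        expand : ∀ m n → 1 + suc (m + n) * 6 ≡ 1 + m * 6 + (5 + (1 + n * 6))
        expand = solve-∀

    sz-+ : ∀ {ι} m n → sz ℕ₂ {ι} (m + n) ≤ sz ℕ₂ {ι} m + (5 + sz ℕ₂ {ι} n)
    sz-+ {ι} m n = sz-step {ι} (m + n) m n (len-+ m n)

    sz-* : ∀ {ι} m n → sz ℕ₂ {ι} (m * n) ≤ sz ℕ₂ {ι} m + (5 + sz ℕ₂ {ι} n)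
    sz-* {ι} m n = sz-step {ι} (m * n) m n (len-* m n)

    sz-double : ∀ {ι} n → sz ℕ₂ {ι} (n + n) ≤ sz ℕ₂ {ι} n + 6
    sz-double {ι} n rewrite sz-ℕ₂ {ι} (n + n) | sz-ℕ₂ {ι} n =
      ≤-trans (s≤s (*-monoˡ-≤ 6 (len-double n))) (≤-reflexive (expand (len n)))
      where
      expand : ∀ n → 1 + suc n * 6 ≡ 1 + n * 6 + 6
      expand = solve-∀

    private variable
      Γ A : Code Ix

    digitsP : ∀ {n} → Poly Γ ℕ₂ n → Poly Γ (𝕃 𝔹) (λ ι γ → digits (n ι γ))
    digitsP N = recode {f = λ _ → digits} (λ _ _ → refl) ∘P N

    valP : ∀ {bs} → Poly Γ (𝕃 𝔹) bs → Poly Γ ℕ₂ (λ ι γ → val (bs ι γ))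
    valP N = recode {f = λ _ → val} (λ _ bs → cong (encList bitTree) (sym (digits-val bs))) ∘P N

    numP : ∀ k → Poly Γ ℕ₂ (λ _ _ → k)
    numP k = constP (λ _ → k) (encList bitTree (digits k)) (λ _ → refl)

  -- Addition is carried out digit by digit, with a carry in unary and the digits of the sum
  -- collected in reverse order.

  private
    unary : List Bool → List ⊤
    unary bs = caseList bs [] (λ b _ → if b then tt ∷ tt ∷ [] else tt ∷ [])

    -- Adds one unit to digit + 2 · carry. As there is no digit 0, the digit is absent exactly while
    -- the count is zero.
    split-step : List Bool × List ⊤ → List Bool × List ⊤
    split-step s = caseList (proj₁ s) ([ false ] , proj₂ s)
      (λ b _ → if b then ([ false ] , tt ∷ proj₂ s) else ([ true ] , proj₂ s))

    split-from : List ⊤ → List Bool × List ⊤ → List Bool × List ⊤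
    split-from t s = foldl (λ s _ → split-step s) s t

    split : List ⊤ → List Bool × List ⊤
    split t = split-from t ([] , [])

    Adder : Set
    Adder = (List Bool × List Bool) × (List ⊤ × List Bool)

    tick : Adder → Adder
    tick ((xs , ys) , (c , out)) =
      let s = split (unary xs ++ unary ys ++ c) in (tail xs , tail ys) , (proj₂ s , proj₁ s ++ out)

    dval : List Bool → ℕ
    dval bs = caseList bs 0 (λ b _ → digit b)

    data Small : List Bool → Set where
      none : Small []
      one  : ∀ b → Small [ b ]

    split-small : ∀ t s → Small (proj₁ s) → Small (proj₁ (split-from t s))
    split-small []      s               p           = p
    split-small (_ ∷ t) (_ , c) none        = split-small t _ (one false)
    split-small (_ ∷ t) (_ , c) (one true)  = split-small t _ (one false)
    split-small (_ ∷ t) (_ , c) (one false) = split-small t _ (one true)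

    split-value : ∀ t s → Small (proj₁ s) → let r = split-from t s in
      dval (proj₁ r) + 2 * length (proj₂ r) ≡ length t + (dval (proj₁ s) + 2 * length (proj₂ s))
    split-value []      s       _           = refl
    split-value (_ ∷ t) (_ , c) none        = trans (split-value t _ (one false)) (move (length t) (length c))
      where
      move : ∀ t c → t + (1 + 2 * c) ≡ suc (t + (0 + 2 * c))
      move = solve-∀
    split-value (_ ∷ t) (_ , c) (one true)  = trans (split-value t _ (one false)) (move (length t) (length c))
      where
      move : ∀ t c → t + (1 + 2 * suc c) ≡ suc (t + (2 + 2 * c))
      move = solve-∀
    split-value (_ ∷ t) (_ , c) (one false) = trans (split-value t _ (one true)) (move (length t) (length c))
      where
      move : ∀ t c → t + (2 + 2 * c) ≡ suc (t + (1 + 2 * c))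
      move = solve-∀

    split-nonempty : ∀ t s {b} → proj₁ s ≡ [ b ] → ∃[ b ] proj₁ (split-from t s) ≡ [ b ]
    split-nonempty []      s       e            = _ , e
    split-nonempty (_ ∷ t) (_ , c) {true}  refl = split-nonempty t _ refl
    split-nonempty (_ ∷ t) (_ , c) {false} refl = split-nonempty t _ refl

    split-empty : ∀ t → proj₁ (split t) ≡ [] → t ≡ []
    split-empty []      _ = refl
    split-empty (_ ∷ t) e with trans (sym e) (proj₂ (split-nonempty t ([ false ] , []) refl))
    ... | ()

    rev-val : List Bool → ℕ → ℕ
    rev-val []        z = z
    rev-val (b ∷ out) z = rev-val out (digit b + 2 * z)

    val-reverse : ∀ out bs → val (foldl (flip _∷_) bs out) ≡ rev-val out (val bs)
    val-reverse []        bs = refl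
    val-reverse (b ∷ out) bs = val-reverse out (b ∷ bs)

    -- The invariant of addition: carry and unread digits of both summands have to be written above
    -- the digits already put out, which `out` holds in reverse.
    adder-value : Adder → ℕ
    adder-value ((xs , ys) , (c , out)) = rev-val out (length c + val xs + val ys)

    unary-val : ∀ xs → val xs ≡ length (unary xs) + 2 * val (tail xs)
    unary-val []           = refl
    unary-val (true ∷ xs)  = refl
    unary-val (false ∷ xs) = refl

    length-t : ∀ xs ys (c : List ⊤) → length (unary xs ++ unary ys ++ c) ≡ length (unary xs) +
        (length (unary ys) + length c)
    length-t xs ys c = trans (length-++ (unary xs)) (cong (length (unary xs) +_) (length-++ (unary ys)))

    tick-value : ∀ a → adder-value (tick a) ≡ adder-value a
    tick-value ((xs , ys) , (c , out)) = go (split t) refl (split-small t ([] , []) none)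
        (split-value t ([] , []) none)
      where
      t = unary xs ++ unary ys ++ c
      value : ∀ n m → m ≡ length t + 0 → m + (2 * val (tail xs) + 2 * val (tail ys)) ≡ length c + val xs + val
          ys
      value n m e rewrite e | length-t xs ys c | unary-val xs | unary-val ys =
        move (length (unary xs)) (length (unary ys)) (length c) (val (tail xs)) (val (tail ys))
        where
        move : ∀ a b c x y → a + (b + c) + 0 + (2 * x + 2 * y) ≡ c + (a + 2 * x) + (b + 2 * y)
        move = solve-∀
      go : ∀ s → split t ≡ s → Small (proj₁ s) → dval (proj₁ s) + 2 * length (proj₂ s) ≡ length t + (0 + 2 * 0)
          →
        rev-val (proj₁ s ++ out) (length (proj₂ s) + val (tail xs) + val (tail ys)) ≡ rev-val out
            (length c + val xs + val ys)
      go (_ , c′) e (one b) v = cong (rev-val out) (trans (move (digit b) (length c′) (val (tail xs))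
          (val (tail ys))) (value 0 _ v))
        where
        move : ∀ d c x y → d + 2 * (c + x + y) ≡ d + 2 * c + (2 * x + 2 * y)
        move = solve-∀
      -- No digit is put out only if column and carry are empty, and then both summands are used up.
      go (_ , c′) e none v with split-empty t (cong proj₁ e)
      ... | t≡[] = cong (rev-val out) (empty xs ys c c′ t≡[] v)
        where
        empty : ∀ xs ys c c′ → unary xs ++ unary ys ++ c ≡ [] → 2 * length c′ ≡ length
            (unary xs ++ unary ys ++ c) + 0 →
                length c′ + val (tail xs) + val (tail ys) ≡ length c + val xs + val ys
        empty [] [] [] [] _ _ = refl
        empty [] [] [] (_ ∷ _) _ ()
        empty [] (true ∷ _) _ _ ()
        empty [] (false ∷ _) _ _ ()
        empty (true ∷ _) _ _ _ ()
        empty (false ∷ _) _ _ _ ()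

    work : Adder → ℕ
    work ((xs , ys) , (c , out)) = length xs + length ys + length c

    nonempties : List Bool → ℕ
    nonempties bs = caseList bs 0 (λ _ _ → 1)

    unary≤ : ∀ xs → length (unary xs) ≤ nonempties xs + nonempties xs
    unary≤ []           = z≤n
    unary≤ (true ∷ xs)  = ≤-refl
    unary≤ (false ∷ xs) = s≤s z≤n

    length-tail : ∀ (xs : List Bool) → nonempties xs + length (tail xs) ≡ length xs
    length-tail []       = refl
    length-tail (x ∷ xs) = refl

    -- Each nonempty summand loses one digit and contributes at most 2 to the column, so the column
    -- is at most twice the work it consumes. The digit put out is at least 1, which makes the new
    -- carry strictly smaller than the work consumed.
    work-decreases : ∀ a n → work a ≤ suc n → work (tick a) ≤ n
    work-decreases ((xs , ys) , (c , out)) n w≤ = go (split t) refl (split-small t ([] , []) none)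
        (split-value t ([] , []) none)
      where
      t = unary xs ++ unary ys ++ c
      ex = nonempties xs
      ey = nonempties ys
      t≤ : length t ≤ (ex + ey + length c) + (ex + ey + length c)
      t≤ = ≤-trans (≤-reflexive (length-t xs ys c)) (≤-trans
          (+-mono-≤ (unary≤ xs) (+-mono-≤ (unary≤ ys) (m≤m+n (length c) (length c))))
        (≤-reflexive (move ex ey (length c))))
        where
        move : ∀ a b c → a + a + (b + b + (c + c)) ≡ a + b + c + (a + b + c)
        move = solve-∀
      half : ∀ d m n → d + 2 * m ≤ n + n → 1 ≤ d → m < n
      half d m n le 1≤d = ≰⇒> λ n≤m → <-irrefl refl (≤-trans (s≤s (+-mono-≤ n≤m n≤m))
        (≤-trans (+-mono-≤ 1≤d (≤-reflexive (cong (m +_) (sym (+-identityʳ m))))) le))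
      rest : ∀ c′ → length c′ < ex + ey + length c → length (tail xs) + length (tail ys) + length c′ ≤ n
      rest c′ lt = +-cancelˡ-≤ 1 _ _ (+-cancelˡ-≤ (ex + ey + length c) _ _ (≤-trans
        (≤-reflexive (move ex ey (length c) (length (tail xs)) (length (tail ys)) (length c′)))
        (≤-trans (+-mono-≤ lt (≤-trans (≤-reflexive (cong₂ (λ a b → a + b + length c) (length-tail xs)
            (length-tail ys))) w≤)) ≤-refl)))
        where
        move : ∀ a b c x y z → a + b + c + (1 + (x + y + z)) ≡ suc z + (a + x + (b + y) + c)
        move = solve-∀
      go : ∀ s → split t ≡ s → Small (proj₁ s) → dval (proj₁ s) + 2 * length (proj₂ s) ≡ length t + 0 →
           length (tail xs) + length (tail ys) + length (proj₂ s) ≤ n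
      go (_ , c′) e (one b) v = rest c′ (half (digit b) (length c′) _
          (≤-trans (≤-reflexive (trans v (+-identityʳ _))) t≤) (1≤digit b))
      go (_ , c′) e none v = empty xs ys c c′ (split-empty t (cong proj₁ e)) v
        where
        empty : ∀ xs ys c c′ → unary xs ++ unary ys ++ c ≡ [] → 2 * length c′ ≡ length
            (unary xs ++ unary ys ++ c) + 0 →
                length (tail xs) + length (tail ys) + length c′ ≤ n
        empty [] [] [] [] _ _ = z≤n
        empty [] [] [] (_ ∷ _) _ ()
        empty [] (true ∷ _) _ _ ()
        empty [] (false ∷ _) _ _ ()
        empty (true ∷ _) _ _ _ ()
        empty (false ∷ _) _ _ _ ()

    ticks : List Bool → Adder → Adder
    ticks l a = foldl (λ a _ → tick a) a l

    ticks-value : ∀ l a → adder-value (ticks l a) ≡ adder-value a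
    ticks-value []      a = refl
    ticks-value (_ ∷ l) a = trans (ticks-value l (tick a)) (tick-value a)

    ticks-work : ∀ l a → work a ≤ length l → work (ticks l a) ≡ 0
    ticks-work []      a w≤ = n≤0⇒n≡0 w≤
    ticks-work (_ ∷ l) a w≤ = ticks-work l (tick a) (work-decreases a (length l) w≤)

    -- The list `xs ++ ys` is a clock: its length is the initial work, after which nothing is left
    -- to add.
    add : List Bool → List Bool → List Bool
    add xs ys = reverse (proj₂ (proj₂ (ticks (xs ++ ys) ((xs , ys) , ([] , [])))))

    add-correct : ∀ xs ys → val (add xs ys) ≡ val xs + val ys
    add-correct xs ys = trans (val-reverse (proj₂ (proj₂ a)) []) (trans (done a (ticks-work (xs ++ ys) _ w≤))
        (ticks-value (xs ++ ys) _))
      where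
      a = ticks (xs ++ ys) ((xs , ys) , ([] , []))
      w≤ : length xs + length ys + 0 ≤ length (xs ++ ys)
      w≤ = ≤-reflexive (trans (+-identityʳ _) (sym (length-++ xs)))
      done : ∀ a → work a ≡ 0 → rev-val (proj₂ (proj₂ a)) 0 ≡ adder-value a
      done (([] , []) , ([] , out)) _ = refl

  module _ {Ix : Set} where

    private variable
      Γ A : Code Ix

    private
      un-code : Code Ix
      un-code = 𝕃 𝟙

      unaryP : ∀ {l} → Poly Γ (𝕃 𝔹) l → Poly Γ un-code (λ ι γ → unary (l ι γ))
      unaryP L = caseP L nilP (ifP v1 (consP unitP (consP unitP nilP)) (consP unitP nilP))

      splitP : ∀ {l} → Poly Γ un-code l → Poly Γ (𝕃 𝔹 ⊠ un-code) (λ ι γ → split (l ι γ))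
      splitP L = foldP⁺ L ⟨ nilP , nilP ⟩P
        (caseP (fstP ∘P v0) ⟨ consP falseP nilP , sndP ∘P v0 ⟩P
          (ifP v1 ⟨ consP falseP nilP , consP unitP (sndP ∘P v2) ⟩P ⟨ consP trueP nilP , sndP ∘P v2 ⟩P))
        (K 9) (λ ι _ _ s → grows {ι} s)
        where
        grows : ∀ {ι} (s : List Bool × List ⊤) → sz (𝕃 𝔹 ⊠ un-code) {ι} (split-step s) ≤ sz (𝕃 𝔹 ⊠ un-code) {ι}
            s + 9
        grows {ι} ([] , c) = ≤-trans (m≤n+m (8 + sz un-code {ι} c) 3) (≤-reflexive (move (sz un-code {ι} c)))
          where
          move : ∀ c → 3 + (8 + c) ≡ suc (1 + c) + 9
          move = solve-∀
        grows {ι} (true ∷ bs , c) = ≤-trans (m≤m+n (10 + sz un-code {ι} c) (5 + sz (𝕃 𝔹) {ι} bs))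
            (≤-trans (n≤1+n _) (≤-reflexive (move (sz (𝕃 𝔹) {ι} bs) (sz un-code {ι} c))))
          where
          move : ∀ b c → suc (10 + c + (5 + b)) ≡ suc (suc (5 + b) + c) + 9
          move = solve-∀
        grows {ι} (false ∷ bs , c) = ≤-trans (m≤m+n (8 + sz un-code {ι} c) (8 + sz (𝕃 𝔹) {ι} bs))
            (≤-reflexive (move (sz (𝕃 𝔹) {ι} bs) (sz un-code {ι} c)))
          where
          move : ∀ b c → 8 + c + (8 + b) ≡ suc (suc (5 + b) + c) + 9
          move = solve-∀

      𝔸 : Code Ix
      𝔸 = (𝕃 𝔹 ⊠ 𝕃 𝔹) ⊠ (un-code ⊠ 𝕃 𝔹)

      tickP : Poly 𝔸 𝔸 (λ _ → tick)
      tickP = letP (splitP (++P (unaryP xs) (++P (unaryP ys) c)))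
        ⟨ ⟨ tailP (xs ∘P fstP) , tailP (ys ∘P fstP) ⟩P , ⟨ sndP ∘P v0 , ++P (fstP ∘P v0) (sndP ∘P sndP ∘P fstP)
            ⟩P ⟩P
        where
        xs : Poly 𝔸 (𝕃 𝔹) _
        xs = fstP ∘P fstP
        ys : Poly 𝔸 (𝕃 𝔹) _
        ys = sndP ∘P fstP
        c : Poly 𝔸 un-code _
        c = fstP ∘P sndP

      sz-un : ∀ {ι : Ix} (l : List ⊤) → sz un-code {ι} l ≡ 1 + length l * 2
      sz-un {ι} []      = refl
      sz-un {ι} (_ ∷ l) = cong (2 +_) (sz-un {ι} l)

      tick-grows : ∀ {ι} a → sz 𝔸 {ι} (tick a) ≤ sz 𝔸 {ι} a + 26
      tick-grows {ι} ((xs , ys) , (c , out)) = bound-by _ (split-small t ([] , []) none)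
          (split-value t ([] , []) none)
        where
        t = unary xs ++ unary ys ++ c
        tail≤ : ∀ bs → length (tail bs) ≤ length bs
        tail≤ []       = z≤n
        tail≤ (_ ∷ bs) = n≤1+n _
        unary≤2 : ∀ bs → length (unary bs) ≤ 2
        unary≤2 []           = z≤n
        unary≤2 (true ∷ bs)  = ≤-refl
        unary≤2 (false ∷ bs) = s≤s z≤n
        small≤1 : ∀ {bs} → Small bs → length bs ≤ 1
        small≤1 none    = z≤n
        small≤1 (one b) = ≤-refl
        carry≤ : ∀ (s : List Bool × List ⊤) → dval (proj₁ s) + 2 * length (proj₂ s) ≡ length t + 0 → length
            (proj₂ s) ≤ 4 + length c
        carry≤ s e = ≤-trans (≤-trans (m≤m+n (length (proj₂ s)) _) (m≤n+m _ (dval (proj₁ s))))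
            (≤-trans (≤-reflexive (trans e (trans (+-identityʳ _) (length-t xs ys c))))
          (+-mono-≤ (unary≤2 xs) (+-monoˡ-≤ (length c) (unary≤2 ys))))
        bound-by : ∀ s → Small (proj₁ s) → dval (proj₁ s) + 2 * length (proj₂ s) ≡ length t + 0 →
          sz 𝔸 {ι} ((tail xs , tail ys) , (proj₂ s , proj₁ s ++ out)) ≤ sz 𝔸 {ι} ((xs , ys) , (c , out)) + 26
        bound-by s small e
          rewrite sz-bits {ι = ι} (tail xs) | sz-bits {ι = ι} (tail ys) | sz-un {ι} (proj₂ s) | sz-bits {ι = ι}
              (proj₁ s ++ out)
                | sz-bits {ι = ι} xs | sz-bits {ι = ι} ys | sz-un {ι} c | sz-bits {ι = ι} out | length-++
                    (proj₁ s) {out} =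
          ≤-trans (s≤s (+-mono-≤ (s≤s (+-mono-≤ (s≤s (*-monoˡ-≤ 6 (tail≤ xs))) (s≤s (*-monoˡ-≤ 6 (tail≤ ys)))))
            (s≤s (+-mono-≤ (s≤s (*-monoˡ-≤ 2 (carry≤ s e)))
                (s≤s (*-monoˡ-≤ 6 (+-monoˡ-≤ (length out) (small≤1 small))))))))
            (≤-trans (m≤n+m _ 12) (≤-reflexive (move (length xs) (length ys) (length c) (length out))))
          where
          move : ∀ x y c o → 12 + suc (suc (1 + x * 6 + (1 + y * 6)) + suc
              (1 + (4 + c) * 2 + (1 + (1 + o) * 6))) ≡
                             suc (suc (1 + x * 6 + (1 + y * 6)) + suc (1 + c * 2 + (1 + o * 6))) + 26
          move = solve-∀

    abstract
      +P : ∀ {m n} → Poly Γ ℕ₂ m → Poly Γ ℕ₂ n → Poly Γ ℕ₂ (λ ι γ → m ι γ + n ι γ)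
      +P {Γ} {m} {n} M N = ext (λ ι γ → trans (add-correct (digits (m ι γ)) (digits (n ι γ)))
          (cong₂ _+_ (val-digits (m ι γ)) (val-digits (n ι γ))))
        (valP (reverseP (sndP ∘P sndP ∘P foldP⁺ {st = λ ι γ → tick (proj₂ γ)} (++P (digitsP M) (digitsP N))
          ⟨ ⟨ digitsP M , digitsP N ⟩P , ⟨ nilP , nilP ⟩P ⟩P (tickP ∘P v0) (K 26)
              (λ ι γ x s → tick-grows {ι} s))))

    private
      horner : ∀ y bs → foldr (λ b acc → (acc + acc) + (if b then y + y else y)) 0 bs ≡ val bs * y
      horner y []       = refl
      horner y (b ∷ bs) = trans (cong (λ z → (z + z) + (if b then y + y else y)) (horner y bs)) (lemma b)
        where
        lemma : ∀ b → (val bs * y + val bs * y) + (if b then y + y else y) ≡ (digit b + 2 * val bs) * y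
        lemma true  = two (val bs) y
          where
          two : ∀ v y → (v * y + v * y) + (y + y) ≡ (2 + 2 * v) * y
          two = solve-∀
        lemma false = one′ (val bs) y
          where
          one′ : ∀ v y → (v * y + v * y) + y ≡ (1 + 2 * v) * y
          one′ = solve-∀

    abstract
      *P : ∀ {m n} → Poly Γ ℕ₂ m → Poly Γ ℕ₂ n → Poly Γ ℕ₂ (λ ι γ → m ι γ * n ι γ)
      *P {Γ} {m} {n} M N =
        ext (λ ι γ → trans (trans (reverse-foldl (λ acc b → (acc + acc) + (if b then n ι γ + n ι γ else n ι γ))
            0 (digits (m ι γ)))
                                   (horner (n ι γ) (digits (m ι γ)))) (cong (_* n ι γ) (val-digits (m ι γ))))
        (foldP⁺ (reverseP (digitsP M)) (numP 0)
          (+P (+P v0 v0) (ifP v1 (+P (N ∘P fstP ∘P fstP) (N ∘P fstP ∘P fstP)) (N ∘P fstP ∘P fstP)))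
          (growth N ⊕ K 17)
          (λ ι γ b s → ≤-trans (sz-+ {ι = ι} (s + s) (d ι γ b))
              (≤-trans (+-mono-≤ (sz-double {ι = ι} s) (+-monoʳ-≤ 5 (d≤ ι γ b)))
             (≤-reflexive (move (sz ℕ₂ {ι} s) (⟦ growth N ⟧ (sz Γ γ + sz 𝔹 {ι} b)))))))
        where
        d : ∀ ι → Car Γ ι → Bool → ℕ
        d ι γ b = if b then n ι γ + n ι γ else n ι γ
        move : ∀ s g → s + 6 + (5 + (g + 6)) ≡ s + (g + 17)
        move = solve-∀
        n≤ : ∀ ι γ b → sz ℕ₂ {ι} (n ι γ) ≤ ⟦ growth N ⟧ (sz Γ γ + sz 𝔹 {ι} b)
        n≤ ι γ b = ≤-trans (out-size N ι γ) (mono (growth N) (m≤m+n (sz Γ γ) (sz 𝔹 {ι} b)))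
        d≤ : ∀ ι γ b → sz ℕ₂ {ι} (d ι γ b) ≤ ⟦ growth N ⟧ (sz Γ γ + sz 𝔹 {ι} b) + 6
        d≤ ι γ true  = ≤-trans (sz-double {ι = ι} (n ι γ)) (+-monoˡ-≤ 6 (n≤ ι γ true))
        d≤ ι γ false = ≤-trans (n≤ ι γ false) (m≤m+n _ 6)

  -- Comparison reads both numerals from the least significant digit; the flag records the
  -- comparison of the digits read so far.

  private
    refine : Bool → Bool → Bool → Bool
    refine b x y = if x then (if y then b else false) else (if y then true else b)

    -- Nonempty numerals are positive: if `ys` runs out first, the comparison fails for good, and
    -- digits of `ys` left at the end affirm it.
    le-step : Bool → List Bool × Bool → List Bool × Bool
    le-step x s = caseList (proj₁ s) ([] , false) (λ y ys → ys , refine (proj₂ s) x y)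

    le-end : List Bool × Bool → Bool
    le-end s = caseList (proj₁ s) (proj₂ s) (λ _ _ → true)

    le : Bool → List Bool → List Bool → Bool
    le b xs ys = le-end (foldl (λ s x → le-step x s) (ys , b) xs)

    -- The flag selects the relation still to be tested on the unread digits: ≤ for `true` and < for
    -- `false`.
    strict : Bool → ℕ
    strict b = if b then 0 else 1

    strict≤1 : ∀ b → strict b ≤ 1
    strict≤1 true  = z≤n
    strict≤1 false = ≤-refl

    double-≤ : ∀ b {u v} → strict b + u ≤ v → strict b + 2 * u ≤ 2 * v
    double-≤ true          le = *-monoʳ-≤ 2 le
    double-≤ false {u} {v} le = ≤-trans (n≤1+n _) (≤-trans (≤-reflexive (double u)) (*-monoʳ-≤ 2 le))
      where
      double : ∀ u → suc (1 + 2 * u) ≡ 2 * suc u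
      double = solve-∀

    refine-ok : ∀ b x y u v → strict (refine b x y) + u ≤ v → strict b + (digit x + 2 * u) ≤ digit y + 2 * v
    refine-ok b true true u v le = ≤-trans (≤-reflexive (move (strict b) u)) (s≤s (s≤s (double-≤ b le)))
      where
      move : ∀ s u → s + (2 + 2 * u) ≡ 2 + (s + 2 * u)
      move = solve-∀
    refine-ok b false false u v le = ≤-trans (≤-reflexive (move (strict b) u)) (s≤s (double-≤ b le))
      where
      move : ∀ s u → s + (1 + 2 * u) ≡ 1 + (s + 2 * u)
      move = solve-∀
    refine-ok b true false u v le = ≤-trans (+-monoˡ-≤ _ (strict≤1 b)) (≤-trans (≤-reflexive (double u))
        (s≤s (*-monoʳ-≤ 2 le)))
      where
      double : ∀ u → 1 + (2 + 2 * u) ≡ 1 + 2 * suc u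
      double = solve-∀
    refine-ok b false true u v le = +-mono-≤ (strict≤1 b) (s≤s (*-monoʳ-≤ 2 le))

    -- Refuting a comparison is affirming the reverse comparison with the opposite strictness.
    refine-not : ∀ b x y → refine (not b) y x ≡ not (refine b x y)
    refine-not b true  true  = refl
    refine-not b true  false = refl
    refine-not b false true  = refl
    refine-not b false false = refl

    exhausted : ∀ xs b → le-end (foldl (λ s x → le-step x s) ([] , false) (b ∷ xs)) ≡ false
    exhausted []       b = refl
    exhausted (x ∷ xs) b = exhausted xs x

    le-true : ∀ b xs ys → le b xs ys ≡ true → strict b + val xs ≤ val ys
    le-true true  []       []       _ = z≤n
    le-true b     []       (y ∷ ys) _ = ≤-trans (≤-reflexive (+-identityʳ _))
        (≤-trans (strict≤1 b) (≤-trans (1≤digit y) (m≤m+n _ (2 * val ys))))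
    le-true b     (x ∷ []) []       ()
    le-true b (x ∷ x′ ∷ xs) []      e with trans (sym (exhausted xs x′)) e
    ... | ()
    le-true b     (x ∷ xs) (y ∷ ys) e = refine-ok b x y (val xs) (val ys) (le-true (refine b x y) xs ys e)

    le-false : ∀ b xs ys → le b xs ys ≡ false → strict (not b) + val ys ≤ val xs
    le-false false []       []       _ = z≤n
    le-false b     (x ∷ xs) []       _ = ≤-trans (≤-reflexive (+-identityʳ _))
        (≤-trans (strict≤1 (not b)) (≤-trans (1≤digit x) (m≤m+n _ (2 * val xs))))
    le-false b     (x ∷ xs) (y ∷ ys) e = refine-ok (not b) y x (val ys) (val xs)
      (subst (λ c → strict c + val ys ≤ val xs) (sym (refine-not b x y)) (le-false (refine b x y) xs ys e))

    le-correct : ∀ m n → le true (digits m) (digits n) ≡ (m ≤ᵇ n)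
    le-correct m n with le true (digits m) (digits n) in e
    ... | true  = sym (T⇒≡ (≤⇒≤ᵇ (subst₂ _≤_ (val-digits m) (val-digits n) (le-true true (digits m) (digits n)
        e))))
      where
      open import Relation.Binary.PropositionalEquality using (subst₂)
      T⇒≡ : ∀ {b} → T b → b ≡ true
      T⇒≡ {true} _ = refl
    ... | false with m ≤ᵇ n in e′
    ...   | false = refl
    ...   | true with <-irrefl refl (≤-trans (subst₂ _<_ (val-digits n) (val-digits m)
        (le-false true (digits m) (digits n) e)) (≤ᵇ⇒≤ m n (subst T (sym e′) tt)))
      where open import Relation.Binary.PropositionalEquality using (subst₂)
    ...     | ()

    ≤ᵇ-antisym : ∀ m n → (m ≤ᵇ n) ∧ (n ≤ᵇ m) ≡ (m ≡ᵇ n)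
    ≤ᵇ-antisym zero    zero          = refl
    ≤ᵇ-antisym zero    (suc n)       = refl
    ≤ᵇ-antisym (suc m) zero          = refl
    ≤ᵇ-antisym (suc m) (suc n) = trans (cong₂ _∧_ (shift m n) (shift n m)) (≤ᵇ-antisym m n)
      where
      shift : ∀ m n → (suc m ≤ᵇ suc n) ≡ (m ≤ᵇ n)
      shift zero    n = refl
      shift (suc m) n = refl

  module _ {Ix : Set} where

    private variable
      Γ A : Code Ix

    abstract
      ≤P : ∀ {m n} → Poly Γ ℕ₂ m → Poly Γ ℕ₂ n → Poly Γ 𝔹 (λ ι γ → m ι γ ≤ᵇ n ι γ)
      ≤P {Γ} {m} {n} M N = ext (λ ι γ → le-correct (m ι γ) (n ι γ))
        (letP (foldP⁺ {S = 𝕃 𝔹 ⊠ 𝔹} {st = λ ι γ → le-step (proj₂ (proj₁ γ)) (proj₂ γ)} (digitsP M)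
            ⟨ digitsP N , trueP ⟩P
            (caseP (fstP ∘P v0) ⟨ nilP , falseP ⟩P
              ⟨ v0 , ifP v3 (ifP v1 (sndP ∘P v2) falseP) (ifP v1 trueP (sndP ∘P v2)) ⟩P)
            (K 0) (λ ι γ x s → ≤-trans (shrinks {ι} x s) (≤-reflexive (sym (+-identityʳ _)))))
          (caseP (fstP ∘P v0) (sndP ∘P v0) trueP))
        where
        5≡ : ∀ {ι : Ix} b → sz 𝔹 {ι} b ≡ 5
        5≡ true  = refl
        5≡ false = refl
        shrinks : ∀ {ι : Ix} x (s : List Bool × Bool) → sz (𝕃 𝔹 ⊠ 𝔹) {ι} (le-step x s) ≤ sz (𝕃 𝔹 ⊠ 𝔹) {ι} s
        shrinks {ι} x ([] , b) rewrite 5≡ {ι} b = ≤-refl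
        shrinks {ι} x (y ∷ ys , b) rewrite 5≡ {ι} b | 5≡ {ι} (refine b x y) = s≤s
            (+-monoˡ-≤ 5 (≤-trans (m≤n+m _ (sz 𝔹 {ι} y)) (n≤1+n _)))

      ≡P : ∀ {m n} → Poly Γ ℕ₂ m → Poly Γ ℕ₂ n → Poly Γ 𝔹 (λ ι γ → m ι γ ≡ᵇ n ι γ)
      ≡P {m = m} {n} M N = ext (λ ι γ → ≤ᵇ-antisym (m ι γ) (n ι γ)) (andP (≤P M N) (≤P N M))

-- The vehicle routing algorithm.

module Routing where

  open PolyTime using (caseList)
  open import Data.Nat using (ℕ; suc; _+_; _*_; _≤ᵇ_)

  -- The depot is not among the points X: w is the distance to it, d the distance between points.
  module Algorithm {X : Set} (w : X → ℕ) (d : X → X → ℕ) (dem : X → ℕ) (cap : ℕ) where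

    pathEnd : X → List X → ℕ
    pathEnd x []       = w x
    pathEnd x (y ∷ ys) = d x y + pathEnd y ys

    tourLength : List X → ℕ
    tourLength []       = 0
    tourLength (x ∷ xs) = w x + pathEnd x xs

    load : List X → ℕ
    load xs = sum (map dem xs)

    totalLength : List (List X) → ℕ
    totalLength L = sum (map tourLength L)

    better : List (List X) → List (List X) → List (List X)
    better L M = if totalLength L ≤ᵇ totalLength M then L else M

    -- Points that fit together and whose common tour saves at least 3/8 of the two single tours.
    compatible : X → X → Bool
    compatible x y = (dem x + dem y ≤ᵇ cap) ∧ (4 * d x y ≤ᵇ w x + w y)

    pick-step : X → List X × List X → X → List X × List X
    pick-step x s y = caseList (proj₁ s)
      (if compatible x y then ([ y ] , proj₂ s) else ([] , y ∷ proj₂ s)) (λ _ _ → proj₁ s , y ∷ proj₂ s)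

    pick : X → List X → List X × List X
    pick x l = foldl (pick-step x) ([] , []) l

    -- Besides compatibility of the pairs, the analysis uses only that no two unmatched points are
    -- compatible. Matching every new point with any compatible waiting point achieves this.
    match-step : List X × List (List X) → X → List X × List (List X)
    match-step s x = caseList (proj₁ (pick x (proj₁ s))) (x ∷ proj₁ s , proj₂ s)
      (λ y _ → proj₂ (pick x (proj₁ s)) , (x ∷ y ∷ []) ∷ proj₂ s)

    match : List X → List X × List (List X)
    match l = foldl match-step ([] , []) l

    -- Optimal partition of a sequence into consecutive tours.  The table holds, for every point
    -- of the sequence, the point and the partition of the rest of the sequence after it.
    Table : Set
    Table = List (X × List (List X))

    scan-step : List X × List (List X) → X × List (List X) → List X × List (List X)
    scan-step (seg , best) (z , E) = seg ++ [ z ] ,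
      (if load (seg ++ [ z ]) ≤ᵇ cap then better best ((seg ++ [ z ]) ∷ E) else best)

    scan : List X → List (List X) → Table → List (List X)
    scan seg best tb = proj₂ (foldl scan-step (seg , best) tb)

    partition-step : X → List (List X) × Table → List (List X) × Table
    partition-step x (E , tb) = scan [ x ] ([ x ] ∷ E) tb , (x , E) ∷ tb

    partitions : List X → List (List X) × Table
    partitions xs = foldr partition-step ([] , []) xs

    -- The threshold between small and big demands is the fraction p/(2p+1) of the capacity.
    small : ℕ → X → Bool
    small p x = suc (p + p) * dem x ≤ᵇ p * cap

    big : ℕ → X → Bool
    big p x = not (small p x)

    solveAt : ℕ → List X → List (List X)
    solveAt p xs = map [_] (proj₁ (match (filterᵇ (big p) xs))) ++
      (proj₂ (match (filterᵇ (big p) xs)) ++ proj₁ (partitions (filterᵇ (small p) xs)))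

    solve : List X → List (List X)
    solve xs = better (solveAt 2 xs) (solveAt 4 xs)

-- Cutting the traveling salesman tour into vehicle tours.

module Splitting where

  open Routing
  open import Data.List.Relation.Binary.Permutation.Propositional using (_↭_)
  open import Data.List.Relation.Binary.Permutation.Propositional.Properties using (map⁺)
  open import Data.List.Relation.Binary.Sublist.Propositional using (_⊆_; []; _∷_; _∷ʳ_)
  open import Data.List.Relation.Unary.All using (All; []; _∷_)
  open import Data.Nat using (ℕ; zero; suc; _+_; _*_; _∸_; _≤_; _<_; z≤n; s≤s; _≤ᵇ_; _<?_)
  open import Data.Nat.ListAction.Properties using (sum-++; sum-↭)
  open import Data.Nat.Properties

  ∑ : {A : Set} → (A → ℕ) → List A → ℕ
  ∑ f xs = sum (map f xs)

  module _ {A : Set} where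

    ∑-++ : ∀ (f : A → ℕ) xs ys → ∑ f (xs ++ ys) ≡ ∑ f xs + ∑ f ys
    ∑-++ f xs ys = trans (cong sum (map-++ f xs ys)) (sum-++ (map f xs) (map f ys))

    ∑-↭ : ∀ (f : A → ℕ) {xs ys} → xs ↭ ys → ∑ f xs ≡ ∑ f ys
    ∑-↭ f p = sum-↭ (map⁺ f p)

    ∑-concat : ∀ (f : A → ℕ) L → ∑ f (concat L) ≡ ∑ (∑ f) L
    ∑-concat f []      = refl
    ∑-concat f (l ∷ L) = trans (∑-++ f l (concat L)) (cong (∑ f l +_) (∑-concat f L))

    ∑-* : ∀ k (f : A → ℕ) xs → ∑ (λ x → k * f x) xs ≡ k * ∑ f xs
    ∑-* k f []       = sym (*-zeroʳ k)
    ∑-* k f (x ∷ xs) = trans (cong (k * f x +_) (∑-* k f xs)) (sym (*-distribˡ-+ k (f x) (∑ f xs)))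

    ∑-mono : ∀ {f g : A → ℕ} {xs} → All (λ x → f x ≤ g x) xs → ∑ f xs ≤ ∑ g xs
    ∑-mono []       = z≤n
    ∑-mono (p ∷ ps) = +-mono-≤ p (∑-mono ps)

  ∑< : (ℕ → ℕ) → ℕ → ℕ
  ∑< f zero    = 0
  ∑< f (suc n) = f n + ∑< f n

  ∑<-cong : ∀ {f g} n → (∀ i → i < n → f i ≡ g i) → ∑< f n ≡ ∑< g n
  ∑<-cong zero    e = refl
  ∑<-cong (suc n) e = cong₂ _+_ (e n ≤-refl) (∑<-cong n (λ i i<n → e i (m<n⇒m<1+n i<n)))

  ∑<-split : ∀ f m n → ∑< f (m + n) ≡ ∑< f m + ∑< (λ i → f (m + i)) n
  ∑<-split f m zero    = trans (cong (∑< f) (+-identityʳ m)) (sym (+-identityʳ _))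
  ∑<-split f m (suc n) rewrite +-suc m n | ∑<-split f m n = move (f (m + n)) (∑< f m) _
    where
    move : ∀ a b c → a + (b + c) ≡ b + (a + c)
    move = solve-∀

  ∑<-+ : ∀ c f n → ∑< (λ i → c + f i) n ≡ n * c + ∑< f n
  ∑<-+ c f zero    = refl
  ∑<-+ c f (suc n) rewrite ∑<-+ c f n = move c (f n) (n * c) (∑< f n)
    where
    move : ∀ a b c d → a + b + (c + d) ≡ a + c + (b + d)
    move = solve-∀

  -- Averaging takes the place of a random shift of the cut positions.
  below-average : ∀ f n → ∃[ r ] r < suc n × suc n * f r ≤ ∑< f (suc n)
  below-average f zero    = 0 , s≤s z≤n , ≤-refl
  below-average f (suc n) with below-average f n
  ... | r , r< , fr≤ with ≤-total (f r) (f (suc n))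
  ...   | inj₁ le = r , m<n⇒m<1+n r< , +-mono-≤ le fr≤
  ...   | inj₂ ge = suc n , ≤-refl , +-monoʳ-≤ (f (suc n)) (≤-trans (*-monoʳ-≤ (suc n) ge) fr≤)

  -- Shifting levels by a modulo W, where crossing W costs c.
  crossing : ℕ → ℕ → ℕ → (ℕ → ℕ) → ℕ → ℕ
  crossing W a c h r with r + a <? W
  ... | yes _ = h (r + a)
  ... | no  _ = c + h (r + a ∸ W)

  -- Adding a modulo W permutes the levels, and exactly a of them wrap around. A point is thus cut
  -- in proportion to its extent.
  ∑-crossing : ∀ W a c h → a ≤ W → ∑< (crossing W a c h) W ≡ a * c + ∑< h W
  ∑-crossing W a c h a≤W = begin
    ∑< (crossing W a c h) W                           ≡⟨ cong (∑< (crossing W a c h)) W≡ ⟨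
    ∑< (crossing W a c h) (b + a)                     ≡⟨ ∑<-split (crossing W a c h) b a ⟩
    ∑< (crossing W a c h) b + ∑< (λ i → crossing W a c h (b + i)) a
      ≡⟨ cong₂ _+_ (∑<-cong b below) (∑<-cong a above) ⟩
    ∑< (λ r → h (a + r)) b + ∑< (λ i → c + h i) a     ≡⟨ cong (∑< (λ r → h (a + r)) b +_) (∑<-+ c h a) ⟩
    ∑< (λ r → h (a + r)) b + (a * c + ∑< h a)         ≡⟨ move (∑< (λ r → h (a + r)) b) (a * c) (∑< h a) ⟩
    a * c + (∑< h a + ∑< (λ r → h (a + r)) b)         ≡⟨ cong (a * c +_) (∑<-split h a b) ⟨
    a * c + ∑< h (a + b)                              ≡⟨ cong (λ n → a * c + ∑< h n) (trans (+-comm a b) W≡) ⟩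
    a * c + ∑< h W                                    ∎
    where
    open Relation.Binary.PropositionalEquality.≡-Reasoning
    b = W ∸ a
    W≡ : b + a ≡ W
    W≡ = m∸n+n≡m a≤W
    move : ∀ x y z → x + (y + z) ≡ y + (z + x)
    move = solve-∀
    below : ∀ r → r < b → crossing W a c h r ≡ h (a + r)
    below r r<b with r + a <? W
    ... | yes _ = cong h (+-comm r a)
    ... | no ¬p = contradiction (<-≤-trans (+-monoˡ-< a r<b) (≤-reflexive W≡)) ¬p
    above : ∀ i → i < a → crossing W a c h (b + i) ≡ c + h i
    above i i<a with b + i + a <? W
    ... | yes p = contradiction p (≤⇒≯ (≤-trans (≤-reflexive (sym W≡)) (+-monoˡ-≤ a (m≤m+n b i))))
    ... | no  _ = cong (λ z → c + h z) (trans (cong (_∸ W)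
        (trans (trans (+-assoc b i a) (cong (b +_) (+-comm i a)))
        (trans (sym (+-assoc b a i)) (cong (_+ i) W≡)))) (m+n∸m≡n W i))

  module Tours {X : Set} (w : X → ℕ) (d : X → X → ℕ) (dem : X → ℕ) (cap : ℕ)
    (depot-tri : ∀ x y → w x ≤ d x y + w y)
    (depot-tri′ : ∀ x y → w y ≤ w x + d x y)
    (tri : ∀ x y z → d x z ≤ d x y + d y z) where

    open Algorithm w d dem cap

    pathEnd-tri : ∀ x y l → pathEnd x l ≤ d x y + pathEnd y l
    pathEnd-tri x y []      = depot-tri x y
    pathEnd-tri x y (z ∷ l) = ≤-trans (+-monoˡ-≤ _ (tri x y z)) (≤-reflexive (+-assoc (d x y) _ _))

    pathEnd-⊆ : ∀ x {l m} → l ⊆ m → pathEnd x l ≤ pathEnd x m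
    pathEnd-⊆ x []                     = ≤-refl
    pathEnd-⊆ x {m = y ∷ m} (.y ∷ʳ τ)  = ≤-trans (pathEnd-⊆ x τ) (pathEnd-tri x y m)
    pathEnd-⊆ x {m = y ∷ m} (refl ∷ τ) = +-monoʳ-≤ (d x y) (pathEnd-⊆ y τ)

    tourLength-drop : ∀ x l → tourLength l ≤ tourLength (x ∷ l)
    tourLength-drop x []      = z≤n
    tourLength-drop x (y ∷ l) = ≤-trans (+-monoˡ-≤ _ (depot-tri′ x y)) (≤-reflexive (+-assoc (w x) _ _))

    -- Shortcutting by the triangle inequality. It passes from all customers to the small ones, and
    -- it bounds a tour from below by a few of its points.
    tourLength-⊆ : ∀ {l m} → l ⊆ m → tourLength l ≤ tourLength m
    tourLength-⊆ []                     = ≤-refl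
    tourLength-⊆ {m = y ∷ m} (.y ∷ʳ τ)  = ≤-trans (tourLength-⊆ τ) (tourLength-drop y m)
    tourLength-⊆ {m = y ∷ m} (refl ∷ τ) = +-monoʳ-≤ (w y) (pathEnd-⊆ y τ)

    data NonEmpty : List X → Set where
      nonempty : ∀ x xs → NonEmpty (x ∷ xs)

    nonempty⇒≢[] : ∀ {s} → NonEmpty s → s ≢ []
    nonempty⇒≢[] (nonempty x xs) ()

    Tour : List X → Set
    Tour s = NonEmpty s × load s ≤ cap

    -- Cut positions are the multiples of W shifted by a level r < W; a point of demand e occupies
    -- the length (2p+1) e, and a point containing a cut ends its tour.
    module Cut (p : ℕ) where

      -- A full vehicle has extent `q * cap` and a small point at most `p * cap`. The distance W of
      -- the cuts is the difference, so the points before a cut and the point at the cut fit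
      -- together.
      W q : ℕ
      W = suc p * cap
      q = suc (p + p)

      extent : X → ℕ
      extent x = q * dem x

      Small : X → Set
      Small x = extent x ≤ p * cap

      extent≤W : ∀ {x} → Small x → extent x ≤ W
      extent≤W s = ≤-trans s (*-monoˡ-≤ cap {p} (n≤1+n p))

      attach : X → List (List X) → List (List X)
      attach x []      = [ x ] ∷ []
      attach x (s ∷ L) = (x ∷ s) ∷ L

      cuts : ℕ → List X → List (List X)
      cuts r []       = []
      cuts r (x ∷ xs) with r + extent x <? W
      ... | yes _ = attach x (cuts (r + extent x) xs)
      ... | no  _ = [ x ] ∷ cuts (r + extent x ∸ W) xs

      cutCost : List X → ℕ → ℕ
      cutCost []       r = 0
      cutCost (x ∷ xs) r = crossing W (extent x) (2 * w x) (cutCost xs) r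

      cuts-concat : ∀ r xs → concat (cuts r xs) ≡ xs
      cuts-concat r []       = refl
      cuts-concat r (x ∷ xs) with r + extent x <? W
      ... | yes _ = trans (attach-concat (cuts (r + extent x) xs)) (cong (x ∷_) (cuts-concat (r + extent x) xs))
        where
        attach-concat : ∀ L → concat (attach x L) ≡ x ∷ concat L
        attach-concat []      = refl
        attach-concat (s ∷ L) = refl
      ... | no  _ = cong (x ∷_) (cuts-concat (r + extent x ∸ W) xs)

      -- Counted from the last cut, the first segment starts at r; its final point may reach beyond
      -- the next cut, but by at most `p * cap`.
      HeadFits : ℕ → List (List X) → Set
      HeadFits r []      = ⊤
      HeadFits r (s ∷ L) = r + q * load s ≤ W + p * cap

      head-load : ∀ r s → r + q * load s ≤ W + p * cap → load s ≤ cap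
      head-load r s le = *-cancelˡ-≤ q (≤-trans (m≤n+m _ r)
          (≤-trans le (≤-reflexive (sym (*-distribʳ-+ cap (suc p) p)))))

      cuts-tours : ∀ r xs → r < W → All Small xs → All Tour (cuts r xs) × HeadFits r (cuts r xs)
      cuts-tours r []       r<W _            = [] , tt
      cuts-tours r (x ∷ xs) r<W (small ∷ ss) with r + extent x <? W
      ... | yes lt = attached (cuts (r + extent x) xs) (cuts-tours (r + extent x) xs lt ss)
        where
        attached : ∀ L → All Tour L × HeadFits (r + extent x) L → All Tour (attach x L) × HeadFits r
            (attach x L)
        attached []      _          = ((nonempty x [] , head-load r [ x ] fits) ∷ []) , fits
          where
          fits : r + q * (dem x + 0) ≤ W + p * cap
          fits = ≤-trans (≤-reflexive (cong (λ z → r + q * z) (+-identityʳ (dem x))))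
              (≤-trans (<⇒≤ lt) (m≤m+n W _))
        attached (s ∷ L) (t ∷ ts , h) = ((nonempty x s , head-load r (x ∷ s) fits) ∷ ts) , fits
          where
          fits : r + q * (dem x + load s) ≤ W + p * cap
          fits = ≤-trans (≤-reflexive (trans (cong (r +_) (*-distribˡ-+ q (dem x) (load s)))
              (sym (+-assoc r _ _)))) h
      ... | no ge = (nonempty x [] , head-load r [ x ] fits) ∷ proj₁ (cuts-tours (r + extent x ∸ W) xs below ss)
          , fits
        where
        fits : r + q * (dem x + 0) ≤ W + p * cap
        fits = ≤-trans (≤-reflexive (cong (λ z → r + q * z) (+-identityʳ (dem x)))) (+-mono-≤ (<⇒≤ r<W) small)
        below : r + extent x ∸ W < W
        below = +-cancelˡ-< W _ _ (≤-<-trans (≤-reflexive (m+[n∸m]≡n (≮⇒≥ ge)))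
            (+-mono-<-≤ r<W (extent≤W {x} small)))

      -- Both the first segment and the whole route receive x between the depot and the same next
      -- point, so their lengths change by the same amount. Writing the equation as a sum avoids
      -- subtraction.
      attach-length : ∀ x L → All Tour L →
        totalLength (attach x L) + tourLength (concat L) ≡ totalLength L + tourLength (x ∷ concat L)
      attach-length x []      _ = move (w x)
        where
        move : ∀ w → w + w + 0 + 0 ≡ 0 + (w + w)
        move = solve-∀
      attach-length x ((y ∷ ys) ∷ L) (t ∷ ts) =
        move (w x) (d x y) (pathEnd y ys) (totalLength L) (w y) (pathEnd y (ys ++ concat L))
        where
        move : ∀ a b c e f g → a + (b + c) + e + (f + g) ≡ f + c + e + (a + (b + g))
        move = solve-∀
      attach-length x ([] ∷ L) ((() , _) ∷ ts)

      cuts-length : ∀ r xs → r < W → All Small xs → totalLength (cuts r xs) ≤ tourLength xs + cutCost xs r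
      cuts-length r []       r<W _            = z≤n
      cuts-length r (x ∷ xs) r<W (small ∷ ss) with r + extent x <? W
      ... | yes lt = +-cancelʳ-≤ (tourLength xs) _ _ (≤-trans
            (≤-reflexive (subst (λ l → totalLength (attach x S) + tourLength l ≡ totalLength S + tourLength
                (x ∷ l))
               (cuts-concat (r + extent x) xs) (attach-length x S
                   (proj₁ (cuts-tours (r + extent x) xs lt ss)))))
            (≤-trans (+-monoˡ-≤ _ (cuts-length (r + extent x) xs lt ss))
                (≤-reflexive (move (tourLength xs) _ (tourLength (x ∷ xs))))))
        where
        S = cuts (r + extent x) xs
        move : ∀ a b c → a + b + c ≡ c + b + a
        move = solve-∀
      -- A cut at x costs one trip from the depot to x and back; the rest of the route is no longer
      -- than the route including x.
      ... | no ge = ≤-trans (+-monoʳ-≤ (w x + w x) (≤-trans (cuts-length (r + extent x ∸ W) xs below ss)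
          (+-monoˡ-≤ _ (tourLength-drop x xs))))
          (≤-reflexive (move (w x) (tourLength (x ∷ xs)) _))
        where
        below : r + extent x ∸ W < W
        below = +-cancelˡ-< W _ _ (≤-<-trans (≤-reflexive (m+[n∸m]≡n (≮⇒≥ ge)))
            (+-mono-<-≤ r<W (extent≤W {x} small)))
        move : ∀ w a b → w + w + (a + b) ≡ a + (2 * w + b)
        move = solve-∀

      ∑-cutCost : ∀ xs → All Small xs → ∑< (cutCost xs) W ≡ ∑ (λ x → extent x * (2 * w x)) xs
      ∑-cutCost []       _            = zeros W
        where
        zeros : ∀ n → ∑< (λ _ → 0) n ≡ 0
        zeros zero    = refl
        zeros (suc n) = zeros n
      ∑-cutCost (x ∷ xs) (small ∷ ss) = trans (∑-crossing W (extent x) (2 * w x) (cutCost xs)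
          (extent≤W {x} small))
        (cong (extent x * (2 * w x) +_) (∑-cutCost xs ss))

      -- Here `extent x` / W is the demand as a fraction of the capacity, divided by 1-a, so the
      -- last sum divided by W is the radial cost over 1-a.
      good-cuts : ∀ xs → 1 ≤ cap → All Small xs →
        ∃[ L ] concat L ≡ xs × All Tour L × W * totalLength L ≤ W * tourLength xs + ∑
            (λ x → extent x * (2 * w x)) xs
      good-cuts xs 1≤cap ss with level W (*-mono-≤ {1} {suc p} (s≤s z≤n) 1≤cap)
        where
        level : ∀ n → 1 ≤ n → ∃[ r ] r < n × n * cutCost xs r ≤ ∑< (cutCost xs) n
        level (suc n) _ = below-average (cutCost xs) n
      ... | r , r<W , avg = cuts r xs , cuts-concat r xs , proj₁ (cuts-tours r xs r<W ss) ,
        ≤-trans (*-monoʳ-≤ W (cuts-length r xs r<W ss))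
            (≤-trans (≤-reflexive (*-distribˡ-+ W (tourLength xs) _))
          (+-monoʳ-≤ (W * tourLength xs) (≤-trans avg (≤-reflexive (∑-cutCost xs ss)))))

    better-≤ˡ : ∀ L M → totalLength (better L M) ≤ totalLength L
    better-≤ˡ L M with totalLength L ≤ᵇ totalLength M in e
    ... | true  = ≤-refl
    ... | false = ≰⇒≥ (λ le → subst T e (≤⇒≤ᵇ le))

    better-≤ʳ : ∀ L M → totalLength (better L M) ≤ totalLength M
    better-≤ʳ L M with totalLength L ≤ᵇ totalLength M in e
    ... | true  = ≤ᵇ⇒≤ _ _ (subst T (sym e) tt)
    ... | false = ≤-refl

    better-case : ∀ (P : List (List X) → Set) L M → P L → P M → P (better L M)
    better-case P L M l m with totalLength L ≤ᵇ totalLength M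
    ... | true  = l
    ... | false = m

    private
      E : List X → List (List X)
      E xs = proj₁ (partitions xs)

      tb : List X → Table
      tb xs = proj₂ (partitions xs)

    IsPartition : List X → List (List X) → Set
    IsPartition xs L = concat L ≡ xs × All Tour L

    private
      snoc-nonempty : ∀ seg z → NonEmpty (seg ++ [ z ])
      snoc-nonempty []      z = nonempty z []
      snoc-nonempty (y ∷ l) z = nonempty y (l ++ [ z ])

    mutual

      partitions-correct : ∀ xs → All (λ x → dem x ≤ cap) xs → IsPartition xs (proj₁ (partitions xs))
      partitions-correct []       _        = refl , []
      partitions-correct (x ∷ xs) (d ∷ ds) = scan-correct xs [ x ] ([ x ] ∷ E xs) ds
        (cong (x ∷_) (proj₁ ih) , (nonempty x [] , ≤-trans (≤-reflexive (+-identityʳ (dem x))) d) ∷ proj₂ ih)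
        where
        ih = partitions-correct xs ds

      scan-correct : ∀ xs seg best → All (λ x → dem x ≤ cap) xs → IsPartition (seg ++ xs) best →
                     IsPartition (seg ++ xs) (scan seg best (proj₂ (partitions xs)))
      scan-correct []       seg best _        h = h
      scan-correct (z ∷ xs) seg best (d ∷ ds) h = subst
          (λ l → IsPartition l (scan (seg ++ [ z ]) best′ (tb xs))) (++-assoc seg [ z ] xs)
        (scan-correct xs (seg ++ [ z ]) best′ ds (subst (λ l → IsPartition l best′)
            (sym (++-assoc seg [ z ] xs)) h′))
        where
        best′ = if load (seg ++ [ z ]) ≤ᵇ cap then better best ((seg ++ [ z ]) ∷ E xs) else best
        h′ : IsPartition (seg ++ z ∷ xs) best′
        h′ with load (seg ++ [ z ]) ≤ᵇ cap in e
        ... | false = h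
        ... | true  = better-case (IsPartition (seg ++ z ∷ xs)) best ((seg ++ [ z ]) ∷ E xs) h
          (trans (cong ((seg ++ [ z ]) ++_) (proj₁ ih)) (++-assoc seg [ z ] xs)
          , (snoc-nonempty seg z , ≤ᵇ⇒≤ _ _ (subst T (sym e) tt)) ∷ proj₂ ih)
          where
          ih = partitions-correct xs ds

    private
      scan-≤ : ∀ xs seg best → totalLength (scan seg best (tb xs)) ≤ totalLength best
      scan-≤ []       seg best = ≤-refl
      scan-≤ (z ∷ xs) seg best = ≤-trans (scan-≤ xs (seg ++ [ z ]) _) smaller
        where
        smaller : totalLength (if load (seg ++ [ z ]) ≤ᵇ cap then better best ((seg ++ [ z ]) ∷ E xs) else best)
            ≤ totalLength best
        smaller with load (seg ++ [ z ]) ≤ᵇ cap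
        ... | true  = better-≤ˡ best _
        ... | false = ≤-refl

      -- The candidate with first tour `seg ++ z ∷ zs` is met when the scan arrives at its last
      -- point, and the remaining scan can only improve on it.
      scan-prefix : ∀ z zs ys seg best → load (seg ++ z ∷ zs) ≤ cap →
        totalLength (scan seg best (tb (z ∷ zs ++ ys))) ≤ totalLength ((seg ++ z ∷ zs) ∷ E ys)
      scan-prefix z [] ys seg best fits = ≤-trans (scan-≤ ys (seg ++ [ z ]) _) smaller
        where
        smaller : totalLength (if load (seg ++ [ z ]) ≤ᵇ cap then better best ((seg ++ [ z ]) ∷ E ys) else best)
            ≤ totalLength ((seg ++ [ z ]) ∷ E ys)
        smaller with load (seg ++ [ z ]) ≤ᵇ cap in e
        ... | true  = better-≤ʳ best _
        ... | false = contradiction (subst T e (≤⇒≤ᵇ fits)) (λ ())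
      scan-prefix z (z′ ∷ zs) ys seg best fits =
        subst (λ l → totalLength (scan seg best (tb (z ∷ z′ ∷ zs ++ ys))) ≤ totalLength (l ∷ E ys))
            (++-assoc seg [ z ] (z′ ∷ zs))
          (scan-prefix z′ zs ys (seg ++ [ z ]) _ (subst (λ l → load l ≤ cap)
              (sym (++-assoc seg [ z ] (z′ ∷ zs))) fits))

    -- By induction the table entry behind the first tour of L is as good as the rest of L, and the
    -- scan tries this first tour.
    partitions-optimal : ∀ L → All Tour L → totalLength (proj₁ (partitions (concat L))) ≤ totalLength L
    partitions-optimal []                  _              = ≤-refl
    partitions-optimal ((x ∷ []) ∷ L)      (_ ∷ ts)       =
      ≤-trans (scan-≤ (concat L) [ x ] _) (+-monoʳ-≤ (tourLength [ x ]) (partitions-optimal L ts))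
    partitions-optimal ((x ∷ z ∷ zs) ∷ L)  ((_ , l) ∷ ts) =
      ≤-trans (scan-prefix z zs (concat L) [ x ] _ l) (+-monoʳ-≤ (tourLength (x ∷ z ∷ zs))
          (partitions-optimal L ts))
    partitions-optimal ([] ∷ L)            ((() , _) ∷ ts)

-- Analysis of the routing algorithm.

module RoutingAnalysis where

  open Routing
  open Splitting
  open import Data.List.Membership.Propositional.Properties using (∈-filter⁺)
  import Data.List.Membership.DecPropositional as DecMembership
  open import Data.List.Relation.Binary.Permutation.Propositional using
      (_↭_; ↭-refl; ↭-trans; ↭-sym; ↭-reflexive; prep; ↭⇒↭ₛ)
  open import Data.List.Relation.Binary.Permutation.Propositional.Properties using
      (shift; ++⁺; ++⁺ʳ; All-resp-↭)
  import Data.List.Relation.Binary.Permutation.Setoid.Properties as Permₛ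
  open import Data.List.Relation.Binary.Sublist.Propositional using (_⊆_; []; _∷_; from∈)
  open import Data.List.Relation.Binary.Sublist.Propositional.Properties using (filter-⊆)
  open import Data.List.Relation.Unary.All as All using (All; []; _∷_)
  open import Data.List.Relation.Unary.All.Properties using (all-filter; ++⁻ˡ; ++⁻ʳ)
  import Data.List.Relation.Unary.All.Properties as Allₚ
  open import Data.List.Relation.Unary.AllPairs as AllPairs using (AllPairs; []; _∷_)
  import Data.List.Relation.Unary.AllPairs.Properties as AllPairsₚ
  open import Data.List.Relation.Unary.Any using (here; there)
  open import Data.Empty using (⊥)
  open import Data.Nat using (ℕ; NonZero; >-nonZero; suc; _+_; _*_; _≤_; _<_; z≤n; s≤s; _≤ᵇ_)
  open import Data.Nat.Properties
  open import Function.Bundles using (Equivalence)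
  open import Relation.Binary using (DecidableEquality)

  module Analysis {X : Set} (_≟_ : DecidableEquality X)
    (w : X → ℕ) (d : X → X → ℕ) (dem : X → ℕ) (cap : ℕ)
    (1≤cap : 1 ≤ cap)
    (dem≤cap : ∀ x → dem x ≤ cap)
    (d-sym : ∀ x y → d x y ≡ d y x)
    (depot-tri : ∀ x y → w x ≤ d x y + w y)
    (tri : ∀ x y z → d x z ≤ d x y + d y z) where

    open Algorithm w d dem cap
    open Tours w d dem cap depot-tri
      (λ x y → ≤-trans (depot-tri y x) (≤-reflexive (trans (+-comm (d y x) (w x)) (cong (w x +_) (d-sym y x)))))
          tri public
    open DecMembership _≟_ using (_∈?_)

    Incompatible : X → X → Set
    Incompatible x y = compatible x y ≡ false

    compatible-sym : ∀ x y → compatible x y ≡ compatible y x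
    compatible-sym x y = cong₂ _∧_ (cong (_≤ᵇ cap) (+-comm (dem x) (dem y)))
      (cong₂ _≤ᵇ_ (cong (4 *_) (d-sym x y)) (+-comm (w x) (w y)))

    pick-found : ∀ x y l kept → ∃[ kept′ ] foldl (pick-step x) ([ y ] , kept) l ≡ ([ y ] , kept′) × kept′ ↭ l ++
        kept
    pick-found x y []      kept = kept , refl , ↭-refl
    pick-found x y (z ∷ l) kept with pick-found x y l (z ∷ kept)
    ... | kept′ , eq , p = kept′ , eq , ↭-trans p (shift z l kept)

    pick-spec : ∀ x l kept → let r = foldl (pick-step x) ([] , kept) l in
      (proj₁ r ≡ [] × All (Incompatible x) l) ⊎
      (∃[ y ] ∃[ kept′ ] r ≡ ([ y ] , kept′) × compatible x y ≡ true × y ∷ kept′ ↭ l ++ kept)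
    pick-spec x []      kept = inj₁ (refl , [])
    pick-spec x (z ∷ l) kept with compatible x z in e
    ... | true with pick-found x z l kept
    ...   | kept′ , eq , p = inj₂ (z , kept′ , eq , e , prep z p)
    pick-spec x (z ∷ l) kept | false with pick-spec x l (z ∷ kept)
    ...   | inj₁ (eq , inc) = inj₁ (eq , e ∷ inc)
    ...   | inj₂ (y , kept′ , eq , c , p) = inj₂ (y , kept′ , eq , c , ↭-trans p (shift z l kept))

    data Matched : List X → Set where
      matched : ∀ x y → compatible x y ≡ true → Matched (x ∷ y ∷ [])

    record Matching (l : List X) (s : List X × List (List X)) : Set where
      field
        covers       : proj₁ s ++ concat (proj₂ s) ↭ l
        incompatible : AllPairs Incompatible (proj₁ s)
        pairs        : All Matched (proj₂ s)
    open Matching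

    match-step-spec : ∀ {l s} x → Matching l s → Matching (x ∷ l) (match-step s x)
    match-step-spec {l} {s} x M with pick x (proj₁ s) | pick-spec x (proj₁ s) []
    ... | ([] , _) | inj₁ (refl , inc) = record
      { covers = prep x (covers M) ; incompatible = inc ∷ incompatible M ; pairs = pairs M }
    ... | (_ , _) | inj₂ (y , kept′ , refl , c , p) = record
      { covers = ↭-trans (shift x kept′ (y ∷ C)) (prep x
          (↭-trans (shift y kept′ C) (↭-trans (++⁺ʳ C p′) (covers M))))
      -- Incompatibility is symmetric and therefore survives the reordering by `pick`; the partner
      -- y, brought to the front, is dropped.
      ; incompatible = AllPairs.tail (Permₛ.AllPairs-resp-↭ (setoid X) (λ {a} {b} e → trans (compatible-sym b a)
          e) (resp₂ Incompatible) (↭⇒↭ₛ (↭-sym p′)) (incompatible M))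
      ; pairs = matched x y c ∷ pairs M }
      where
      C = concat (proj₂ s)
      p′ : y ∷ kept′ ↭ proj₁ s
      p′ = ↭-trans p (↭-reflexive (++-identityʳ (proj₁ s)))

    match-spec : ∀ l → Matching l (match l)
    match-spec l = subst (λ m → Matching m (match l)) (++-identityʳ l)
      (go l [] (record { covers = ↭-refl ; incompatible = [] ; pairs = [] }))
      where
      go : ∀ l l₀ {s} → Matching l₀ s → Matching (l ++ l₀) (foldl match-step s l)
      go []      l₀ M = M
      go (x ∷ l) l₀ M = let N = go l (x ∷ l₀) (match-step-spec x M) in
        record { covers = ↭-trans (covers N) (shift x l l₀) ; incompatible = incompatible N ; pairs = pairs N }

    filter-↭ : ∀ (b : X → Bool) xs → filterᵇ (not ∘ b) xs ++ filterᵇ b xs ↭ xs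
    filter-↭ b []       = ↭-refl
    filter-↭ b (x ∷ xs) with b x
    ... | true  = ↭-trans (shift x (filterᵇ (not ∘ b) xs) (filterᵇ b xs)) (prep x (filter-↭ b xs))
    ... | false = prep x (filter-↭ b xs)

    module Threshold (p : ℕ) (xs : List X) where

      open Cut p using (W; q; Small; good-cuts; extent)

      bigs smalls unmatched : List X
      bigs      = filterᵇ (big p) xs
      smalls    = filterᵇ (small p) xs
      unmatched = proj₁ (match bigs)

      coupled : List (List X)
      coupled = proj₂ (match bigs)

      M : Matching bigs (match bigs)
      M = match-spec bigs

      all-small : ∀ l → All Small (filterᵇ (small p) l)
      all-small l = All.map (≤ᵇ⇒≤ _ _) (all-filter (T? ∘ small p) l)

      big⇒ : ∀ x → T (big p x) → p * cap < q * dem x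
      big⇒ x b with small p x in e
      ... | false = ≰⇒> (λ le → subst T e (≤⇒≤ᵇ le))

      all-big : All (T ∘ big p) (unmatched ++ concat coupled)
      all-big = All-resp-↭ (↭-sym (covers M)) (all-filter (T? ∘ big p) xs)

      solution-correct : concat (solveAt p xs) ↭ xs × All Tour (solveAt p xs)
      solution-correct =
          ↭-trans (↭-reflexive (trans (sym (concat-++ (map [_] unmatched) _)) (cong₂ _++_ (concat-[ unmatched ])
            (trans (sym (concat-++ coupled _)) (cong (concat coupled ++_) (proj₁ parts))))))
          (↭-trans (↭-reflexive (sym (++-assoc unmatched _ _))) (↭-trans (++⁺ʳ smalls (covers M))
              (filter-↭ (small p) xs)))
        , Allₚ.++⁺ (singles unmatched) (Allₚ.++⁺ (All.map tour (pairs M)) (proj₂ parts))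
        where
        parts : IsPartition smalls (proj₁ (partitions smalls))
        parts = partitions-correct smalls (All.universal dem≤cap smalls)
        concat-[_] : ∀ l → concat (map [_] l) ≡ l
        concat-[ [] ]    = refl
        concat-[ x ∷ l ] = cong (x ∷_) concat-[ l ]
        singles : ∀ l → All Tour (map [_] l)
        singles []      = []
        singles (x ∷ l) = (nonempty x [] , ≤-trans (≤-reflexive (+-identityʳ (dem x))) (dem≤cap x)) ∷ singles l
        tour : ∀ {s} → Matched s → Tour s
        tour (matched x y c) = nonempty x (y ∷ []) , ≤-trans
            (≤-reflexive (cong (dem x +_) (+-identityʳ (dem y))))
          (≤ᵇ⇒≤ _ _ (proj₁ (Equivalence.to T-∧ (subst T (sym c) tt))))

      -- The bound on the length of the solution, scaled by 8W, charges these amounts to the points.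
      charge : X → ℕ
      charge x = if small p x then 16 * (extent x * w x) else if does (x ∈? unmatched) then 16 * (W * w x) else
          10 * (W * w x)

      charge-small : ∀ {l} → All (T ∘ small p) l → ∑ charge l ≡ ∑ (λ x → 16 * (extent x * w x)) l
      charge-small []             = refl
      charge-small (_∷_ {x = x} s ss) with small p x
      ... | true = cong (16 * (extent x * w x) +_) (charge-small ss)

      ∑-parts : ∀ f l → ∑ f l ≡ ∑ f (filterᵇ (big p) l) + ∑ f (filterᵇ (small p) l)
      ∑-parts f l = trans (sym (∑-↭ f (filter-↭ (small p) l))) (∑-++ f (filterᵇ (big p) l) _)

      -- The partition is optimal, hence no longer than the good cuts, and the route through the
      -- small points is a shortcut of the route through all.
      length-smalls : 8 * (W * totalLength (proj₁ (partitions smalls))) ≤ 8 * (W * tourLength xs) + ∑ charge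
          smalls
      length-smalls with good-cuts smalls 1≤cap (all-small xs)
      ... | L , L≡ , ts , bound = ≤-trans (*-monoʳ-≤ 8 (≤-trans
          (*-monoʳ-≤ W (subst (λ l → totalLength (proj₁ (partitions l)) ≤ totalLength L) L≡
              (partitions-optimal L ts))) bound))
        (≤-trans (≤-reflexive (*-distribˡ-+ 8 (W * tourLength smalls) _)) (+-mono-≤
          (*-monoʳ-≤ 8 (*-monoʳ-≤ W (tourLength-⊆ (filter-⊆ (T? ∘ small p) xs))))
          (≤-reflexive (trans (sym (∑-* 8 _ smalls)) (trans (∑-cong smalls)
              (sym (charge-small (all-filter (T? ∘ small p) xs))))))))
        where
        move : ∀ a w → 8 * (a * (2 * w)) ≡ 16 * (a * w)
        move = solve-∀
        ∑-cong : ∀ l → ∑ (λ x → 8 * (extent x * (2 * w x))) l ≡ ∑ (λ x → 16 * (extent x * w x)) l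
        ∑-cong []      = refl
        ∑-cong (x ∷ l) = cong₂ _+_ (move (extent x) (w x)) (∑-cong l)

      length-singles : 8 * (W * totalLength (map [_] unmatched)) ≤ ∑ charge unmatched
      length-singles = ≤-trans (≤-reflexive (go unmatched))
          (∑-mono (bounds (++⁻ˡ unmatched all-big) (All.tabulate (λ m → m))))
        where
        move : ∀ k w l → 8 * (k * (w + w + l)) ≡ 16 * (k * w) + 8 * (k * l)
        move = solve-∀
        go : ∀ l → 8 * (W * totalLength (map [_] l)) ≡ ∑ (λ x → 16 * (W * w x)) l
        go []      = cong (8 *_) (*-zeroʳ W)
        go (x ∷ l) = trans (move W (w x) _) (cong (16 * (W * w x) +_) (go l))
        bounds : ∀ {l} → All (T ∘ big p) l → All (_∈ unmatched) l → All (λ x → 16 * (W * w x) ≤ charge x) l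
        bounds []       []       = []
        bounds (_∷_ {x = x} b bs) (m ∷ ms) = here′ ∷ bounds bs ms
          where
          here′ : 16 * (W * w x) ≤ charge x
          here′ with small p x
          ... | false with x ∈? unmatched
          ...   | yes _ = ≤-refl
          ...   | no ¬m = contradiction m ¬m

      -- A compatible pair satisfies 4 d ≤ w x + w y, so eight times the length of its tour is at
      -- most 10 (w x + w y).
      length-pairs : 8 * (W * totalLength coupled) ≤ ∑ charge (concat coupled)
      length-pairs = ≤-trans (go (pairs M)) (∑-mono (bounds (++⁻ʳ unmatched all-big)))
        where
        expand : ∀ k a e b l → 8 * (k * (a + (e + b) + l)) ≡ 8 * (k * a) + 8 * (k * b) + 2 * (k * (4 * e)) + 8 *
            (k * l)
        expand = solve-∀
        collect : ∀ k a b l → 8 * (k * a) + 8 * (k * b) + 2 * (k * (a + b)) + l ≡ 10 * (k * a) +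
            (10 * (k * b) + l)
        collect = solve-∀
        go : ∀ {L} → All Matched L → 8 * (W * totalLength L) ≤ ∑ (λ x → 10 * (W * w x)) (concat L)
        go []       = ≤-reflexive (cong (8 *_) (*-zeroʳ W))
        go {_ ∷ L} (matched x y c ∷ ms) = ≤-trans (≤-reflexive (expand W (w x) (d x y) (w y) (totalLength L)))
          (≤-trans (+-mono-≤ (+-monoʳ-≤ (8 * (W * w x) + 8 * (W * w y)) (*-monoʳ-≤ 2 (*-monoʳ-≤ W
              (≤ᵇ⇒≤ _ _ (proj₂ (Equivalence.to (T-∧ {dem x + dem y ≤ᵇ cap}) (subst T (sym c) tt))))))) (go ms))
            (≤-reflexive (collect W (w x) (w y) _)))
        bounds : ∀ {l} → All (T ∘ big p) l → All (λ x → 10 * (W * w x) ≤ charge x) l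
        bounds []       = []
        bounds (_∷_ {x = x} b bs) = here′ ∷ bounds bs
          where
          here′ : 10 * (W * w x) ≤ charge x
          here′ with small p x
          ... | false with x ∈? unmatched
          ...   | yes _ = *-monoˡ-≤ (W * w x) {10} {16} (m≤m+n 10 6)
          ...   | no  _ = ≤-refl

      solution-length : 8 * (W * totalLength (solveAt p xs)) ≤ 8 * (W * tourLength xs) + ∑ charge xs
      solution-length = ≤-trans (≤-reflexive (trans
          (cong (λ z → 8 * (W * z)) (trans (∑-++ tourLength (map [_] unmatched) _)
              (cong (totalLength (map [_] unmatched) +_) (∑-++ tourLength coupled _))))
          (expand W (totalLength (map [_] unmatched)) (totalLength coupled) _)))
        (≤-trans (+-mono-≤ length-singles (+-mono-≤ length-pairs length-smalls))
          (≤-reflexive (trans (move (∑ charge unmatched) _ (8 * (W * tourLength xs)) _)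
              (cong (8 * (W * tourLength xs) +_)
            (trans (cong (_+ ∑ charge smalls) (trans (sym (∑-++ charge unmatched _)) (∑-↭ charge (covers M))))
                (sym (∑-parts charge xs)))))))
        where
        expand : ∀ k a b c → 8 * (k * (a + (b + c))) ≡ 8 * (k * a) + (8 * (k * b) + 8 * (k * c))
        expand = solve-∀
        move : ∀ u c t s → u + (c + (t + s)) ≡ t + (u + c + s)
        move = solve-∀

      -- P is a tour of any solution used for comparison. The bound `2≤p` serves to exclude three
      -- big points and to get 13p + 21 ≤ 16(p + 1); `p≤4` serves tours without big points.
      module PerTour (P : List X) (distinct : AllPairs _≢_ P) (fits : load P ≤ cap) (2≤p : 2 ≤ p) (p≤4 : p ≤ 4)
          where

        t S : ℕ
        t = tourLength P
        S = load (filterᵇ (small p) P)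

        w≤t : ∀ {x} → x ∈ P → 2 * w x ≤ t
        w≤t {x} x∈P = ≤-trans (≤-reflexive (cong (w x +_) (+-identityʳ (w x)))) (tourLength-⊆ (from∈ x∈P))

        charge-smalls : ∑ charge (filterᵇ (small p) P) ≤ 8 * (t * (q * S))
        charge-smalls = ≤-trans (≤-reflexive (charge-small (all-filter (T? ∘ small p) P)))
          (≤-trans (∑-mono (Allₚ.filter⁺ (T? ∘ small p) (All.tabulate λ {x} x∈P → each x (w≤t x∈P))))
            (≤-reflexive (trans (∑-* (8 * (t * q)) dem (filterᵇ (small p) P)) (move t q S))))
          where
          move : ∀ t q s → 8 * (t * q) * s ≡ 8 * (t * (q * s))
          move = solve-∀
          double : ∀ q e w → 16 * (q * e * w) ≡ 8 * ((2 * w) * (q * e))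
          double = solve-∀
          each : ∀ x → 2 * w x ≤ t → 16 * (extent x * w x) ≤ 8 * (t * q) * dem x
          each x le = ≤-trans (≤-reflexive (double q (dem x) (w x)))
              (≤-trans (*-monoʳ-≤ 8 (*-monoˡ-≤ (extent x) le)) (≤-reflexive (sym (move t q (dem x)))))

        charge-parts : ∀ {l} → filterᵇ (big p) P ≡ l → ∑ charge P ≤ ∑ charge l + 8 * (t * (q * S))
        charge-parts refl = ≤-trans (≤-reflexive (∑-parts charge P)) (+-monoʳ-≤ _ charge-smalls)

        load-parts : ∀ {l} → filterᵇ (big p) P ≡ l → q * load l + q * S ≤ q * cap
        load-parts {l} refl = ≤-trans (≤-reflexive (sym (*-distribˡ-+ q (load l) S)))
            (*-monoʳ-≤ q (≤-trans (≤-reflexive (sym (∑-parts dem P))) fits))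

        bigs-in : ∀ {l} → filterᵇ (big p) P ≡ l → All (λ x → T (big p x) × x ∈ P) l
        bigs-in refl = All.zip (all-filter (T? ∘ big p) P , Allₚ.filter⁺ (T? ∘ big p) (All.tabulate (λ m → m)))

        qcap : q * cap ≡ p * cap + suc p * cap
        qcap = trans (*-distribʳ-+ cap (suc p) p) (+-comm (suc p * cap) (p * cap))

        -- As 8Wt stands for c(P), an unmatched big point pays at most c(P) and a matched one at
        -- most 5/8 of it. The exact charge of an unmatched point is kept for the case of two of
        -- them.
        data Class (x : X) : Set where
          un : x ∈ unmatched → charge x ≤ 8 * (W * t) → charge x ≡ 16 * (W * w x) → Class x
          ma : charge x ≤ 5 * (W * t) → Class x

        classify : ∀ x → T (big p x) → x ∈ P → Class x
        classify x b x∈P with small p x in e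
        ... | false with x ∈? unmatched in e′
        ...   | yes m = un m (≤-trans (≤-reflexive c) (≤-trans (≤-reflexive (move W (w x)))
            (*-monoʳ-≤ 8 (*-monoʳ-≤ W (w≤t x∈P))))) c
          where
          c : charge x ≡ 16 * (W * w x)
          c rewrite e | e′ = refl
          move : ∀ k w → 16 * (k * w) ≡ 8 * (k * (2 * w))
          move = solve-∀
        ...   | no ¬m = ma (≤-trans (≤-reflexive c) (≤-trans (≤-reflexive (move W (w x)))
            (*-monoʳ-≤ 5 (*-monoʳ-≤ W (w≤t x∈P)))))
          where
          c : charge x ≡ 10 * (W * w x)
          c rewrite e | e′ = refl
          move : ∀ k w → 10 * (k * w) ≡ 5 * (k * (2 * w))
          move = solve-∀

        -- In units of `cap * t` the value 2 c(P) is 16(p + 1). The coefficient 13p + 21 = 13(p + 1)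
        -- + 8 comes from tours with two big points, which are the worst good ones.
        Good : Set
        Good = ∑ charge P ≤ (13 * p + 21) * (cap * t)

        LoneUnmatched : Set
        LoneUnmatched = ∃[ v ] filterᵇ (big p) P ≡ [ v ] × q * dem v + q * S ≤ q * cap × p * cap ≤ q * dem v ×
          ∑ charge P ≤ 8 * (W * t) + 8 * (t * (q * S))

        -- The small points fill at most the whole capacity and pay 8(2p + 1); now 16p + 8 ≤ 13p +
        -- 21 holds up to p = 4.
        no-bigs : filterᵇ (big p) P ≡ [] → Good
        no-bigs e = ≤-trans (charge-parts e) (≤-trans (*-monoʳ-≤ 8 (*-monoʳ-≤ t
            (≤-trans (m≤n+m (q * S) (q * 0)) (load-parts e))))
          (≤-trans (≤-reflexive (move p cap t)) (*-monoˡ-≤ (cap * t) (≤-trans (≤-reflexive (move′ p))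
              (+-monoʳ-≤ (13 * p) (+-mono-≤ (*-monoʳ-≤ 3 p≤4) (m≤m+n 8 1)))))))
          where
          move : ∀ p c t → 8 * (t * (suc (p + p) * c)) ≡ (16 * p + 8) * (c * t)
          move = solve-∀
          move′ : ∀ p → 16 * p + 8 ≡ 13 * p + (3 * p + 8)
          move′ = solve-∀

        -- The big point leaves at most the fraction 1-a of the capacity, for which the small points
        -- pay at most c(P).
        one-big-S : ∀ {v} → p * cap ≤ q * dem v → q * dem v + q * S ≤ q * cap → q * S ≤ suc p * cap
        one-big-S {v} pc le = +-cancelˡ-≤ (p * cap) _ _ (≤-trans (+-monoˡ-≤ (q * S) pc)
            (≤-trans le (≤-reflexive qcap)))

        one-big : ∀ v → filterᵇ (big p) P ≡ [ v ] → Good ⊎ LoneUnmatched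
        one-big v e with bigs-in e
        ... | (b , v∈P) ∷ [] = go (classify v b v∈P)
          where
          pc : p * cap ≤ q * dem v
          pc = <⇒≤ (big⇒ v b)
          le : q * dem v + q * S ≤ q * cap
          le = ≤-trans (≤-reflexive (cong (λ z → q * z + q * S) (sym (+-identityʳ (dem v))))) (load-parts e)
          total≤ : ∑ charge P ≤ charge v + 8 * (t * (q * S))
          total≤ = ≤-trans (charge-parts e) (≤-reflexive (cong (_+ 8 * (t * (q * S))) (+-identityʳ (charge v))))
          go : Class v → Good ⊎ LoneUnmatched
          go (un _ c≤ _) = inj₂ (v , e , le , pc , ≤-trans total≤ (+-monoˡ-≤ _ c≤))
          go (ma c≤) = inj₁ (≤-trans total≤ (≤-trans (+-mono-≤ c≤
              (*-monoʳ-≤ 8 (*-monoʳ-≤ t (one-big-S {v} pc le))))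
            (≤-trans (≤-reflexive (move p cap t)) (*-monoˡ-≤ (cap * t) (+-monoʳ-≤ (13 * p) (m≤m+n 13 8))))))
            where
            move : ∀ p c t → 5 * (suc p * c * t) + 8 * (t * (suc p * c)) ≡ (13 * p + 13) * (c * t)
            move = solve-∀

        two-bigs : ∀ u v → filterᵇ (big p) P ≡ u ∷ v ∷ [] → Good
        two-bigs u v e with bigs-in e
        ... | (bu , u∈P) ∷ (bv , v∈P) ∷ [] = ≤-trans total≤
            (≤-trans (+-mono-≤ (go (classify u bu u∈P) (classify v bv v∈P)) (*-monoʳ-≤ 8 (*-monoʳ-≤ t qS≤)))
            (≤-reflexive (finish p cap t)))
          where
          finish : ∀ p c t → 13 * (suc p * c * t) + 8 * (t * c) ≡ (13 * p + 21) * (c * t)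
          finish = solve-∀
          total≤ : ∑ charge P ≤ (charge u + charge v) + 8 * (t * (q * S))
          total≤ = ≤-trans (charge-parts e) (≤-reflexive (cong (λ z → charge u + z + 8 * (t * (q * S)))
              (+-identityʳ (charge v))))
          loads : q * dem u + q * dem v + q * S ≤ q * cap
          loads = ≤-trans (≤-reflexive (cong (_+ q * S) (trans (sym (*-distribˡ-+ q (dem u) (dem v)))
              (cong (λ z → q * (dem u + z)) (sym (+-identityʳ (dem v))))))) (load-parts e)
          -- Two big points leave at most the fraction 1-2a = 1/q of the capacity.
          qS≤ : q * S ≤ cap
          qS≤ = +-cancelˡ-≤ (p * cap + p * cap) _ _ (≤-trans
              (+-monoˡ-≤ (q * S) (+-mono-≤ (<⇒≤ (big⇒ u bu)) (<⇒≤ (big⇒ v bv))))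
            (≤-trans loads (≤-reflexive (move p cap))))
            where
            move : ∀ p c → suc (p + p) * c ≡ p * c + p * c + c
            move = solve-∀
          uv⊆P : u ∷ v ∷ [] ⊆ P
          uv⊆P = subst (_⊆ P) e (filter-⊆ (T? ∘ big p) P)
          u≢v : u ≢ v
          u≢v with subst (AllPairs _≢_) e (AllPairsₚ.filter⁺ (T? ∘ big p) distinct)
          ... | (ne ∷ []) ∷ _ = ne
          fit : dem u + dem v ≤ cap
          fit = *-cancelˡ-≤ q (≤-trans (≤-reflexive (*-distribˡ-+ q (dem u) (dem v)))
              (≤-trans (m≤m+n _ (q * S)) loads))
          far : ∀ {l} → u ∈ l → v ∈ l → AllPairs Incompatible l → Incompatible u v
          far (here refl) (here refl) _        = contradiction refl u≢v
          far (here refl) (there m)   (i ∷ _)  = All.lookup i m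
          far (there m)   (here refl) (i ∷ _)  = trans (compatible-sym u v) (All.lookup i m)
          far (there m)   (there m′)  (_ ∷ is) = far m m′ is
          apart : Incompatible u v → w u + w v ≤ 4 * d u v
          apart inc with dem u + dem v ≤ᵇ cap in e₁ | 4 * d u v ≤ᵇ w u + w v in e₂
          ... | false | _     = contradiction (subst T e₁ (≤⇒≤ᵇ fit)) (λ ())
          ... | true  | false = ≰⇒≥ (λ le → subst T e₂ (≤⇒≤ᵇ le))
          apart () | true | true
          go : Class u → Class v → charge u + charge v ≤ 13 * (W * t)
          go (ma cu) (ma cv) = ≤-trans (+-mono-≤ cu cv) (≤-trans (≤-reflexive (sym (*-distribʳ-+ (W * t) 5 5)))
              (*-monoˡ-≤ (W * t) {10} {13} (m≤m+n 10 3)))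
          go (ma cu) (un _ cv _) = ≤-trans (+-mono-≤ cu cv) (≤-reflexive (sym (*-distribʳ-+ (W * t) 5 8)))
          go (un _ cu _) (ma cv) = ≤-trans (+-mono-≤ cu cv) (≤-reflexive (sym (*-distribʳ-+ (W * t) 8 5)))
          -- Points that fit together but are incompatible are far apart: t ≥ w u + d u v + w v ≥
          -- 5/4 (w u + w v). Hence 16W(w u + w v) ≤ 64/5 · Wt, rounded up to 13Wt; the factor 5
          -- clears the denominator.
          go (un mu _ cu) (un mv _ cv) = *-cancelˡ-≤ 5 (≤-trans
              (≤-reflexive (trans (cong (5 *_) (cong₂ _+_ cu cv)) (expand W (w u) (w v))))
            (≤-trans (*-monoʳ-≤ 16 (*-monoʳ-≤ W five≤)) (≤-trans (≤-reflexive (move W t))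
                (≤-trans (*-monoˡ-≤ (W * t) {64} {65} (n≤1+n 64)) (≤-reflexive (*-assoc 5 13 (W * t)))))))
            where
            expand : ∀ k a b → 5 * (16 * (k * a) + 16 * (k * b)) ≡ 16 * (k * (4 * (a + b) + (a + b)))
            expand = solve-∀
            move : ∀ k t → 16 * (k * (4 * t)) ≡ 64 * (k * t)
            move = solve-∀
            join : ∀ a b e → 4 * (a + b) + 4 * e ≡ 4 * (a + (e + b))
            join = solve-∀
            five≤ : 4 * (w u + w v) + (w u + w v) ≤ 4 * t
            five≤ = ≤-trans (+-monoʳ-≤ (4 * (w u + w v)) (apart (far mu mv (incompatible M))))
                (≤-trans (≤-reflexive (join (w u) (w v) (d u v))) (*-monoʳ-≤ 4 (tourLength-⊆ uv⊆P)))

        three-bigs : ∀ u v z l → filterᵇ (big p) P ≡ u ∷ v ∷ z ∷ l → Good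
        three-bigs u v z l e with bigs-in e
        ... | (bu , _) ∷ (bv , _) ∷ (bz , _) ∷ _ = contradiction too-much (<⇒≱ (n<1+n (q * cap)))
          where
          -- The three big points together exceed 3p · cap, and this is at least (2p + 1) · cap.
          too-much : suc (q * cap) ≤ q * cap
          too-much = ≤-trans (s≤s (≤-trans (≤-reflexive (move p cap))
              (≤-trans (+-monoʳ-≤ (p * cap + p * cap) (≤-trans (≤-reflexive (sym (*-identityˡ cap)))
              (*-monoˡ-≤ cap (≤-trans (s≤s z≤n) 2≤p))))
              (+-monoˡ-≤ (p * cap) (+-mono-≤ (<⇒≤ (big⇒ u bu)) (<⇒≤ (big⇒ v bv)))))))
            (≤-trans (≤-reflexive (sym (+-suc (q * dem u + q * dem v) (p * cap))))
                (≤-trans (+-monoʳ-≤ (q * dem u + q * dem v) (big⇒ z bz))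
              (≤-trans (≤-trans (m≤m+n _ (q * load l)) (≤-reflexive (collect q (dem u) (dem v) (dem z)
                  (load l)))) (≤-trans (m≤m+n _ (q * S)) (load-parts e)))))
            where
            move : ∀ p c → suc (p + p) * c ≡ p * c + p * c + c
            move = solve-∀
            collect : ∀ q a b c l → q * a + q * b + q * c + q * l ≡ q * (a + (b + (c + l)))
            collect = solve-∀

        per-tour : Good ⊎ LoneUnmatched
        per-tour = go (filterᵇ (big p) P) refl
          where
          go : ∀ l → filterᵇ (big p) P ≡ l → Good ⊎ LoneUnmatched
          go []              e = inj₁ (no-bigs e)
          go (v ∷ [])        e = one-big v e
          go (u ∷ v ∷ [])    e = inj₁ (two-bigs u v e)
          go (u ∷ v ∷ z ∷ l) e = inj₁ (three-bigs u v z l e)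

        -- The bound 2 c(P), for use with the threshold at which P may bring no gain.
        never-worse : ∑ charge P ≤ 16 * suc p * (cap * t)
        never-worse with per-tour
        ... | inj₁ good = ≤-trans good (*-monoˡ-≤ (cap * t)
            (≤-trans (≤-trans (+-monoʳ-≤ (13 * p) (+-mono-≤ (*-monoʳ-≤ 3 2≤p) ≤-refl)) (m≤m+n _ 1))
            (≤-reflexive (move p))))
          where
          move : ∀ p → 13 * p + (3 * p + 15) + 1 ≡ 16 * suc p
          move = solve-∀
        ... | inj₂ (v , e , le , pc , bound) = ≤-trans bound
            (≤-trans (+-monoʳ-≤ (8 * (W * t)) (*-monoʳ-≤ 8 (*-monoʳ-≤ t (one-big-S {v} pc le))))
            (≤-reflexive (move p cap t)))
          where
          move : ∀ p c t → 8 * (suc p * c * t) + 8 * (t * (suc p * c)) ≡ 16 * suc p * (c * t)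
          move = solve-∀

    -- A tour that is not good for the threshold 2/5 has a single big point; this point is either
    -- above 4/9, which leaves little room for other points, or all points are small for the threshold 4/9.
    combined : ∀ xs P → AllPairs _≢_ P → load P ≤ cap →
      5 * ∑ (Threshold.charge 2 xs) P + 3 * ∑ (Threshold.charge 4 xs) P ≤ 475 * (cap * tourLength P)
    combined xs P distinct fits = by-case (T₂.per-tour)
      where
      module T₂ = Threshold.PerTour 2 xs P distinct fits ≤-refl (s≤s (s≤s z≤n))
      module T₄ = Threshold.PerTour 4 xs P distinct fits (s≤s (s≤s z≤n)) ≤-refl
      φ₂ φ₄ ct : ℕ
      φ₂ = ∑ (Threshold.charge 2 xs) P
      φ₄ = ∑ (Threshold.charge 4 xs) P
      ct = cap * tourLength P
      -- The charges are scaled by 8 · 3 · cap and 8 · 5 · cap; the weights 5 and 3 equalize this,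
      -- so a plain average is formed. The bound 2 c(P) reads 48 and 80, and 5 · 47 + 3 · 80 = 475
      -- falls short of 480 by 1/96.
      first-good : φ₂ ≤ 47 * ct → 5 * φ₂ + 3 * φ₄ ≤ 475 * ct
      first-good g = ≤-trans (+-mono-≤ (*-monoʳ-≤ 5 g) (*-monoʳ-≤ 3 T₄.never-worse)) (≤-reflexive (move ct))
        where
        move : ∀ c → 5 * (47 * c) + 3 * (80 * c) ≡ 475 * c
        move = solve-∀
      second-good : φ₄ ≤ 73 * ct → 5 * φ₂ + 3 * φ₄ ≤ 475 * ct
      second-good g = ≤-trans (+-mono-≤ (*-monoʳ-≤ 5 T₂.never-worse) (*-monoʳ-≤ 3 g))
        (≤-trans (≤-reflexive (move ct)) (*-monoˡ-≤ ct {459} {475} (m≤m+n 459 16)))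
        where
        move : ∀ c → 5 * (48 * c) + 3 * (73 * c) ≡ 459 * c
        move = solve-∀
      by-case : T₂.Good ⊎ T₂.LoneUnmatched → 5 * φ₂ + 3 * φ₄ ≤ 475 * ct
      by-case (inj₁ good) = first-good good
      by-case (inj₂ (v , e , le , _ , bound)) with small 4 v in s
      -- Here 9 dem v ≥ 4 cap, so the small points have 5S ≤ 25/9 · cap, and the charge for 2/5 is
      -- at most 24 + 8 · 25/9 = 416/9 < 47. All is multiplied by 9, and the summand added on both
      -- sides replaces a subtraction.
      ... | false = first-good (*-cancelˡ-≤ 9 (≤-trans (+-cancelʳ-≤ (40 * (t * (4 * cap))) _ _ large)
          (≤-trans (*-monoˡ-≤ ct {416} {423} (m≤m+n 416 7)) (≤-reflexive (*-assoc 9 47 ct)))))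
        where
        t S : ℕ
        t = tourLength P
        S = T₂.S
        expand : ∀ c t s e → 9 * (8 * (3 * c * t) + 8 * (t * (5 * s))) + 40 * (t * (9 * e)) ≡ 216 * (c * t) + 72
            * (t * (5 * e + 5 * s))
        expand = solve-∀
        collect : ∀ c t → 216 * (c * t) + 72 * (t * (5 * c)) ≡ 416 * (c * t) + 40 * (t * (4 * c))
        collect = solve-∀
        large : 9 * φ₂ + 40 * (t * (4 * cap)) ≤ 416 * ct + 40 * (t * (4 * cap))
        large = ≤-trans (+-mono-≤ (*-monoʳ-≤ 9 bound) (*-monoʳ-≤ 40
            (*-monoʳ-≤ t (≰⇒≥ (λ l → subst T s (≤⇒≤ᵇ l))))))
          (≤-trans (≤-reflexive (expand cap t S (dem v)))
              (≤-trans (+-monoʳ-≤ (216 * ct) (*-monoʳ-≤ 72 (*-monoʳ-≤ t le))) (≤-reflexive (collect cap t))))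
      -- The points other than v are small for 2/5, hence for 4/9, and so is v by the case
      -- distinction. With threshold 4/9 the tour has no big point.
      ... | true  = second-good (T₄.no-bigs (filter-none (T? ∘ big 4) (All.tabulate not-big)))
        where
        small₂₄ : ∀ x → T (small 2 x) → T (small 4 x)
        small₂₄ x h = ≤⇒≤ᵇ {9 * dem x} {4 * cap} (*-cancelˡ-≤ 5
            (≤-trans (≤-reflexive (trans (sym (*-assoc 5 9 (dem x))) (*-assoc 9 5 (dem x))))
          (≤-trans (*-monoʳ-≤ 9 (≤ᵇ⇒≤ (5 * dem x) (2 * cap) h)) (≤-trans (≤-reflexive (sym (*-assoc 9 2 cap)))
              (≤-trans (*-monoˡ-≤ cap {18} {20} (m≤m+n 18 2)) (≤-reflexive (*-assoc 5 4 cap)))))))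
        not-not : ∀ {b} → T b → T (not b) → ⊥
        not-not {true} _ ()
        not-big : ∀ {x} → x ∈ P → T (big 4 x) → ⊥
        not-big {x} x∈P with small 2 x in e₂
        ... | true  = not-not (small₂₄ x (subst T (sym e₂) tt))
        ... | false with subst (x ∈_) e (∈-filter⁺ (T? ∘ big 2) x∈P (subst (T ∘ not) (sym e₂) tt))
        ...   | here refl = not-not (subst T (sym s) tt)

    private
      split-AllPairs : ∀ {R : X → X → Set} k {l} → AllPairs R (k ++ l) → AllPairs R k × AllPairs R l
      split-AllPairs []      rs       = [] , rs
      split-AllPairs (x ∷ k) (r ∷ rs) = let (rk , rl) = split-AllPairs k rs in ++⁻ˡ k r ∷ rk , rl

    solve-correct : ∀ xs → concat (solve xs) ↭ xs × All Tour (solve xs)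
    solve-correct xs = better-case (λ L → concat L ↭ xs × All Tour L) (solveAt 2 xs) (solveAt 4 xs)
      (Threshold.solution-correct 2 xs) (Threshold.solution-correct 4 xs)

    -- The better solution is at most the average of the two. Summing `combined` over the tours of L
    -- gives the factor 475/240 = 95/48 = 2(1 - 1/96).
    solve-length : ∀ xs → AllPairs _≢_ xs → ∀ L → concat L ↭ xs → All (λ P → load P ≤ cap) L →
      48 * totalLength (solve xs) ≤ 48 * tourLength xs + 95 * totalLength L
    solve-length xs distinct L L↭xs fits = *-cancelˡ-≤ (5 * cap)
        (≤-trans (≤-reflexive (halve cap (totalLength (solve xs))))
      (≤-trans (+-mono-≤ (*-monoʳ-≤ 5 (bound 2 (better-≤ˡ (solveAt 2 xs) (solveAt 4 xs))))
          (*-monoʳ-≤ 3 (bound 4 (better-≤ʳ (solveAt 2 xs) (solveAt 4 xs)))))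
      (≤-trans (≤-reflexive (collect cap (tourLength xs) (∑ φ₂ xs) (∑ φ₄ xs)))
      (≤-trans (+-monoʳ-≤ (240 * (cap * tourLength xs)) charges)
          (≤-reflexive (finish cap (tourLength xs) (totalLength L)))))))
      where
      instance
        cap-nonZero : NonZero (5 * cap)
        cap-nonZero = >-nonZero (*-mono-≤ {1} {5} (s≤s z≤n) 1≤cap)
      φ₂ φ₄ : X → ℕ
      φ₂ = Threshold.charge 2 xs
      φ₄ = Threshold.charge 4 xs
      halve : ∀ c m → 5 * c * (48 * m) ≡ 5 * (8 * (3 * c * m)) + 3 * (8 * (5 * c * m))
      halve = solve-∀
      collect : ∀ c t a b → 5 * (8 * (3 * c * t) + a) + 3 * (8 * (5 * c * t) + b) ≡ 240 * (c * t) +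
          (5 * a + 3 * b)
      collect = solve-∀
      finish : ∀ c t l → 240 * (c * t) + 475 * (c * l) ≡ 5 * c * (48 * t + 95 * l)
      finish = solve-∀
      bound : ∀ p → totalLength (solve xs) ≤ totalLength (solveAt p xs) →
        8 * (suc p * cap * totalLength (solve xs)) ≤ 8 * (suc p * cap * tourLength xs) + ∑
            (Threshold.charge p xs) xs
      bound p le = ≤-trans (*-monoʳ-≤ 8 (*-monoʳ-≤ (suc p * cap) le)) (Threshold.solution-length p xs)
      charges : 5 * ∑ φ₂ xs + 3 * ∑ φ₄ xs ≤ 475 * (cap * totalLength L)
      charges = ≤-trans (≤-reflexive (cong₂ (λ a b → 5 * a + 3 * b) (sym (∑-↭ φ₂ L↭xs)) (sym (∑-↭ φ₄ L↭xs))))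
        (go L (Permₛ.AllPairs-resp-↭ (setoid X) (λ ne e → ne (sym e)) (resp₂ _≢_) (↭⇒↭ₛ (↭-sym L↭xs)) distinct)
            fits)
        where
        go : ∀ L → AllPairs _≢_ (concat L) → All (λ P → load P ≤ cap) L →
          5 * ∑ φ₂ (concat L) + 3 * ∑ φ₄ (concat L) ≤ 475 * (cap * totalLength L)
        go []      _  _        = z≤n
        go (P ∷ L) ds (f ∷ fs) with split-AllPairs P ds
        ... | dP , dL = ≤-trans (≤-reflexive (trans (cong₂ (λ a b → 5 * a + 3 * b) (∑-++ φ₂ P (concat L))
            (∑-++ φ₄ P (concat L)))
              (move (∑ φ₂ P) (∑ φ₂ (concat L)) (∑ φ₄ P) (∑ φ₄ (concat L)))))
            (≤-trans (+-mono-≤ (combined xs P dP f) (go L dL fs))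
                (≤-reflexive (join cap (tourLength P) (totalLength L))))
          where
          move : ∀ a b c e → 5 * (a + b) + 3 * (c + e) ≡ (5 * a + 3 * c) + (5 * b + 3 * e)
          move = solve-∀
          join : ∀ c a b → 475 * (c * a) + 475 * (c * b) ≡ 475 * (c * (a + b))
          join = solve-∀

-- The routing algorithm runs in polynomial time.

module PolyRouting where

  open Routing
  open StackMachine
  open PolyTime
  open PolyLists
  open PolyArithmetic
  open import Data.List.Relation.Unary.All using (All; []; _∷_)
  open import Data.Nat using (ℕ; suc; _+_; _*_; _≤_; z≤n; s≤s; _≤ᵇ_)
  open import Data.Nat.Properties

  module _ {Ix : Set} where

    private variable
      Γ E S : Code Ix

    -- Here the increment may depend on a part of the state that an invariant keeps bounded, such as
    -- the last visited point in the computation of a tour length.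
    foldPⁱ : ∀ {l i st} → Poly Γ (𝕃 E) l → Poly Γ S i → Poly (Γ ⊠ E ⊠ S) S st → (k : Bound) →
      (Inv : ∀ {ι} → ℕ → Car S ι → Set) →
      (∀ ι γ n → sz S (i ι γ) ≤ n → Inv n (i ι γ)) →
      (∀ ι γ x s n → sz Γ γ ≤ n → sz E x ≤ n → Inv n s →
        Inv n (st ι ((γ , x) , s)) × sz S (st ι ((γ , x) , s)) ≤ sz S s + ⟦ k ⟧ n) →
      Poly Γ S (λ ι γ → foldl (λ s x → st ι ((γ , x) , s)) (i ι γ) (l ι γ))
    foldPⁱ {Γ} {E} {S} {l} {i} {st} L I F k Inv start grows = foldP L I F (growth I ⊕ growth L ⊗ k ⊙ N) bounded
      where
      N : Bound
      N = X ⊕ (growth I ⊕ growth L)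
      fold≤ : ∀ ι γ n s l → sz Γ γ ≤ n → sz (𝕃 E) l ≤ n → Inv n s →
        sz S (foldl (λ s x → st ι ((γ , x) , s)) s l) ≤ sz S s + length l * ⟦ k ⟧ n
      fold≤ ι γ n s []      _  _  _   = ≤-reflexive (sym (+-identityʳ _))
      fold≤ ι γ n s (x ∷ l) γ≤ l≤ inv with grows ι γ x s n γ≤ (≤-trans (≤-trans (m≤m+n (sz E x) _) (n≤1+n _))
          l≤) inv
      ... | inv′ , s≤ = ≤-trans (fold≤ ι γ n _ l γ≤ (≤-trans (≤-trans (m≤n+m _ (sz E x)) (n≤1+n _)) l≤) inv′)
        (≤-trans (+-monoˡ-≤ _ s≤) (≤-reflexive (+-assoc (sz S s) _ _)))
      bounded : ∀ ι γ l₁ l₂ → l ι γ ≡ l₁ ++ l₂ → _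
      bounded ι γ l₁ l₂ eq = ≤-trans
        (fold≤ ι γ (⟦ N ⟧ (sz Γ γ)) (i ι γ) l₁ (m≤m+n _ _)
            (≤-trans l₁≤ (≤-trans (m≤n+m _ (⟦ growth I ⟧ (sz Γ γ))) (m≤n+m _ (sz Γ γ))))
          (start ι γ _ (≤-trans (out-size I ι γ) (≤-trans (m≤m+n _ (⟦ growth L ⟧ (sz Γ γ)))
              (m≤n+m _ (sz Γ γ))))))
        (+-mono-≤ (out-size I ι γ) (*-monoˡ-≤ _ (≤-trans (length≤sz E l₁) l₁≤)))
        where
        l₁≤ : sz (𝕃 E) l₁ ≤ ⟦ growth L ⟧ (sz Γ γ)
        l₁≤ = ≤-trans (sz-prefix E l₁ l₂) (≤-trans (≤-reflexive (cong (sz (𝕃 E)) (sym eq))) (out-size L ι γ))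

    abstract
      sumP : ∀ {l} → Poly Γ (𝕃 ℕ₂) l → Poly Γ ℕ₂ (λ ι γ → sum (l ι γ))
      sumP {Γ} {l} L = ext (λ ι γ → trans (reverse-foldl (λ s x → x + s) 0 (l ι γ)) refl)
        (foldP⁺ (reverseP L) (numP 0) (+P v1 v0) (X ⊕ K 5) (λ ι γ x s → ≤-trans (sz-+ {ι = ι} x s)
          (≤-trans (≤-reflexive (move (sz ℕ₂ {ι} x) (sz ℕ₂ {ι} s)))
              (+-monoʳ-≤ (sz ℕ₂ {ι} s) (+-monoˡ-≤ 5 (m≤n+m _ (sz Γ γ)))))))
        where
        move : ∀ x s → x + (5 + s) ≡ s + (x + 5)
        move = solve-∀

  module PolyRouting {Ix : Set} (𝕏 : Code Ix)
    (w : ∀ ι → Car 𝕏 ι → ℕ) (d : ∀ ι → Car 𝕏 ι → Car 𝕏 ι → ℕ) (dem : ∀ ι → Car 𝕏 ι → ℕ) (cap : Ix → ℕ)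
    (wP : Poly 𝕏 ℕ₂ w) (dP : Poly (𝕏 ⊠ 𝕏) ℕ₂ (λ ι p → d ι (proj₁ p) (proj₂ p))) (demP : Poly 𝕏 ℕ₂ dem)
    (capP : Poly 𝕏 ℕ₂ (λ ι _ → cap ι))
    -- Nonempty tours that make up `xs` have a code linear in that of `xs`; this bounds the entries
    -- of the dynamic programming table.
    (partitions-shape : ∀ ι xs →
       concat (proj₁ (Algorithm.partitions (w ι) (d ι) (dem ι) (cap ι) xs)) ≡ xs ×
       All (_≢ []) (proj₁ (Algorithm.partitions (w ι) (d ι) (dem ι) (cap ι) xs))) where

    module A ι = Algorithm (w ι) (d ι) (dem ι) (cap ι)

    private
      variable
        Γ : Code Ix

      𝕋 : Code Ix
      𝕋 = 𝕃 (𝕏 ⊠ 𝕃 (𝕃 𝕏))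

    abstract
      tourLengthP : Poly (𝕃 𝕏) ℕ₂ (λ ι → A.tourLength ι)
      tourLengthP = ext eq (caseP idP (numP 0) (+P (wP ∘P fstP ∘P path) (sndP ∘P path)))
        where
        follow : ∀ ι → Car (𝕏 ⊠ ℕ₂) ι → Car 𝕏 ι → Car (𝕏 ⊠ ℕ₂) ι
        follow ι (y , acc) z = z , acc + d ι y z
        path : Poly (𝕃 𝕏 ⊠ 𝕏 ⊠ 𝕃 𝕏) (𝕏 ⊠ ℕ₂) (λ ι γ → foldl (follow ι) (proj₂ (proj₁ γ) , w ι (proj₂ (proj₁ γ)))
            (proj₂ γ))
        path = foldPⁱ {st = λ ι γ → follow ι (proj₂ γ) (proj₂ (proj₁ γ))} v0 ⟨ v1 , wP ∘P v1 ⟩P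
          ⟨ v1 , +P (sndP ∘P v0) (dP ∘P ⟨ fstP ∘P v0 , v1 ⟩P) ⟩P
          (X ⊕ K 5 ⊕ growth dP ⊙ (K 1 ⊕ X ⊕ X))
          (λ n s → sz 𝕏 (proj₁ s) ≤ n)
          (λ ι γ n le → ≤-trans (≤-trans (m≤m+n _ _) (n≤1+n _)) le)
          (λ { ι γ z (y , acc) n _ z≤ y≤ → z≤ ,
            ≤-trans (s≤s (+-mono-≤ z≤ (≤-trans (sz-+ {ι = ι} acc (d ι y z))
                (+-monoʳ-≤ _ (+-monoʳ-≤ 5 (≤-trans (out-size dP ι (y , z))
                (mono (growth dP) (s≤s (+-mono-≤ y≤ z≤)))))))))
              (≤-trans (≤-reflexive (move n (sz ℕ₂ {ι} acc) _)) (+-monoˡ-≤ _ (s≤s (m≤n+m _ (sz 𝕏 y))))) })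
          where
          move : ∀ n a g → suc (n + (a + (5 + g))) ≡ suc a + (n + 5 + g)
          move = solve-∀
        end : ∀ ι y acc ys → w ι (proj₁ (foldl (follow ι) (y , acc) ys)) + proj₂ (foldl (follow ι) (y , acc) ys)
            ≡ acc + A.pathEnd ι y ys
        end ι y acc []       = +-comm (w ι y) acc
        end ι y acc (z ∷ zs) = trans (end ι z (acc + d ι y z) zs) (+-assoc acc (d ι y z) _)
        eq : ∀ ι l → caseList l 0 (λ x xs → let s = foldl (follow ι) (x , w ι x) xs in w ι (proj₁ s) + proj₂ s) ≡ A.tourLength ι l
        eq ι []       = refl
        eq ι (x ∷ xs) = end ι x (w ι x) xs

      loadP : ∀ {l} → Poly Γ (𝕃 𝕏) l → Poly Γ ℕ₂ (λ ι γ → A.load ι (l ι γ))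
      loadP L = sumP (mapP L (demP ∘P v0))

      totalLengthP : ∀ {l} → Poly Γ (𝕃 (𝕃 𝕏)) l → Poly Γ ℕ₂ (λ ι γ → A.totalLength ι (l ι γ))
      totalLengthP L = sumP (mapP L (tourLengthP ∘P v0))

      betterP : ∀ {k l} → Poly Γ (𝕃 (𝕃 𝕏)) k → Poly Γ (𝕃 (𝕃 𝕏)) l → Poly Γ (𝕃 (𝕃 𝕏))
          (λ ι γ → A.better ι (k ι γ) (l ι γ))
      betterP L M = ifP (≤P (totalLengthP L) (totalLengthP M)) L M

      compatibleP : ∀ {x y} → Poly Γ 𝕏 x → Poly Γ 𝕏 y → Poly Γ 𝔹 (λ ι γ → A.compatible ι (x ι γ) (y ι γ))
      compatibleP P Q = andP (≤P (+P (demP ∘P P) (demP ∘P Q)) (capP ∘P P))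
        (≤P (*P (numP 4) (dP ∘P ⟨ P , Q ⟩P)) (+P (wP ∘P P) (wP ∘P Q)))

      pickP : ∀ {x l} → Poly Γ 𝕏 x → Poly Γ (𝕃 𝕏) l → Poly Γ (𝕃 𝕏 ⊠ 𝕃 𝕏) (λ ι γ → A.pick ι (x ι γ) (l ι γ))
      pickP {Γ} {x} P L = foldP⁺ {st = λ ι γ → A.pick-step ι (x ι (proj₁ (proj₁ γ))) (proj₂ γ)
          (proj₂ (proj₁ γ))} L ⟨ nilP , nilP ⟩P
        (caseP (fstP ∘P v0)
          (ifP (compatibleP (P ∘P fstP ∘P fstP) v1) ⟨ consP v1 nilP , sndP ∘P v0 ⟩P
              ⟨ nilP , consP v1 (sndP ∘P v0) ⟩P)
          ⟨ fstP ∘P v2 , consP v3 (sndP ∘P v2) ⟩P)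
        (K 1 ⊕ X)
        (λ { ι γ y s → ≤-trans (≤-reflexive (pick-size ι (x ι γ) y s))
            (+-monoʳ-≤ (sz (𝕃 𝕏 ⊠ 𝕃 𝕏) s) (s≤s (m≤n+m (sz 𝕏 y) (sz Γ γ)))) })
        where
        pick-size : ∀ ι x y s → sz (𝕃 𝕏 ⊠ 𝕃 𝕏) (A.pick-step ι x s y) ≡ sz (𝕃 𝕏 ⊠ 𝕃 𝕏) s + suc (sz 𝕏 y)
        pick-size ι x y (z ∷ f , kept) = move (sz (𝕃 𝕏) (z ∷ f)) (sz 𝕏 y) (sz (𝕃 𝕏) kept)
          where
          move : ∀ f y k → suc (f + suc (y + k)) ≡ suc (f + k) + suc y
          move = solve-∀
        pick-size ι x y ([] , kept) with A.compatible ι x y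
        ... | true  = move (sz 𝕏 y) (sz (𝕃 𝕏) kept)
          where
          move : ∀ y k → suc (suc (y + 1) + k) ≡ suc (1 + k) + suc y
          move = solve-∀
        ... | false = move (sz 𝕏 y) (sz (𝕃 𝕏) kept)
          where
          move : ∀ y k → suc (1 + suc (y + k)) ≡ suc (1 + k) + suc y
          move = solve-∀

      -- `pick` merely redistributes its list. Partner and kept points together are thus no larger
      -- than the unmatched list before, which bounds the growth of the matching.
      pick-total : ∀ ι x l s → let r = foldl (A.pick-step ι x) s l in
        sz (𝕃 𝕏) (proj₁ r) + sz (𝕃 𝕏) (proj₂ r) + 1 ≡ sz (𝕃 𝕏) (proj₁ s) + sz (𝕃 𝕏) (proj₂ s) + sz (𝕃 𝕏) l
      pick-total ι x []      s = refl
      pick-total ι x (y ∷ l) s = trans (pick-total ι x l (A.pick-step ι x s y)) (step s)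
        where
        move₁ : ∀ f y k l → f + suc (y + k) + l ≡ f + k + suc (y + l)
        move₁ = solve-∀
        step : ∀ s → sz (𝕃 𝕏) (proj₁ (A.pick-step ι x s y)) + sz (𝕃 𝕏) (proj₂ (A.pick-step ι x s y)) + sz (𝕃 𝕏)
            l ≡
                     sz (𝕃 𝕏) (proj₁ s) + sz (𝕃 𝕏) (proj₂ s) + sz (𝕃 𝕏) (y ∷ l)
        step (z ∷ f , kept) = move₁ (sz (𝕃 𝕏) (z ∷ f)) (sz 𝕏 y) (sz (𝕃 𝕏) kept) (sz (𝕃 𝕏) l)
        step ([] , kept) with A.compatible ι x y
        ... | true  = move (sz 𝕏 y) (sz (𝕃 𝕏) kept) (sz (𝕃 𝕏) l)
          where
          move : ∀ y k l → suc (y + 1) + k + l ≡ 1 + k + suc (y + l)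
          move = solve-∀
        ... | false = move₁ 1 (sz 𝕏 y) (sz (𝕃 𝕏) kept) (sz (𝕃 𝕏) l)

      matchP : ∀ {l} → Poly Γ (𝕃 𝕏) l → Poly Γ (𝕃 𝕏 ⊠ 𝕃 (𝕃 𝕏)) (λ ι γ → A.match ι (l ι γ))
      matchP {Γ} L = foldP⁺ {st = λ ι γ → A.match-step ι (proj₂ γ) (proj₂ (proj₁ γ))} L ⟨ nilP , nilP ⟩P
        (caseP (fstP ∘P picked) ⟨ consP v1 (fstP ∘P v0) , sndP ∘P v0 ⟩P
          ⟨ sndP ∘P picked ∘P fstP ∘P fstP , consP (consP v3 (consP v1 nilP)) (sndP ∘P v2) ⟩P)
        (X ⊕ K 3)
        (λ { ι γ x s → ≤-trans (match-size ι x s) (+-monoʳ-≤ (sz (𝕃 𝕏 ⊠ 𝕃 (𝕃 𝕏)) s)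
            (+-monoˡ-≤ 3 (m≤n+m (sz 𝕏 x) (sz Γ γ)))) })
        where
        picked : Poly (Γ ⊠ 𝕏 ⊠ (𝕃 𝕏 ⊠ 𝕃 (𝕃 𝕏))) (𝕃 𝕏 ⊠ 𝕃 𝕏) (λ ι γ → A.pick ι (proj₂ (proj₁ γ))
            (proj₁ (proj₂ γ)))
        picked = pickP v1 (fstP ∘P v0)
        match-size : ∀ ι x s → sz (𝕃 𝕏 ⊠ 𝕃 (𝕃 𝕏)) (A.match-step ι s x) ≤ sz (𝕃 𝕏 ⊠ 𝕃 (𝕃 𝕏)) s + (sz 𝕏 x + 3)
        match-size ι x (um , ps) with A.pick ι x um | pick-total ι x um ([] , [])
        ... | [] , kept | _ = ≤-trans (m≤m+n _ 2) (≤-reflexive (move (sz 𝕏 x) (sz (𝕃 𝕏) um) (sz (𝕃 (𝕃 𝕏)) ps)))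
          where
          move : ∀ x u p → suc (suc (x + u) + p) + 2 ≡ suc (u + p) + (x + 3)
          move = solve-∀
        ... | y ∷ f , kept | e = +-cancelʳ-≤ 2 _ _ (≤-trans
          (≤-reflexive (move (sz (𝕃 𝕏) kept) (sz 𝕏 x) (sz 𝕏 y) (sz (𝕃 (𝕃 𝕏)) ps)))
          (≤-trans (+-monoˡ-≤ (sz 𝕏 x + sz (𝕃 (𝕃 𝕏)) ps + 4)
             (≤-trans (+-monoˡ-≤ 1 (+-monoˡ-≤ (sz (𝕃 𝕏) kept) (s≤s (+-monoʳ-≤ (sz 𝕏 y) (1≤sz (𝕃 𝕏) f)))))
                 (≤-reflexive e)))
            (≤-reflexive (move′ (sz (𝕃 𝕏) um) (sz 𝕏 x) (sz (𝕃 (𝕃 𝕏)) ps)))))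
          where
          move : ∀ k x y p → suc (k + suc (suc (x + suc (y + 1)) + p)) + 2 ≡ suc (y + 1) + k + 1 + (x + p + 4)
          move = solve-∀
          move′ : ∀ u x p → 1 + 1 + u + (x + p + 4) ≡ suc (u + p) + (x + 3) + 2
          move′ = solve-∀

      -- The best partition is replaced rather than extended, so its size is bounded as a whole:
      -- each candidate consists of the segment so far and one table entry.
      scanP : ∀ {seg best tb} → Poly Γ (𝕃 𝕏) seg → Poly Γ (𝕃 (𝕃 𝕏)) best → Poly Γ 𝕋 tb →
              Poly Γ (𝕃 (𝕃 𝕏)) (λ ι γ → A.scan ι (seg ι γ) (best ι γ) (tb ι γ))
      scanP {Γ} {seg} {best} {tb} P Q R = sndP ∘P foldP {S = 𝕃 𝕏 ⊠ 𝕃 (𝕃 𝕏)}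
          {st = λ ι γ → A.scan-step ι (proj₂ γ) (proj₂ (proj₁ γ))} R ⟨ P , Q ⟩P
        ⟨ seg′ , ifP (≤P (loadP seg′) (capP ∘P fstP ∘P v1))
                     (betterP (sndP ∘P v0) (consP seg′ (sndP ∘P v1))) (sndP ∘P v0) ⟩P
        (K 2 ⊗ growth P ⊕ growth Q ⊕ K 2 ⊗ growth R ⊕ K 2)
        (λ ι γ l₁ l₂ eq → ≤-trans (scan-size ι l₁ (seg ι γ) (best ι γ)) (size-sum
          (out-size P ι γ) (out-size Q ι γ) (≤-trans (sz-prefix (𝕏 ⊠ 𝕃 (𝕃 𝕏)) l₁ l₂)
              (≤-trans (≤-reflexive (cong (sz 𝕋) (sym eq))) (out-size R ι γ)))))
        where
        seg′ : Poly (Γ ⊠ (𝕏 ⊠ 𝕃 (𝕃 𝕏)) ⊠ (𝕃 𝕏 ⊠ 𝕃 (𝕃 𝕏))) (𝕃 𝕏) (λ ι γ → proj₁ (proj₂ γ) ++ [ proj₁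
            (proj₂ (proj₁ γ)) ])
        seg′ = ++P (fstP ∘P v0) (consP (fstP ∘P v1) nilP)
        size-sum : ∀ {a b c a′ b′ c′} → a ≤ a′ → b ≤ b′ → c ≤ c′ → a + c + (b + (a + c)) + 2 ≤ 2 * a′ + b′ + 2 *
            c′ + 2
        size-sum {a} {b} {c} a≤ b≤ c≤ = ≤-trans (≤-reflexive (move a b c))
            (+-monoˡ-≤ 2 (+-mono-≤ (+-mono-≤ (*-monoʳ-≤ 2 a≤) b≤) (*-monoʳ-≤ 2 c≤)))
          where
          move : ∀ a b c → a + c + (b + (a + c)) + 2 ≡ 2 * a + b + 2 * c + 2
          move = solve-∀
        snoc-size : ∀ {ι} (s : List (Car 𝕏 ι)) z → sz (𝕃 𝕏) (s ++ [ z ]) ≡ sz (𝕃 𝕏) s + suc (sz 𝕏 z)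
        snoc-size s z = +-cancelʳ-≡ 1 _ _ (trans (sz-++ 𝕏 s [ z ]) (move (sz (𝕃 𝕏) s) (sz 𝕏 z)))
          where
          move : ∀ s z → s + suc (z + 1) ≡ s + suc z + 1
          move = solve-∀
        if-size : ∀ {ι} (b : Bool) (L M : List (List (Car 𝕏 ι))) {n} → sz (𝕃 (𝕃 𝕏)) L ≤ n → sz (𝕃 (𝕃 𝕏)) M ≤ n →
                  sz (𝕃 (𝕃 𝕏)) (if b then L else M) ≤ n
        if-size true  L M l m = l
        if-size false L M l m = m
        best-size : ∀ ι tb seg best n → sz (𝕃 (𝕃 𝕏)) best ≤ n → sz (𝕃 𝕏) seg + sz 𝕋 tb ≤ n →
          sz (𝕃 (𝕃 𝕏)) (proj₂ (foldl (A.scan-step ι) (seg , best) tb)) ≤ n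
        best-size ι []             seg best n b≤ s≤ = b≤
        best-size ι ((z , E) ∷ tb) seg best n b≤ s≤ = best-size ι tb (seg ++ [ z ]) _ n
          (if-size (A.load ι (seg ++ [ z ]) ≤ᵇ cap ι) _ _
            (if-size (A.totalLength ι best ≤ᵇ A.totalLength ι ((seg ++ [ z ]) ∷ E)) _ _ b≤
              (≤-trans (≤-reflexive (cong (λ k → suc (k + sz (𝕃 (𝕃 𝕏)) E)) (snoc-size seg z)))
                (≤-trans (m≤m+n _ (sz 𝕋 tb)) (≤-trans (≤-reflexive
                    (move (sz (𝕃 𝕏) seg) (sz 𝕏 z) (sz (𝕃 (𝕃 𝕏)) E) (sz 𝕋 tb))) s≤)))) b≤)
          (≤-trans (≤-reflexive (cong (_+ sz 𝕋 tb) (snoc-size seg z)))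
            (≤-trans (m≤n+m _ (suc (sz (𝕃 (𝕃 𝕏)) E))) (≤-trans
                (≤-reflexive (move′ (sz (𝕃 𝕏) seg) (sz 𝕏 z) (sz (𝕃 (𝕃 𝕏)) E) (sz 𝕋 tb))) s≤)))
          where
          move : ∀ s z e t → suc (s + suc z + e) + t ≡ s + suc (suc (z + e) + t)
          move = solve-∀
          move′ : ∀ s z e t → suc e + (s + suc z + t) ≡ s + suc (suc (z + e) + t)
          move′ = solve-∀
        seg-size : ∀ ι tb seg best → sz (𝕃 𝕏) (proj₁ (foldl (A.scan-step ι) (seg , best) tb)) ≤ sz (𝕃 𝕏) seg +
            sz 𝕋 tb
        seg-size ι []             seg best = m≤m+n _ 1
        seg-size ι ((z , E) ∷ tb) seg best = ≤-trans (seg-size ι tb (seg ++ [ z ]) _)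
          (≤-trans (≤-reflexive (cong (_+ sz 𝕋 tb) (snoc-size seg z))) (≤-trans (m≤n+m _ (suc (sz (𝕃 (𝕃 𝕏)) E)))
              (≤-reflexive (move (sz (𝕃 𝕏) seg) (sz 𝕏 z) (sz (𝕃 (𝕃 𝕏)) E) (sz 𝕋 tb)))))
          where
          move : ∀ s z e t → suc e + (s + suc z + t) ≡ s + suc (suc (z + e) + t)
          move = solve-∀
        scan-size : ∀ ι tb seg best → sz (𝕃 𝕏 ⊠ 𝕃 (𝕃 𝕏)) (foldl (A.scan-step ι) (seg , best) tb) ≤
          sz (𝕃 𝕏) seg + sz 𝕋 tb + (sz (𝕃 (𝕃 𝕏)) best + (sz (𝕃 𝕏) seg + sz 𝕋 tb)) + 2
        scan-size ι tb seg best = ≤-trans (s≤s (+-mono-≤ (seg-size ι tb seg best)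
            (best-size ι tb seg best _ (m≤m+n _ _) (m≤n+m _ (sz (𝕃 (𝕃 𝕏)) best)))))
          (≤-trans (n≤1+n _) (≤-reflexive (+-comm 2 _)))

      -- A tour adds one node and one leaf to the flat list, and its first point pays for them.
      concat-size : ∀ {ι} (L : List (List (Car 𝕏 ι))) → All (_≢ []) L → sz (𝕃 (𝕃 𝕏)) L ≤ 2 * sz (𝕃 𝕏) (concat L)
      concat-size []             _        = s≤s z≤n
      concat-size ([] ∷ L)       (n ∷ ns) = contradiction refl n
      concat-size ((x ∷ s) ∷ L)  (_ ∷ ns) = +-cancelʳ-≤ 2 _ _ (≤-trans (≤-reflexive (+-comm _ 2))
        (≤-trans (s≤s (s≤s (s≤s (+-monoʳ-≤ (sz (𝕃 𝕏) (x ∷ s)) (concat-size L ns)))))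
        (≤-trans (+-monoˡ-≤ (sz (𝕃 𝕏) (x ∷ s) + 2 * sz (𝕃 𝕏) (concat L))
            (s≤s (+-mono-≤ (1≤sz 𝕏 x) (1≤sz (𝕃 𝕏) s))))
        (≤-trans (≤-reflexive (move (sz (𝕃 𝕏) (x ∷ s)) (sz (𝕃 𝕏) (concat L))))
            (≤-trans (≤-reflexive (cong (2 *_) (sym (sz-++ 𝕏 (x ∷ s) (concat L)))))
            (≤-reflexive (move′ (sz (𝕃 𝕏) (x ∷ s ++ concat L)))))))))
        where
        move : ∀ s c → s + (s + 2 * c) ≡ 2 * (s + c)
        move = solve-∀
        move′ : ∀ c → 2 * (c + 1) ≡ 2 * c + 2
        move′ = solve-∀

      partitionsP : ∀ {l} → Poly Γ (𝕃 𝕏) l → Poly Γ (𝕃 (𝕃 𝕏)) (λ ι γ → proj₁ (A.partitions ι (l ι γ)))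
      partitionsP {Γ} {l} L = fstP ∘P foldrP {S = 𝕃 (𝕃 𝕏) ⊠ 𝕋} {st = λ ι γ → A.partition-step ι
          (proj₂ (proj₁ γ)) (proj₂ γ)} L ⟨ nilP , nilP ⟩P
        ⟨ scanP (consP v1 nilP) (consP (consP v1 nilP) (fstP ∘P v0)) (sndP ∘P v0) , consP ⟨ v1 , fstP ∘P v0 ⟩P
            (sndP ∘P v0) ⟩P
        (K 1 ⊕ (K 2 ⊗ growth L ⊕ (growth L ⊗ (K 2 ⊕ K 3 ⊗ growth L) ⊕ K 1)))
        (λ ι γ l₁ l₂ eq → let l₂≤ = ≤-trans (sz-suffix 𝕏 l₁ l₂) (≤-trans (≤-reflexive (cong (sz (𝕃 𝕏)) (sym eq))) (out-size L ι γ)) in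
          s≤s (+-mono-≤ (≤-trans (first-size ι l₂) (*-monoʳ-≤ 2 l₂≤))
            (≤-trans (table-size ι l₂ _ l₂≤) (+-monoˡ-≤ 1 (*-monoˡ-≤ (2 + 3 * ⟦ growth L ⟧ (sz Γ γ))
                (≤-trans (length≤sz 𝕏 l₂) l₂≤))))))
        where
        first-size : ∀ ι l → sz (𝕃 (𝕃 𝕏)) (proj₁ (A.partitions ι l)) ≤ 2 * sz (𝕃 𝕏) l
        first-size ι l with partitions-shape ι l
        ... | c , ne = ≤-trans (concat-size _ ne) (≤-reflexive (cong (λ k → 2 * sz (𝕃 𝕏) k) c))
        -- One partition is stored per point of the sequence, so the table is of quadratic size.
        table-size : ∀ ι l n → sz (𝕃 𝕏) l ≤ n → sz 𝕋 (proj₂ (A.partitions ι l)) ≤ length l * (2 + 3 * n) + 1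
        table-size ι []      n l≤ = ≤-refl
        table-size ι (x ∷ l) n l≤ = ≤-trans (s≤s (+-mono-≤
            (s≤s (+-mono-≤ (≤-trans (≤-trans (m≤m+n _ _) (n≤1+n _)) l≤)
            (≤-trans (first-size ι l) (*-monoʳ-≤ 2 tail≤)))) (table-size ι l n tail≤)))
          (≤-reflexive (move n (length l * (2 + 3 * n))))
          where
          tail≤ : sz (𝕃 𝕏) l ≤ n
          tail≤ = ≤-trans (≤-trans (m≤n+m _ (sz 𝕏 x)) (n≤1+n _)) l≤
          move : ∀ n t → suc (suc (n + 2 * n) + (t + 1)) ≡ 2 + 3 * n + t + 1
          move = solve-∀

      solveAtP : ∀ p → Poly (𝕃 𝕏) (𝕃 (𝕃 𝕏)) (λ ι → A.solveAt ι p)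
      solveAtP p = ++P (mapP (fstP ∘P m) (consP v0 nilP)) (++P (sndP ∘P m) (partitionsP (filterP idP smallP)))
        where
        smallP : ∀ {Γ} → Poly (Γ ⊠ 𝕏) 𝔹 (λ ι γ → A.small ι p (proj₂ γ))
        smallP = ≤P (*P (numP (suc (p + p))) (demP ∘P v0)) (*P (numP p) (capP ∘P v0))
        m : Poly (𝕃 𝕏) (𝕃 𝕏 ⊠ 𝕃 (𝕃 𝕏)) (λ ι xs → A.match ι (filterᵇ (A.big ι p) xs))
        m = matchP (filterP idP (notP smallP))

      solveP : Poly (𝕃 𝕏) (𝕃 (𝕃 𝕏)) (λ ι → A.solve ι)
      solveP = betterP (solveAtP 2) (solveAtP 4)

-- Words, numbers and tables in polynomial time.

module PolyWords where

  open StackMachine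
  open PolyTime
  open PolyLists
  open PolyArithmetic
  open import Data.List.Relation.Unary.All as All using (All; []; _∷_)
  import Data.List.Relation.Unary.All.Properties as Allₚ
  open import Data.Nat using (ℕ; zero; suc; _+_; _*_; _≤_; _<_; z≤n; s≤s; _≤ᵇ_; _≡ᵇ_)
  import Data.Nat.Binary as ℕᵇ
  open import Data.Nat.Properties

  encList-map : ∀ {A B : Set} (e : B → Tree) (f : A → B) l → encList e (map f l) ≡ encList (e ∘ f) l
  encList-map e f []      = refl
  encList-map e f (x ∷ l) = cong (node (e (f x))) (encList-map e f l)

  symbolBits : Symbol → Bool × Bool
  symbolBits bit0      = false , false
  symbolBits bit1      = false , true
  symbolBits comma     = true , false
  symbolBits semicolon = true , true

  symbolTree : Symbol → Tree
  symbolTree a = node (bitTree (proj₁ (symbolBits a))) (bitTree (proj₂ (symbolBits a)))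

  bitSymbol : Bool → Symbol
  bitSymbol b = if b then bit1 else bit0

  word : List ℕ → Word
  word = concatMap encodeℕ

  bits-digits : ∀ x → bits x ≡ map bitSymbol (digitsᵇ x)
  bits-digits ℕᵇ.zero     = refl
  bits-digits ℕᵇ.2[1+ x ] = cong (bit1 ∷_) (bits-digits x)
  bits-digits ℕᵇ.1+[2 x ] = cong (bit0 ∷_) (bits-digits x)

  private
    Lexer : Set
    Lexer = List Bool × List (List Bool)

    lex-step : Lexer → Symbol → Lexer
    lex-step s a = if proj₁ (symbolBits a) then ([] , proj₁ s ∷ proj₂ s) else (proj₂ (symbolBits a) ∷ proj₁ s ,
        proj₂ s)

    numerals : Word → List (List Bool)
    numerals u = reverse (map reverse (proj₂ (foldl lex-step ([] , []) u)))

    lex-bits : ∀ bs s out → foldl lex-step (s , out) (map bitSymbol bs) ≡ (bs ʳ++ s , out)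
    lex-bits []           s out = refl
    lex-bits (true ∷ bs)  s out = lex-bits bs (true ∷ s) out
    lex-bits (false ∷ bs) s out = lex-bits bs (false ∷ s) out

    lex-word : ∀ ns out → foldl lex-step ([] , out) (word ns) ≡ ([] , map (reverse ∘ digits) ns ʳ++ out)
    lex-word []       out = refl
    lex-word (n ∷ ns) out = trans (foldl-++ lex-step ([] , out) (encodeℕ n) (word ns))
      (trans (cong (λ s → foldl lex-step s (word ns))
         (trans (foldl-++ lex-step ([] , out) (bits (ℕᵇ.fromℕ n)) [ comma ])
           (cong (λ s → lex-step s comma) (trans (cong (foldl lex-step ([] , out)) (bits-digits (ℕᵇ.fromℕ n)))
               (lex-bits (digits n) [] out)))))
        (lex-word ns (reverse (digits n) ∷ out)))

    numerals-word : ∀ ns → numerals (word ns) ≡ map digits ns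
    numerals-word ns = trans (cong (λ s → reverse (map reverse (proj₂ s))) (lex-word ns []))
      (trans (cong (λ l → reverse (map reverse l)) (trans (ʳ++-defn (map (reverse ∘ digits) ns))
          (++-identityʳ _)))
      (trans (cong reverse (reverse-map reverse (map (reverse ∘ digits) ns)))
      (trans (reverse-involutive _) (trans (sym (map-∘ ns)) (map-cong (λ n → reverse-involutive (digits n))
          ns)))))

    map-val-digits : ∀ ns → map val (map digits ns) ≡ ns
    map-val-digits ns = trans (sym (map-∘ ns)) (trans (map-cong val-digits ns) (map-id ns))

  flat : List (ℕ × ℕ) → List ℕ
  flat = concatMap (λ p → proj₁ p ∷ proj₂ p ∷ [])

  private
    pair-step : List ℕ × List (ℕ × ℕ) → ℕ → List ℕ × List (ℕ × ℕ)
    pair-step s x = caseList (proj₁ s) ([ x ] , proj₂ s) (λ p _ → [] , (p , x) ∷ proj₂ s)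

    pair-flat : ∀ ps out → foldl pair-step ([] , out) (flat ps) ≡ ([] , ps ʳ++ out)
    pair-flat []       out = refl
    pair-flat (p ∷ ps) out = pair-flat ps (p ∷ out)

  -- In general a binary number cannot be written in unary in polynomial time. Here the count climbs
  -- along a list that is already present and long enough.
  climb-step : ℕ → ℕ × List ⊤ → ℕ × List ⊤
  climb-step k s = if suc (proj₁ s) ≤ᵇ k then (suc (proj₁ s) , tt ∷ proj₂ s) else s

  climb : {A : Set} → ℕ → List A → ℕ × List ⊤
  climb k l = foldl (λ s _ → climb-step k s) (0 , []) l

  climb-reaches : {A : Set} → ∀ k (l : List A) → k ≤ length l → climb k l ≡ (k , replicate k tt)
  climb-reaches {A} k l k≤ = go 0 l z≤n k≤
    where
    go : ∀ c (l : List A) → c ≤ k → k ≤ c + length l → foldl (λ s _ → climb-step k s) (c , replicate c tt) l ≡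
        (k , replicate k tt)
    go c []      c≤ k≤ = cong (λ c → c , replicate c tt)
        (≤-antisym c≤ (≤-trans k≤ (≤-reflexive (+-identityʳ c))))
    go c (x ∷ l) c≤ k≤ with suc c ≤ᵇ k in e
    ... | true  = go (suc c) l (≤ᵇ⇒≤ (suc c) k (subst T (sym e) tt))
        (≤-trans k≤ (≤-reflexive (+-suc c (length l))))
    ... | false = go c l c≤ (≤-trans (≮⇒≥ (λ lt → subst T e (≤⇒≤ᵇ {suc c} {k} lt))) (m≤m+n c (length l)))

  chop-step : {A : Set} → List A × List A → List A × List A
  chop-step s = caseList (proj₂ s) s (λ x xs → x ∷ proj₁ s , xs)

  -- The first |u| elements in reverse order, and the others.
  chop : {A : Set} → List ⊤ → List A → List A × List A
  chop u l = foldl (λ s _ → chop-step s) ([] , l) u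

  chop-++ : ∀ {A : Set} (k l : List A) → chop (replicate (length k) tt) (k ++ l) ≡ (reverse k , l)
  chop-++ {A} k l = trans (go k []) (cong (_, l) (trans (ʳ++-defn k) (++-identityʳ _)))
    where
    go : ∀ k r → foldl (λ s _ → chop-step s) (r , k ++ l) (replicate (length k) tt) ≡ (k ʳ++ r , l)
    go []      r = refl
    go (x ∷ k) r = go k (x ∷ r)

  module _ {A : Set} where

    nth-step : ℕ → ℕ × A → A → ℕ × A
    nth-step k s x = suc (proj₁ s) , (if proj₁ s ≡ᵇ k then x else proj₂ s)

    nth : A → ℕ → List A → A
    nth z k l = proj₂ (foldl (nth-step k) (0 , z) l)

    nth-tabulate : ∀ z {n} (f : Fin n → A) i → nth z (toℕ i) (tabulate f) ≡ f i
    nth-tabulate z f i = go 0 z f i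
      where
      past : ∀ k j r l → k < j → proj₂ (foldl (nth-step k) (j , r) l) ≡ r
      past k j r []      lt = refl
      past k j r (x ∷ l) lt with j ≡ᵇ k in e
      ... | true  = contradiction (subst (k <_) (≡ᵇ⇒≡ j k (subst T (sym e) tt)) lt) (<-irrefl refl)
      ... | false = past k (suc j) r l (m<n⇒m<1+n lt)
      go : ∀ j r {n} (f : Fin n → A) i → proj₂ (foldl (nth-step (j + toℕ i)) (j , r) (tabulate f)) ≡ f i
      go j r {suc n} f zero rewrite +-identityʳ j with j ≡ᵇ j in e
      ... | true  = past j (suc j) (f zero) (tabulate (f ∘ suc)) ≤-refl
      ... | false = contradiction (subst T e (≡⇒≡ᵇ j j refl)) (λ ())
      go j r {suc n} f (suc i) with j ≡ᵇ (j + suc (toℕ i))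
      ... | true  rewrite +-suc j (toℕ i) = go (suc j) (f zero) (f ∘ suc) i
      ... | false rewrite +-suc j (toℕ i) = go (suc j) r (f ∘ suc) i

    nth-allFin : ∀ z {n} (f : Fin n → A) i → nth z (toℕ i) (map f (allFin n)) ≡ f i
    nth-allFin z f i = trans (cong (nth z (toℕ i)) (map-tabulate (λ j → j) f)) (nth-tabulate z f i)

  -- Brings fractions to a common denominator. The product of the denominators replaces their least
  -- common multiple, and its length is still linear in the input.
  scale-step : List ℕ × ℕ → ℕ × ℕ → List ℕ × ℕ
  scale-step s p = map (_* proj₂ p) (proj₁ s) ++ [ proj₁ p * proj₂ s ] , proj₂ s * proj₂ p

  scale : List (ℕ × ℕ) → List ℕ × ℕ
  scale l = foldl scale-step ([] , 1) l

  module _ {Ix : Set} where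

    𝕊 𝕎 : Code Ix
    𝕊 = record { Car = λ _ → Symbol ; enc = symbolTree }
    𝕎 = 𝕃 𝕊

    private variable
      Γ A B C : Code Ix

    retype : ∀ {f g} → Poly Γ A f → (∀ ι γ → enc A (f ι γ) ≡ enc B (g ι γ)) → Poly Γ B g
    retype {Γ} F e = record { prog = prog F ; bound = bound F ; run = λ ι γ u v →
      subst (λ t → Run (prog F) (St (enc Γ γ ◂ u) v []) (St (t ◂ u) v []) (⟦ bound F ⟧ (sz Γ γ))) (e ι γ)
          (run F ι γ u v) }

    symbolBitsP : ∀ {a} → Poly Γ 𝕊 a → Poly Γ (𝔹 ⊠ 𝔹) (λ ι γ → symbolBits (a ι γ))
    symbolBitsP P = retype P (λ _ _ → refl)

    symbolP : ∀ a → Poly Γ 𝕊 (λ _ _ → a)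
    symbolP a = constP (λ _ → a) (symbolTree a) (λ _ → refl)

    abstract
      numbersP : ∀ {ns} → Poly Γ 𝕎 (λ ι γ → word (ns ι γ)) → Poly Γ (𝕃 ℕ₂) ns
      numbersP {Γ} {ns} P = ext (λ ι γ → trans (cong (map val) (numerals-word (ns ι γ)))
          (map-val-digits (ns ι γ)))
        (mapP (reverseP (mapP (sndP ∘P lexed) (reverseP v0))) (valP v0))
        where
        lexed : Poly Γ (𝕃 𝔹 ⊠ 𝕃 (𝕃 𝔹)) (λ ι γ → foldl lex-step ([] , []) (word (ns ι γ)))
        lexed = foldP⁺ {st = λ ι γ → lex-step (proj₂ γ) (proj₂ (proj₁ γ))} P ⟨ nilP , nilP ⟩P
          (ifP (fstP ∘P symbolBitsP v1) ⟨ nilP , consP (fstP ∘P v0) (sndP ∘P v0) ⟩P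
               ⟨ consP (sndP ∘P symbolBitsP v1) (fstP ∘P v0) , sndP ∘P v0 ⟩P)
          (K 6) (λ ι γ a s → grows {ι} a s)
          where
          grows : ∀ {ι : Ix} a (s : List Bool × List (List Bool)) → sz (𝕃 𝔹 ⊠ 𝕃 (𝕃 𝔹)) {ι} (lex-step s a) ≤ sz
              (𝕃 𝔹 ⊠ 𝕃 (𝕃 𝔹)) {ι} s + 6
          grows {ι} a (cur , out) with symbolBits a
          ... | true , _  = ≤-trans (m≤m+n _ 4) (≤-reflexive (move (sz (𝕃 𝔹) {ι} cur) (sz (𝕃 (𝕃 𝔹)) {ι} out)))
            where
            move : ∀ c o → suc (1 + suc (c + o)) + 4 ≡ suc (c + o) + 6
            move = solve-∀
          ... | false , true  = ≤-reflexive (+-comm 6 _)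
          ... | false , false = ≤-reflexive (+-comm 6 _)

      wordP : ∀ {ns} → Poly Γ (𝕃 ℕ₂) ns → Poly Γ 𝕎 (λ ι γ → word (ns ι γ))
      wordP P = concatMapP P (ext (λ ι γ → cong (_++ [ comma ]) (sym (bits-digits (ℕᵇ.fromℕ (proj₂ γ)))))
        (++P (mapP (digitsP v0) (ifP v0 (symbolP bit1) (symbolP bit0))) (consP (symbolP comma) nilP)))

      flatP : ∀ {ps} → Poly Γ (𝕃 (ℕ₂ ⊠ ℕ₂)) ps → Poly Γ (𝕃 ℕ₂) (λ ι γ → flat (ps ι γ))
      flatP P = concatMapP P (consP (fstP ∘P v0) (consP (sndP ∘P v0) nilP))

      unflatP : ∀ {ps} → Poly Γ (𝕃 ℕ₂) (λ ι γ → flat (ps ι γ)) → Poly Γ (𝕃 (ℕ₂ ⊠ ℕ₂)) ps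
      unflatP {Γ} {ps} P = ext (λ ι γ → trans (cong (reverse ∘ proj₂) (pair-flat (ps ι γ) []))
          (trans (cong reverse (trans (ʳ++-defn (ps ι γ)) (++-identityʳ _))) (reverse-involutive (ps ι γ))))
        (reverseP (sndP ∘P foldP⁺ {S = 𝕃 ℕ₂ ⊠ 𝕃 (ℕ₂ ⊠ ℕ₂)} {st = λ ι γ → pair-step (proj₂ γ) (proj₂ (proj₁ γ))}
            P ⟨ nilP , nilP ⟩P
          (caseP (fstP ∘P v0) ⟨ consP v1 nilP , sndP ∘P v0 ⟩P ⟨ nilP , consP ⟨ v1 , v3 ⟩P (sndP ∘P v2) ⟩P)
          (X ⊕ K 2) (λ ι γ x s → ≤-trans (grows {ι} x s) (+-monoʳ-≤ (sz (𝕃 ℕ₂ ⊠ 𝕃 (ℕ₂ ⊠ ℕ₂)) {ι} s)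
              (+-monoˡ-≤ 2 (m≤n+m (sz ℕ₂ {ι} x) (sz Γ γ)))))))
        where
        grows : ∀ {ι : Ix} x (s : List ℕ × List (ℕ × ℕ)) → sz (𝕃 ℕ₂ ⊠ 𝕃 (ℕ₂ ⊠ ℕ₂)) {ι} (pair-step s x) ≤ sz
            (𝕃 ℕ₂ ⊠ 𝕃 (ℕ₂ ⊠ ℕ₂)) {ι} s + (sz ℕ₂ {ι} x + 2)
        grows {ι} x ([] , out) = ≤-trans (m≤m+n _ 1) (≤-reflexive
            (move (sz ℕ₂ {ι} x) (sz (𝕃 (ℕ₂ ⊠ ℕ₂)) {ι} out)))
          where
          move : ∀ x o → suc (suc (x + 1) + o) + 1 ≡ suc (1 + o) + (x + 2)
          move = solve-∀
        grows {ι} x (p ∷ l , out) = ≤-trans (m≤m+n _ (sz (𝕃 ℕ₂) {ι} l))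
            (≤-reflexive (move (sz ℕ₂ {ι} p) (sz (𝕃 ℕ₂) {ι} l) (sz ℕ₂ {ι} x) (sz (𝕃 (ℕ₂ ⊠ ℕ₂)) {ι} out)))
          where
          move : ∀ p l x o → suc (1 + suc (suc (p + x) + o)) + l ≡ suc (suc (p + l) + o) + (x + 2)
          move = solve-∀

      climbP : ∀ {k l} → Poly Γ ℕ₂ k → Poly Γ (𝕃 A) l → Poly Γ (ℕ₂ ⊠ 𝕃 𝟙) (λ ι γ → climb (k ι γ) (l ι γ))
      climbP {Γ} {A} {k} {l} N L = foldP⁺ {st = λ ι γ → climb-step (k ι (proj₁ (proj₁ γ))) (proj₂ γ)} L
          ⟨ numP 0 , nilP ⟩P
        (ifP (≤P (+P (numP 1) (fstP ∘P v0)) (N ∘P fstP ∘P fstP)) ⟨ +P (numP 1) (fstP ∘P v0) , consP unitP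
            (sndP ∘P v0) ⟩P v0)
        (K 20) (λ ι γ x s → grows {ι} (k ι γ) s)
        where
        grows : ∀ {ι : Ix} k (s : ℕ × List ⊤) → sz (ℕ₂ ⊠ 𝕃 𝟙) {ι} (climb-step k s) ≤ sz (ℕ₂ ⊠ 𝕃 𝟙) {ι} s + 20
        grows {ι} k (c , u) with suc c ≤ᵇ k
        ... | true  = ≤-trans (s≤s (+-monoˡ-≤ _ (sz-+ {ι = ι} 1 c)))
            (≤-trans (m≤m+n _ 6) (≤-reflexive (move (sz ℕ₂ {ι} c) (sz (𝕃 𝟙) {ι} u))))
          where
          move : ∀ c u → suc (7 + (5 + c) + suc (1 + u)) + 6 ≡ suc (c + u) + 20
          move = solve-∀
        ... | false = m≤m+n _ 20

      chopP : ∀ {u l} → Poly Γ (𝕃 𝟙) u → Poly Γ (𝕃 A) l → Poly Γ (𝕃 A ⊠ 𝕃 A) (λ ι γ → chop (u ι γ) (l ι γ))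
      chopP {Γ} {A} U L = foldP⁺ {st = λ ι γ → chop-step (proj₂ γ)} U ⟨ nilP , L ⟩P
        (caseP (sndP ∘P v0) v0 ⟨ consP v1 (fstP ∘P v2) , v0 ⟩P) (K 0)
        (λ ι γ _ s → ≤-reflexive (trans (same {ι} s) (sym (+-identityʳ _))))
        where
        same : ∀ {ι : Ix} (s : List (Car A ι) × List (Car A ι)) → sz (𝕃 A ⊠ 𝕃 A) {ι} (chop-step s) ≡ sz
            (𝕃 A ⊠ 𝕃 A) {ι} s
        same (r , [])    = refl
        same (r , x ∷ l) = move (sz A x) (sz (𝕃 A) r) (sz (𝕃 A) l)
          where
          move : ∀ x r l → 1 + ((1 + (x + r)) + l) ≡ 1 + (r + (1 + (x + l)))
          move = solve-∀

      nthP : ∀ {z k l} → Poly Γ A z → Poly Γ ℕ₂ k → Poly Γ (𝕃 A) l → Poly Γ A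
          (λ ι γ → nth (z ι γ) (k ι γ) (l ι γ))
      nthP {Γ} {A} {z} {k} Z N L = sndP ∘P foldP⁺ {S = ℕ₂ ⊠ A} {st = λ ι γ → nth-step (k ι (proj₁ (proj₁ γ)))
          (proj₂ γ) (proj₂ (proj₁ γ))} L ⟨ numP 0 , Z ⟩P
        ⟨ +P (numP 1) (fstP ∘P v0) , ifP (≡P (fstP ∘P v0) (N ∘P fstP ∘P fstP)) v1 (sndP ∘P v0) ⟩P
        (X ⊕ K 12) (λ ι γ x s → ≤-trans (grows (k ι γ) x s)
            (+-monoʳ-≤ (sz (ℕ₂ ⊠ A) s) (+-monoˡ-≤ 12 (m≤n+m (sz A x) (sz Γ γ)))))
        where
        grows : ∀ {ι : Ix} k x (s : ℕ × Car A ι) → sz (ℕ₂ ⊠ A) {ι} (nth-step k s x) ≤ sz (ℕ₂ ⊠ A) {ι} s +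
            (sz A x + 12)
        grows {ι} k x (j , r) = ≤-trans (s≤s (+-mono-≤ (sz-+ {ι = ι} 1 j) (choice (j ≡ᵇ k))))
            (≤-reflexive (move (sz ℕ₂ {ι} j) (sz A r) (sz A x)))
          where
          choice : ∀ b → sz A (if b then x else r) ≤ sz A r + sz A x
          choice true  = m≤n+m _ (sz A r)
          choice false = m≤m+n (sz A r) _
          move : ∀ j r x → suc (7 + (5 + j) + (r + x)) ≡ suc (j + r) + (x + 12)
          move = solve-∀

      -- Each step enlarges all numerators collected so far, so the increment is not controlled by
      -- the element alone. Instead the size of every number is kept linear in the input.
      scaleP : ∀ {l} → Poly Γ (𝕃 (ℕ₂ ⊠ ℕ₂)) l → Poly Γ (𝕃 ℕ₂ ⊠ ℕ₂) (λ ι γ → scale (l ι γ))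
      scaleP {Γ} {l} L = foldP {st = λ ι γ → scale-step (proj₂ γ) (proj₂ (proj₁ γ))} L ⟨ nilP , numP 1 ⟩P
        ⟨ ++P (mapP (fstP ∘P v0) (*P v0 (sndP ∘P v2))) (consP (*P (fstP ∘P v1) (sndP ∘P v0)) nilP) , *P
            (sndP ∘P v0) (sndP ∘P v1) ⟩P
        (K 1 ⊕ (growth L ⊗ (K 8 ⊕ K 6 ⊗ growth L) ⊕ K 1 ⊕ (K 7 ⊕ K 6 ⊗ growth L)))
        (λ ι γ l₁ l₂ eq → bounded ι l₁ _ (≤-trans (sz-prefix (ℕ₂ ⊠ ℕ₂) {ι} l₁ l₂)
            (≤-trans (≤-reflexive (cong (sz (𝕃 (ℕ₂ ⊠ ℕ₂)) {ι}) (sym eq))) (out-size L ι γ))))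
        where
        module _ (ι : Ix) where
          all≤ : ∀ l ns D B → All (λ n → sz ℕ₂ {ι} n ≤ B) ns → sz ℕ₂ {ι} D ≤ B →
            let r = foldl scale-step (ns , D) l ; B′ = B + 6 * sz (𝕃 (ℕ₂ ⊠ ℕ₂)) {ι} l in
            length (proj₁ r) ≡ length ns + length l × All (λ n → sz ℕ₂ {ι} n ≤ B′) (proj₁ r) × sz ℕ₂ {ι}
                (proj₂ r) ≤ B′
          all≤ []            ns D B ns≤ D≤ = sym (+-identityʳ _) , All.map (λ h → ≤-trans h (m≤m+n B 6)) ns≤ ,
              ≤-trans D≤ (m≤m+n B 6)
          all≤ ((p , q) ∷ l) ns D B ns≤ D≤ with all≤ l (map (_* q) ns ++ [ p * D ]) (D * q) B₁
              (Allₚ.++⁺ (Allₚ.map⁺ (All.map (λ {n} n≤ → ≤-trans (sz-* {ι = ι} n q)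
                  (times n≤ (m≤n+m _ (sz ℕ₂ {ι} p)))) ns≤))
                (≤-trans (sz-* {ι = ι} p D) (≤-trans (≤-reflexive (rotate (sz ℕ₂ {ι} p) (sz ℕ₂ {ι} D)))
                    (times D≤ (m≤m+n _ (sz ℕ₂ {ι} q)))) ∷ []))
              (≤-trans (sz-* {ι = ι} D q) (times D≤ (m≤n+m _ (sz ℕ₂ {ι} p))))
            where
            pq = sz ℕ₂ {ι} p + sz ℕ₂ {ι} q
            B₁ = B + (5 + pq)
            times : ∀ {n r} → n ≤ B → r ≤ pq → n + (5 + r) ≤ B₁
            times n≤ r≤ = +-mono-≤ n≤ (+-monoʳ-≤ 5 r≤)
            rotate : ∀ p d → p + (5 + d) ≡ d + (5 + p)
            rotate = solve-∀
          ... | len≡ , all , D′≤ = trans len≡ (trans (cong (_+ length l) (trans (length-++ (map (_* q) ns))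
              (cong (_+ 1) (length-map (_* q) ns)))) (+-assoc (length ns) 1 (length l)))
              , All.map (λ h → ≤-trans h B≤) all , ≤-trans D′≤ B≤
            where
            pq = sz ℕ₂ {ι} p + sz ℕ₂ {ι} q
            s = sz (𝕃 (ℕ₂ ⊠ ℕ₂)) {ι} l
            B≤ : B + (5 + pq) + 6 * s ≤ B + 6 * suc (suc pq + s)
            B≤ = ≤-trans (m≤m+n _ (7 + 5 * pq)) (≤-reflexive (move B pq s))
              where
              move : ∀ b p s → b + (5 + p) + 6 * s + (7 + 5 * p) ≡ b + 6 * suc (suc p + s)
              move = solve-∀
          list≤ : ∀ ns B → All (λ n → sz ℕ₂ {ι} n ≤ B) ns → sz (𝕃 ℕ₂) {ι} ns ≤ length ns * suc B + 1
          list≤ []       B _        = ≤-refl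
          list≤ (n ∷ ns) B (h ∷ hs) = s≤s (≤-trans (+-mono-≤ h (list≤ ns B hs))
              (≤-reflexive (sym (+-assoc B _ 1))))
        bounded : ∀ (ι : Ix) l n → sz (𝕃 (ℕ₂ ⊠ ℕ₂)) {ι} l ≤ n → sz (𝕃 ℕ₂ ⊠ ℕ₂) {ι} (scale l) ≤ 1 +
            (n * (8 + 6 * n) + 1 + (7 + 6 * n))
        bounded ι l n l≤ with all≤ ι l [] 1 7 [] ≤-refl
        ... | len≡ , all , D≤ = s≤s (+-mono-≤ (≤-trans (list≤ ι _ _ all)
            (+-monoˡ-≤ 1 (*-mono-≤ (≤-trans (≤-reflexive len≡) (≤-trans (length≤sz (ℕ₂ ⊠ ℕ₂) {ι} l) l≤))
                (s≤s (+-monoʳ-≤ 7 (*-monoʳ-≤ 6 l≤))))))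
          (≤-trans D≤ (+-monoʳ-≤ 7 (*-monoʳ-≤ 6 l≤))))

  chunk-step : {A : Set} → List ⊤ → List A × List (List A) → List A × List (List A)
  chunk-step u s = proj₂ (chop u (proj₁ s)) , proj₁ (chop u (proj₁ s)) ∷ proj₂ s

  -- `chop` returns its part reversed, hence the inner `reverse`; the outer one restores the order
  -- of the parts.
  chunks : {A : Set} → List ⊤ → List ⊤ → List A → List (List A)
  chunks u v l = reverse (map reverse (proj₂ (foldl (λ s _ → chunk-step u s) (l , []) v)))

  chunks-concat : ∀ {A : Set} m (L : List (List A)) → All (λ l → length l ≡ m) L →
    chunks (replicate m tt) (replicate (length L) tt) (concat L) ≡ L
  chunks-concat {A} m L lengths = trans (cong (λ s → reverse (map reverse (proj₂ s))) (go L [] lengths))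
    (trans (cong (λ l → reverse (map reverse l)) (trans (ʳ++-defn (map reverse L)) (++-identityʳ _)))
    (trans (cong reverse (reverse-map reverse (map reverse L)))
    (trans (reverse-involutive _) (trans (sym (map-∘ L)) (trans (map-cong reverse-involutive L) (map-id L))))))
    where
    go : ∀ L out → All (λ l → length l ≡ m) L →
      foldl (λ s _ → chunk-step (replicate m tt) s) (concat L , out) (replicate (length L) tt) ≡
          ([] , map reverse L ʳ++ out)
    go []      out _            = refl
    go (l ∷ L) out (refl ∷ eqs) = trans
      (cong (λ s → foldl (λ s _ → chunk-step (replicate m tt) s) (proj₂ s , proj₁ s ∷ out)
          (replicate (length L) tt)) (chop-++ l (concat L)))
      (go L (reverse l ∷ out) eqs)

  module _ {Ix : Set} where

    private variable
      Γ A : Code Ix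

    chop-size : ∀ (A : Code Ix) {ι} u (l : List (Car A ι)) → sz (𝕃 A ⊠ 𝕃 A) (chop u l) ≡ suc (1 + sz (𝕃 A) l)
    chop-size A {ι} u l = go u ([] , l)
      where
      go : ∀ u (s : List (Car A ι) × List (Car A ι)) → sz (𝕃 A ⊠ 𝕃 A) (foldl (λ s _ → chop-step s) s u) ≡ sz
          (𝕃 A ⊠ 𝕃 A) s
      go []      s           = refl
      go (_ ∷ u) (r , [])    = go u (r , [])
      go (_ ∷ u) (r , x ∷ l) = trans (go u (x ∷ r , l)) (move (sz A x) (sz (𝕃 A) r) (sz (𝕃 A) l))
        where
        move : ∀ x r l → 1 + ((1 + (x + r)) + l) ≡ 1 + (r + (1 + (x + l)))
        move = solve-∀

    abstract
      chunksP : ∀ {u v l} → Poly Γ (𝕃 𝟙) u → Poly Γ (𝕃 𝟙) v → Poly Γ (𝕃 A) l → Poly Γ (𝕃 (𝕃 A))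
          (λ ι γ → chunks (u ι γ) (v ι γ) (l ι γ))
      chunksP {Γ} {A} {u} U V L = reverseP (mapP (sndP ∘P foldP⁺ {S = 𝕃 A ⊠ 𝕃 (𝕃 A)}
          {st = λ ι γ → chunk-step (u ι (proj₁ (proj₁ γ))) (proj₂ γ)} V ⟨ L , nilP ⟩P
          ⟨ sndP ∘P chopped , consP (fstP ∘P chopped) (sndP ∘P v0) ⟩P (K 2) (λ ι γ _ s → grows (u ι γ) s))
              (reverseP v0))
        where
        chopped : Poly (Γ ⊠ 𝟙 ⊠ (𝕃 A ⊠ 𝕃 (𝕃 A))) (𝕃 A ⊠ 𝕃 A) (λ ι γ → chop (u ι (proj₁ (proj₁ γ)))
            (proj₁ (proj₂ γ)))
        chopped = chopP (U ∘P fstP ∘P fstP) (fstP ∘P v0)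
        grows : ∀ {ι : Ix} u (s : List (Car A ι) × List (List (Car A ι))) → sz (𝕃 A ⊠ 𝕃 (𝕃 A)) (chunk-step u s)
            ≤ sz (𝕃 A ⊠ 𝕃 (𝕃 A)) s + 2
        grows u (l , out) = ≤-reflexive (trans (move (sz (𝕃 A) (proj₂ (chop u l))) (sz (𝕃 A) (proj₁ (chop u l)))
            (sz (𝕃 (𝕃 A)) out))
          (trans (cong (λ z → z + (1 + sz (𝕃 (𝕃 A)) out)) (chop-size A u l))
              (move′ (sz (𝕃 A) l) (sz (𝕃 (𝕃 A)) out))))
          where
          move : ∀ b a o → 1 + (b + (1 + (a + o))) ≡ 1 + (a + b) + (1 + o)
          move = solve-∀
          move′ : ∀ l o → 1 + (1 + l) + (1 + o) ≡ 1 + (l + o) + 2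
          move′ = solve-∀

      lengthP : ∀ {l} → Poly Γ (𝕃 A) l → Poly Γ ℕ₂ (λ ι γ → length (l ι γ))
      lengthP {Γ} {A} {l} L = ext (λ ι γ → trans (count 0 (l ι γ)) refl)
        (foldP⁺ {st = λ ι γ → 1 + proj₂ γ} L (numP 0) (+P (numP 1) v0) (K 12) (λ ι γ _ s →
          ≤-trans (sz-+ {ι = ι} 1 s) (≤-reflexive (+-comm 12 (sz ℕ₂ {ι} s)))))
        where
        count : ∀ {B : Set} k (l : List B) → foldl (λ s _ → 1 + s) k l ≡ k + length l
        count k []      = sym (+-identityʳ k)
        count k (_ ∷ l) = trans (count (1 + k) l) (sym (+-suc k (length l)))

-- Integer data for a rational instance.

module ScaledInstance where

  open PolyWords using (scale; scale-step)
  open Routing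
  open Splitting
  open RoutingAnalysis
  import Data.Fin.Properties as Finₚ
  open import Data.Integer as ℤ using (+_; -[1+_])
  import Data.Integer.Properties as ℤₚ
  open import Data.List.Relation.Unary.All as All using (All; []; _∷_)
  import Data.List.Relation.Unary.All.Properties as Allₚ
  open import Data.Nat as ℕ using (ℕ; zero; suc; _+_; _*_; z≤n; s≤s)
  open import Data.Nat.Coprimality using (1-coprimeTo) renaming (sym to coprime-sym)
  open import Data.Nat.Divisibility using (_∣_; divides; ∣-trans; m∣m*n; n∣m*n; ∣n⇒∣m*n)
  open import Data.Nat.DivMod using (_/_; m/n*n≡m; m*n/n≡m)
  import Data.Nat.Properties as ℕₚ
  open import Data.Rational as ℚ using (ℚ; mkℚ; 0ℚ; 1ℚ; _≤_; ↥_; ↧ₙ_)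
  import Data.Rational.Properties as ℚₚ
  open import Data.Rational.Unnormalised using (*≡*; *≤*)
  import Data.Rational.Unnormalised.Properties as ℚᵘₚ

  ⟪_⟫ : ℕ → ℚ
  ⟪ n ⟫ = mkℚ (+ n) 0 (coprime-sym (1-coprimeTo n))

  ⟪⟫-+ : ∀ m n → ⟪ m + n ⟫ ≡ ⟪ m ⟫ ℚ.+ ⟪ n ⟫
  ⟪⟫-+ m n = ℚₚ.toℚᵘ-injective (ℚᵘₚ.≃-trans (*≡* (cong (ℤ._* + 1) (sum≡)))
      (ℚᵘₚ.≃-sym (ℚₚ.toℚᵘ-homo-+ ⟪ m ⟫ ⟪ n ⟫)))
    where
    sum≡ : + (m + n) ≡ + m ℤ.* + 1 ℤ.+ + n ℤ.* + 1
    sum≡ = trans (ℤₚ.pos-+ m n) (sym (cong₂ ℤ._+_ (ℤₚ.*-identityʳ (+ m)) (ℤₚ.*-identityʳ (+ n))))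

  ⟪⟫-* : ∀ m n → ⟪ m * n ⟫ ≡ ⟪ m ⟫ ℚ.* ⟪ n ⟫
  ⟪⟫-* m n = ℚₚ.toℚᵘ-injective (ℚᵘₚ.≃-trans (*≡* (cong (ℤ._* + 1) (ℤₚ.pos-* m n)))
      (ℚᵘₚ.≃-sym (ℚₚ.toℚᵘ-homo-* ⟪ m ⟫ ⟪ n ⟫)))

  ⟪⟫-cancel-≤ : ∀ {m n} → ⟪ m ⟫ ≤ ⟪ n ⟫ → m ℕ.≤ n
  ⟪⟫-cancel-≤ {m} {n} (ℚ.*≤* le) = ℤₚ.drop‿+≤+ (subst₂ ℤ._≤_ (ℤₚ.*-identityʳ (+ m)) (ℤₚ.*-identityʳ (+ n)) le)

  ⟪⟫-mono-≤ : ∀ {m n} → m ℕ.≤ n → ⟪ m ⟫ ≤ ⟪ n ⟫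
  ⟪⟫-mono-≤ {m} {n} le = ℚ.*≤* (subst₂ ℤ._≤_ (sym (ℤₚ.*-identityʳ (+ m))) (sym (ℤₚ.*-identityʳ (+ n)))
      (ℤ.+≤+ le))

  frac : ℚ → ℕ × ℕ
  frac q = ℤ.∣ ↥ q ∣ , ↧ₙ q

  -- The division is exact in all uses, since D will be a multiple of the denominator of q.
  scaled : ℕ → ℚ → ℕ
  scaled D q = ℤ.∣ ↥ q ∣ * D / ↧ₙ q

  ⟪scaled⟫ : ∀ D q → 0ℚ ≤ q → ↧ₙ q ∣ D → ⟪ scaled D q ⟫ ≡ ⟪ D ⟫ ℚ.* q
  ⟪scaled⟫ D q@(mkℚ (+ a) b-1 _) _ b∣D = ℚₚ.toℚᵘ-injective
      (ℚᵘₚ.≃-trans (*≡* cross) (ℚᵘₚ.≃-sym (ℚₚ.toℚᵘ-homo-* ⟪ D ⟫ q)))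
    where
    cross : + scaled D q ℤ.* + (1 * suc b-1) ≡ (+ D ℤ.* + a) ℤ.* + 1
    cross = trans (sym (ℤₚ.pos-* (scaled D q) (1 * suc b-1)))
        (trans (cong +_ (trans (cong (scaled D q *_) (ℕₚ.*-identityˡ (suc b-1)))
      (trans (m/n*n≡m (∣n⇒∣m*n a b∣D)) (ℕₚ.*-comm a D))))
          (trans (ℤₚ.pos-* D a) (sym (ℤₚ.*-identityʳ (+ D ℤ.* + a)))))
  ⟪scaled⟫ D (mkℚ -[1+ a ] b-1 _) (ℚ.*≤* ()) b∣D

  denominator-from : ℕ → List ℚ → ℕ
  denominator-from D []       = D
  denominator-from D (q ∷ qs) = denominator-from (D * ↧ₙ q) qs

  denominator : List ℚ → ℕ
  denominator = denominator-from 1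

  -- For the induction, the fractions `rs` already read must be exact over the current denominator;
  -- multiplying it by another one preserves divisibility.
  scale-from : ∀ D rs qs → All (λ q → ↧ₙ q ∣ D) rs → let D′ = denominator-from D qs in
    foldl scale-step (map (scaled D) rs , D) (map frac qs) ≡ (map (scaled D′) (rs ++ qs) , D′) ×
    All (λ q → ↧ₙ q ∣ D′) (rs ++ qs)
  scale-from D rs []       div rewrite Data.List.Properties.++-identityʳ rs = refl , div
  scale-from D rs (q ∷ qs) div with scale-from (D * ↧ₙ q) (rs ++ [ q ]) qs div′
    where
    div′ : All (λ r → ↧ₙ r ∣ D * ↧ₙ q) (rs ++ [ q ])
    div′ = Allₚ.++⁺ (All.map (λ d → ∣-trans d (m∣m*n (↧ₙ q))) div) (n∣m*n D ∷ [])
  ... | eq , div″ rewrite ++-assoc rs [ q ] qs = trans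
      (cong (λ l → foldl scale-step (l , D * ↧ₙ q) (map frac qs)) (sym step)) eq , div″
    where
    old : ∀ r → ↧ₙ r ∣ D → scaled (D * ↧ₙ q) r ≡ scaled D r * ↧ₙ q
    old r (divides k D≡) rewrite D≡ = trans (cong (_/ ↧ₙ r) (move ℤ.∣ ↥ r ∣ k (↧ₙ r) (↧ₙ q)))
        (trans (m*n/n≡m (ℤ.∣ ↥ r ∣ * k * ↧ₙ q) (↧ₙ r))
      (cong (_* ↧ₙ q) (sym (trans (cong (_/ ↧ₙ r) (sym (ℕₚ.*-assoc ℤ.∣ ↥ r ∣ k (↧ₙ r))))
          (m*n/n≡m (ℤ.∣ ↥ r ∣ * k) (↧ₙ r))))))
      where
      move : ∀ a k b d → a * (k * b * d) ≡ a * k * d * b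
      move = solve-∀
    new : scaled (D * ↧ₙ q) q ≡ ℤ.∣ ↥ q ∣ * D
    new = trans (cong (_/ ↧ₙ q) (sym (ℕₚ.*-assoc ℤ.∣ ↥ q ∣ D (↧ₙ q)))) (m*n/n≡m (ℤ.∣ ↥ q ∣ * D) (↧ₙ q))
    step : map (scaled (D * ↧ₙ q)) (rs ++ [ q ]) ≡ map (_* ↧ₙ q) (map (scaled D) rs) ++ [ ℤ.∣ ↥ q ∣ * D ]
    step = trans (map-++ (scaled (D * ↧ₙ q)) rs [ q ])
        (cong₂ _++_ (trans (map-cong-local (All.map (λ {r} → old r) div)) (map-∘ rs)) (cong [_] new))

  scale-frac : ∀ qs → scale (map frac qs) ≡ (map (scaled (denominator qs)) qs , denominator qs)
  scale-frac qs = proj₁ (scale-from 1 [] qs [])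

  ∣denominator : ∀ qs → All (λ q → ↧ₙ q ∣ denominator qs) qs
  ∣denominator qs = proj₂ (scale-from 1 [] qs [])

  denominator≥1 : ∀ qs → 1 ℕ.≤ denominator qs
  denominator≥1 qs = go 1 qs ℕₚ.≤-refl
    where
    go : ∀ D qs → 1 ℕ.≤ D → 1 ℕ.≤ denominator-from D qs
    go D []       h = h
    go D (q ∷ qs) h = go (D * ↧ₙ q) qs (ℕₚ.*-mono-≤ h (s≤s z≤n))

  module Scaled (I : CVRPInstance) where

    open CVRPInstance I renaming (customers to n)

    distances demands : List ℚ
    distances = concatMap (λ i → map (dist i) (allFin (suc n))) (allFin (suc n))
    demands   = map demand (allFin n)

    -- Distances and demands get separate denominators; the vehicle capacity 1 turns into `cap`.
    D cap : ℕ
    D   = denominator distances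
    cap = denominator demands

    c : Fin (suc n) → Fin (suc n) → ℕ
    c i j = scaled D (dist i j)

    dem : Fin n → ℕ
    dem v = scaled cap (demand v)

    w : Fin n → ℕ
    w v = c zero (suc v)

    d : Fin n → Fin n → ℕ
    d u v = c (suc u) (suc v)

    private
      open import Data.List.Membership.Propositional using (_∈_)
      open import Data.List.Membership.Propositional.Properties using (∈-map⁺; ∈-allFin; ∈-concat⁺′)

      dist∈ : ∀ i j → dist i j ∈ distances
      dist∈ i j = ∈-concat⁺′ (∈-map⁺ (dist i) (∈-allFin j)) (∈-map⁺ (λ i → map (dist i) (allFin (suc n)))
          (∈-allFin i))

    ⟪c⟫ : ∀ i j → ⟪ c i j ⟫ ≡ ⟪ D ⟫ ℚ.* dist i j
    ⟪c⟫ i j = ⟪scaled⟫ D (dist i j) (nonnegative i j) (All.lookup (∣denominator distances) (dist∈ i j))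

    ⟪dem⟫ : ∀ v → ⟪ dem v ⟫ ≡ ⟪ cap ⟫ ℚ.* demand v
    ⟪dem⟫ v = ⟪scaled⟫ cap (demand v) (demand≥0 v) (All.lookup (∣denominator demands)
        (∈-map⁺ demand (∈-allFin v)))

    1≤cap : 1 ℕ.≤ cap
    1≤cap = denominator≥1 demands

    private instance
      D-nonNeg : ℚ.NonNegative ⟪ D ⟫
      D-nonNeg = ℚ.nonNegative (⟪⟫-mono-≤ {0} z≤n)
      cap-nonNeg : ℚ.NonNegative ⟪ cap ⟫
      cap-nonNeg = ℚ.nonNegative (⟪⟫-mono-≤ {0} z≤n)

      D-pos : ℚ.Positive ⟪ D ⟫
      D-pos = pos D (denominator≥1 distances)
        where
        pos : ∀ m → 1 ℕ.≤ m → ℚ.Positive ⟪ m ⟫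
        pos (suc m) _ = _
      cap-pos : ℚ.Positive ⟪ cap ⟫
      cap-pos = pos cap 1≤cap
        where
        pos : ∀ m → 1 ℕ.≤ m → ℚ.Positive ⟪ m ⟫
        pos (suc m) _ = _

    c-sym : ∀ x y → c x y ≡ c y x
    c-sym x y = cong (scaled D) (symmetric x y)

    c-tri : ∀ x y z → c x z ℕ.≤ c x y + c y z
    c-tri x y z = ⟪⟫-cancel-≤ (subst₂ _≤_ (sym (⟪c⟫ x z))
      (trans (ℚₚ.*-distribˡ-+ ⟪ D ⟫ (dist x y) (dist y z)) (trans (cong₂ ℚ._+_ (sym (⟪c⟫ x y)) (sym (⟪c⟫ y z)))
          (sym (⟪⟫-+ (c x y) (c y z)))))
      (ℚₚ.*-monoˡ-≤-nonNeg ⟪ D ⟫ (triangle x y z)))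

    dem≤cap : ∀ v → dem v ℕ.≤ cap
    dem≤cap v = ⟪⟫-cancel-≤ (subst₂ _≤_ (sym (⟪dem⟫ v)) (ℚₚ.*-identityʳ ⟪ cap ⟫)
        (ℚₚ.*-monoˡ-≤-nonNeg ⟪ cap ⟫ (demand≤1 v)))

    depot-tri : ∀ x y → w x ℕ.≤ d x y + w y
    depot-tri x y = ℕₚ.≤-trans (c-tri zero (suc y) (suc x))
        (ℕₚ.≤-reflexive (trans (ℕₚ.+-comm (w y) _) (cong (_+ w y) (c-sym (suc y) (suc x)))))

    open Algorithm w d dem cap public
    open Analysis Finₚ._≟_ w d dem cap 1≤cap dem≤cap (λ x y → c-sym (suc x) (suc y)) depot-tri
        (λ x y z → c-tri (suc x) (suc y) (suc z)) public

    ⟪load⟫ : ∀ Q → ⟪ load Q ⟫ ≡ ⟪ cap ⟫ ℚ.* sumℚ (map demand Q)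
    ⟪load⟫ []      = sym (ℚₚ.*-zeroʳ ⟪ cap ⟫)
    ⟪load⟫ (v ∷ Q) = trans (⟪⟫-+ (dem v) (load Q)) (trans (cong₂ ℚ._+_ (⟪dem⟫ v) (⟪load⟫ Q))
        (sym (ℚₚ.*-distribˡ-+ ⟪ cap ⟫ (demand v) _)))

    load≤⇒ : ∀ Q → load Q ℕ.≤ cap → sumℚ (map demand Q) ≤ 1ℚ
    load≤⇒ Q le = ℚₚ.*-cancelˡ-≤-pos ⟪ cap ⟫ (subst₂ _≤_ (⟪load⟫ Q) (sym (ℚₚ.*-identityʳ ⟪ cap ⟫))
        (⟪⟫-mono-≤ le))

    load≤⇐ : ∀ Q → sumℚ (map demand Q) ≤ 1ℚ → load Q ℕ.≤ cap
    load≤⇐ Q le = ⟪⟫-cancel-≤ (subst₂ _≤_ (sym (⟪load⟫ Q)) (ℚₚ.*-identityʳ ⟪ cap ⟫)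
        (ℚₚ.*-monoˡ-≤-nonNeg ⟪ cap ⟫ le))

    private
      ⟪pathEnd⟫ : ∀ x Q → ⟪ pathEnd x Q ⟫ ≡ ⟪ D ⟫ ℚ.* pathCost dist (suc x) (map suc Q) zero
      ⟪pathEnd⟫ x []      = trans (cong ⟪_⟫ (c-sym zero (suc x))) (⟪c⟫ (suc x) zero)
      ⟪pathEnd⟫ x (y ∷ Q) = trans (⟪⟫-+ (d x y) _) (trans (cong₂ ℚ._+_ (⟪c⟫ (suc x) (suc y)) (⟪pathEnd⟫ y Q))
          (sym (ℚₚ.*-distribˡ-+ ⟪ D ⟫ (dist (suc x) (suc y)) _)))

    ⟪tourLength⟫ : ∀ Q → ⟪ tourLength Q ⟫ ≡ ⟪ D ⟫ ℚ.* cycleCost dist (zero ∷ map suc Q)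
    ⟪tourLength⟫ []      = sym (trans (cong (⟪ D ⟫ ℚ.*_) (self zero)) (ℚₚ.*-zeroʳ ⟪ D ⟫))
    ⟪tourLength⟫ (x ∷ Q) = trans (⟪⟫-+ (w x) _) (trans (cong₂ ℚ._+_ (⟪c⟫ zero (suc x)) (⟪pathEnd⟫ x Q))
        (sym (ℚₚ.*-distribˡ-+ ⟪ D ⟫ (dist zero (suc x)) _)))

    ⟪totalLength⟫ : ∀ L → ⟪ totalLength (map toList L) ⟫ ≡ ⟪ D ⟫ ℚ.* sumℚ (map tourCost L)
    ⟪totalLength⟫ []      = sym (ℚₚ.*-zeroʳ ⟪ D ⟫)
    ⟪totalLength⟫ (Q ∷ L) = trans (⟪⟫-+ (tourLength (toList Q)) _)
        (trans (cong₂ ℚ._+_ (⟪tourLength⟫ (toList Q)) (⟪totalLength⟫ L))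
        (sym (ℚₚ.*-distribˡ-+ ⟪ D ⟫ (tourCost Q) _)))

    unscale-≤ : ∀ {p q} → ⟪ D ⟫ ℚ.* p ≤ ⟪ D ⟫ ℚ.* q → p ≤ q
    unscale-≤ = ℚₚ.*-cancelˡ-≤-pos ⟪ D ⟫

    -- Each intermediate visit to the depot is replaced by a direct connection. So an optimal
    -- traveling salesman tour costs at most as much as any routing solution.
    tourLength-concat : ∀ L → tourLength (concat L) ℕ.≤ totalLength L
    tourLength-concat []      = z≤n
    tourLength-concat (Q ∷ L) = ℕₚ.≤-trans (join Q (concat L))
        (ℕₚ.+-monoʳ-≤ (tourLength Q) (tourLength-concat L))
      where
      join-path : ∀ x P Q → pathEnd x (P ++ Q) ℕ.≤ pathEnd x P + tourLength Q
      join-path x []      []      = ℕₚ.≤-reflexive (sym (ℕₚ.+-identityʳ (w x)))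
      join-path x []      (y ∷ Q) = ℕₚ.≤-trans (ℕₚ.+-monoˡ-≤ (pathEnd y Q)
          (ℕₚ.≤-trans (c-tri (suc x) zero (suc y)) (ℕₚ.≤-reflexive (cong (_+ w y) (c-sym (suc x) zero)))))
        (ℕₚ.≤-reflexive (ℕₚ.+-assoc (w x) (w y) _))
      join-path x (z ∷ P) Q = ℕₚ.≤-trans (ℕₚ.+-monoʳ-≤ (d x z) (join-path z P Q))
          (ℕₚ.≤-reflexive (sym (ℕₚ.+-assoc (d x z) _ _)))
      join : ∀ P Q → tourLength (P ++ Q) ℕ.≤ tourLength P + tourLength Q
      join []      Q = ℕₚ.≤-refl
      join (x ∷ P) Q = ℕₚ.≤-trans (ℕₚ.+-monoʳ-≤ (w x) (join-path x P Q))
          (ℕₚ.≤-reflexive (sym (ℕₚ.+-assoc (w x) _ _)))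

-- From a traveling salesman tour to a routing solution.

module Approximation where

  open PolyTime using (caseList)
  open Routing
  open Splitting
  open ScaledInstance
  open import Data.List.Membership.Propositional.Properties using (∈-∃++)
  open import Data.List.Relation.Binary.Permutation.Propositional using (_↭_; ↭-trans; ↭-sym; ↭-reflexive; prep;
      ↭⇒↭ₛ)
  open import Data.List.Relation.Binary.Permutation.Propositional.Properties using
      (∈-resp-↭; drop-mid; map⁺; ↭-map-inv; ++-comm)
  import Data.List.Relation.Binary.Permutation.Setoid.Properties as Permₛ
  open import Data.List.Relation.Unary.All as All using (All; []; _∷_)
  import Data.List.Relation.Unary.All.Properties as Allₚ
  open import Data.List.Relation.Unary.AllPairs using (AllPairs)
  open import Data.List.Relation.Unary.Any using (here)
  import Data.List.Relation.Unary.Unique.Propositional.Properties as Uniqueₚ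
  open import Data.Nat using (ℕ; zero; suc; _+_; _*_)
  open import Data.Rational as ℚ using (ℚ; 1ℚ; _≤_)
  import Data.Rational.Properties as ℚₚ
  open import Data.Rational.Solver using (module +-*-Solver)

  asCustomer : ∀ {n} → Fin (suc n) → List (Fin n)
  asCustomer zero    = []
  asCustomer (suc v) = [ v ]

  -- At the depot the customers read so far are set aside; both components of the state are in
  -- reverse order.
  rotate-step : ∀ {n} → List (Fin n) × List (Fin n) → Fin (suc n) → List (Fin n) × List (Fin n)
  rotate-step s v = caseList (asCustomer v) (proj₂ s , []) (λ x _ → proj₁ s , x ∷ proj₂ s)

  -- Starts a cyclic order at the depot, which is omitted.
  rotate : ∀ {n} → List (Fin (suc n)) → List (Fin n)
  rotate l = let s = foldl rotate-step ([] , []) l in reverse (proj₁ s ++ proj₂ s)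

  pathCost-++ : ∀ {X : Set} (c : X → X → ℚ) x P y Q z → pathCost c x (P ++ y ∷ Q) z ≡ pathCost c x P y ℚ.+
      pathCost c y Q z
  pathCost-++ c x []      y Q z = refl
  pathCost-++ c x (p ∷ P) y Q z = trans (cong (c x p ℚ.+_) (pathCost-++ c p P y Q z))
      (sym (ℚₚ.+-assoc (c x p) _ _))

  cycleCost-rotate : ∀ {X : Set} (c : X → X → ℚ) P y Q → cycleCost c (P ++ y ∷ Q) ≡ cycleCost c (y ∷ Q ++ P)
  cycleCost-rotate c []      y Q = cong (λ l → cycleCost c (y ∷ l)) (sym (++-identityʳ Q))
  cycleCost-rotate c (p ∷ P) y Q = trans (pathCost-++ c p P y Q p) (trans (ℚₚ.+-comm (pathCost c p P y) _)
      (sym (pathCost-++ c y Q p P y)))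

  map-split : ∀ {A B : Set} (f : A → B) l xs ys → map f l ≡ xs ++ ys → ∃[ as ] ∃[ bs ] l ≡ as ++ bs × xs ≡ map f
      as × ys ≡ map f bs
  map-split f l       []       ys eq = [] , l , refl , refl , sym eq
  map-split f (x ∷ l) (y ∷ xs) ys eq with ∷-injective eq
  ... | refl , eq′ with map-split f l xs ys eq′
  ...   | as , bs , refl , refl , refl = x ∷ as , bs , refl , refl , refl

  module _ {n : ℕ} where

    private
      rotate-customers : ∀ (as : List (Fin n)) pre acc → foldl rotate-step (pre , acc) (map suc as) ≡
          (pre , as ʳ++ acc)
      rotate-customers []       pre acc = refl
      rotate-customers (a ∷ as) pre acc = rotate-customers as pre (a ∷ acc)

    rotate-++ : ∀ (as bs : List (Fin n)) → rotate (map suc as ++ zero ∷ map suc bs) ≡ bs ++ as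
    rotate-++ as bs = trans (cong (λ s → reverse (proj₁ s ++ proj₂ s)) state)
        (trans (reverse-++ (as ʳ++ []) (bs ʳ++ []))
      (cong₂ _++_ (involutive bs) (involutive as)))
      where
      involutive : ∀ (l : List (Fin n)) → reverse (l ʳ++ []) ≡ l
      involutive l = trans (cong reverse (trans (ʳ++-defn l) (++-identityʳ _))) (reverse-involutive l)
      state : foldl rotate-step ([] , []) (map suc as ++ zero ∷ map suc bs) ≡ (as ʳ++ [] , bs ʳ++ [])
      state = trans (foldl-++ rotate-step ([] , []) (map suc as) _)
        (trans (cong (λ s → foldl rotate-step s (zero ∷ map suc bs)) (rotate-customers as [] []))
            (rotate-customers bs (as ʳ++ []) []))

    -- The depot occurs exactly once, so the entries on both sides of it are customers.
    rotate-order : ∀ {l : List (Fin (suc n))} → l ↭ allFin (suc n) →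
      ∃[ as ] ∃[ bs ] l ≡ map suc as ++ zero ∷ map suc bs × bs ++ as ↭ allFin n
    rotate-order {l} p with ∈-∃++ (∈-resp-↭ (↭-sym p) (here {x = zero} refl))
    ... | xs , ys , refl with ↭-map-inv suc (↭-trans (↭-reflexive (map-tabulate (λ i → i) suc))
        (↭-sym (drop-mid xs [] p)))
    ...   | L , eq , q with map-split suc L xs ys (sym eq)
    ...     | as , bs , refl , refl , refl = as , bs , refl , ↭-trans (++-comm bs as) (↭-sym q)

  private
    pull : ∀ a b c → a ℚ.* (b ℚ.* c) ≡ b ℚ.* (a ℚ.* c)
    pull = solve 3 (λ a b c → a :* (b :* c) := b :* (a :* c)) refl
      where open +-*-Solver

  module Solve (I : CVRPInstance) where

    open CVRPInstance I hiding (Tour) renaming (customers to n)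
    open Scaled I

    tspInstance : TSPInstance
    tspInstance = record { size = suc n ; metric = metric }

    private
      toTours : ∀ {L} → All Tour L → List (List⁺ (Fin n))
      toTours []                           = []
      toTours ((nonempty x xs , _) ∷ ts)   = (x List⁺.∷ xs) ∷ toTours ts

      toTours-toList : ∀ {L} (ts : All Tour L) → map toList (toTours ts) ≡ L
      toTours-toList []                         = refl
      toTours-toList ((nonempty x xs , _) ∷ ts) = cong ((x ∷ xs) ∷_) (toTours-toList ts)

      toTours-capacity : ∀ {L} (ts : All Tour L) → All (λ Q → tourDemand Q ≤ 1ℚ) (toTours ts)
      toTours-capacity []                          = []
      toTours-capacity ((nonempty x xs , le) ∷ ts) = load≤⇒ (x ∷ xs) le ∷ toTours-capacity ts

    module _ (T : TSPTour tspInstance) where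

      open TSPTour T

      σ : List (Fin n)
      σ = rotate order

      private
        as bs : List (Fin n)
        as = proj₁ (rotate-order hamiltonian)
        bs = proj₁ (proj₂ (rotate-order hamiltonian))

        order≡ : order ≡ map suc as ++ zero ∷ map suc bs
        order≡ = proj₁ (proj₂ (proj₂ (rotate-order hamiltonian)))

        σ≡ : σ ≡ bs ++ as
        σ≡ = trans (cong rotate order≡) (rotate-++ as bs)

      σ↭ : σ ↭ allFin n
      σ↭ = ↭-trans (↭-reflexive σ≡) (proj₂ (proj₂ (proj₂ (rotate-order hamiltonian))))

      ⟪σ⟫ : ⟪ tourLength σ ⟫ ≡ ⟪ D ⟫ ℚ.* cycleCost dist order
      ⟪σ⟫ = trans (⟪tourLength⟫ σ) (cong (⟪ D ⟫ ℚ.*_)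
          (trans (cong (λ l → cycleCost dist (zero ∷ l)) (trans (cong (map suc) σ≡) (map-++ suc bs as)))
        (trans (sym (cycleCost-rotate dist (map suc as) zero (map suc bs)))
            (cong (cycleCost dist) (sym order≡)))))

      solution : CVRPSolution I
      solution = record
        { tours     = toTours (proj₂ (solve-correct σ))
        ; partition = ↭-trans (↭-reflexive (cong concat (toTours-toList (proj₂ (solve-correct σ)))))
            (↭-trans (proj₁ (solve-correct σ)) σ↭)
        ; capacity  = toTours-capacity (proj₂ (solve-correct σ)) }

      solution-tours : map toList (CVRPSolution.tours solution) ≡ solve σ
      solution-tours = toTours-toList (proj₂ (solve-correct σ))

      open MinimizationProblem using (cost)

      -- The bound `solve-length` with the factor D cancelled.
      solution-cost : (O : CVRPSolution I) →
        ⟪ 48 ⟫ ℚ.* cost CVRP solution ≤ ⟪ 48 ⟫ ℚ.* cost TSP T ℚ.+ ⟪ 95 ⟫ ℚ.* cost CVRP O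
      solution-cost O = unscale-≤ (subst₂ _≤_ lhs rhs (⟪⟫-mono-≤ (solve-length σ distinct L
          (↭-trans (CVRPSolution.partition O) (↭-sym σ↭))
              (Allₚ.map⁺ (All.map (λ {Q} → load≤⇐ (toList Q)) (CVRPSolution.capacity O))))))
        where
        L : List (List (Fin n))
        L = map toList (CVRPSolution.tours O)
        distinct : AllPairs _≢_ σ
        distinct = Permₛ.AllPairs-resp-↭ (setoid (Fin n)) (λ ne e → ne (sym e)) (resp₂ _≢_) (↭⇒↭ₛ (↭-sym σ↭))
            (Uniqueₚ.allFin⁺ n)
        lhs : ⟪ 48 * totalLength (solve σ) ⟫ ≡ ⟪ D ⟫ ℚ.* (⟪ 48 ⟫ ℚ.* cost CVRP solution)
        lhs = trans (⟪⟫-* 48 (totalLength (solve σ))) (trans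
          (cong (⟪ 48 ⟫ ℚ.*_) (trans (cong (λ l → ⟪ totalLength l ⟫) (sym solution-tours))
              (⟪totalLength⟫ (CVRPSolution.tours solution))))
          (pull ⟪ 48 ⟫ ⟪ D ⟫ (cost CVRP solution)))
        rhs : ⟪ 48 * tourLength σ + 95 * totalLength L ⟫ ≡ ⟪ D ⟫ ℚ.* (⟪ 48 ⟫ ℚ.* cost TSP T ℚ.+ ⟪ 95 ⟫ ℚ.* cost
            CVRP O)
        rhs = trans (⟪⟫-+ (48 * tourLength σ) (95 * totalLength L)) (trans (cong₂ ℚ._+_
            (trans (⟪⟫-* 48 (tourLength σ)) (trans (cong (⟪ 48 ⟫ ℚ.*_) ⟪σ⟫) (pull ⟪ 48 ⟫ ⟪ D ⟫ (cost TSP T))))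
            (trans (⟪⟫-* 95 (totalLength L)) (trans (cong (⟪ 95 ⟫ ℚ.*_) (⟪totalLength⟫ (CVRPSolution.tours O)))
                (pull ⟪ 95 ⟫ ⟪ D ⟫ (cost CVRP O)))))
          (sym (ℚₚ.*-distribˡ-+ ⟪ D ⟫ (⟪ 48 ⟫ ℚ.* cost TSP T) (⟪ 95 ⟫ ℚ.* cost CVRP O))))

    joined : CVRPSolution I → TSPTour tspInstance
    joined O = record
      { order       = zero ∷ map suc (concat (map toList tours))
      ; hamiltonian = prep zero (↭-trans (map⁺ suc partition) (↭-reflexive (map-tabulate (λ i → i) suc))) }
      where open CVRPSolution O

    joined-cost : ∀ O → MinimizationProblem.cost TSP (joined O) ≤ MinimizationProblem.cost CVRP O
    joined-cost O = unscale-≤ (subst₂ _≤_ (⟪tourLength⟫ (concat (map toList tours))) (⟪totalLength⟫ tours)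
        (⟪⟫-mono-≤ (tourLength-concat (map toList tours))))
      where open CVRPSolution O

-- Existence of an optimal routing solution, and the approximation guarantee.

module Minimum where

  open ScaledInstance
  open Approximation
  import Data.Rational.Properties as ℚₚ
  open import Data.Integer using (+_)
  open import Relation.Binary using (module DecTotalOrder)
  open import Data.List.Extrema (DecTotalOrder.totalOrder ℚₚ.≤-decTotalOrder) using (argmin; f[argmin]≤f[xs])
  open import Data.List.Membership.Propositional.Properties using (∈-∃++; ∈-map⁺; ∈-concatMap⁺)
  open import Data.List.Relation.Binary.Permutation.Propositional using
      (_↭_; ↭-refl; ↭-trans; ↭-sym; ↭-reflexive; prep; swap)
  open import Data.List.Relation.Binary.Permutation.Propositional.Properties using
      (∈-resp-↭; drop-mid; ↭-empty-inv)
  open import Data.List.Relation.Unary.All as All using (All; []; _∷_)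
  import Data.List.Relation.Unary.All.Properties as Allₚ
  open import Data.List.Relation.Unary.Any as Any using (Any; here; there)
  open import Data.Nat as ℕ using (ℕ)
  import Data.Nat.Properties as ℕₚ
  open import Data.Rational as ℚ using (ℚ; 0ℚ; 1ℚ; _≤_; _≤?_)
  open import Data.Rational.Solver using (module +-*-Solver)

  private
    concatMap-All : ∀ {A B : Set} {P : B → Set} (f : A → List B) {xs} → All (λ x → All P (f x)) xs → All P
        (concatMap f xs)
    concatMap-All f ps = Allₚ.concat⁺ (Allₚ.map⁺ ps)

  module _ {A : Set} where

    insertions : A → List A → List (List A)
    insertions x []       = [ x ] ∷ []
    insertions x (y ∷ ys) = (x ∷ y ∷ ys) ∷ map (y ∷_) (insertions x ys)

    permutations : List A → List (List A)
    permutations []       = [] ∷ []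
    permutations (x ∷ xs) = concatMap (insertions x) (permutations xs)

    insertions-sound : ∀ x ys → All (_↭ x ∷ ys) (insertions x ys)
    insertions-sound x []       = ↭-refl ∷ []
    insertions-sound x (y ∷ ys) = ↭-refl ∷ Allₚ.map⁺ (All.map (λ p → ↭-trans (prep y p) (swap y x ↭-refl))
        (insertions-sound x ys))

    permutations-sound : ∀ xs → All (_↭ xs) (permutations xs)
    permutations-sound []       = ↭-refl ∷ []
    permutations-sound (x ∷ xs) = concatMap-All (insertions x)
      (All.map (λ {ys} p → All.map (λ q → ↭-trans q (prep x p)) (insertions-sound x ys))
          (permutations-sound xs))

    insertions-complete : ∀ x as bs → as ++ x ∷ bs ∈ insertions x (as ++ bs)
    insertions-complete x []       []       = here refl
    insertions-complete x []       (b ∷ bs) = here refl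
    insertions-complete x (a ∷ as) bs       = there (∈-map⁺ (a ∷_) (insertions-complete x as bs))

    permutations-complete : ∀ xs {ys} → ys ↭ xs → ys ∈ permutations xs
    permutations-complete []       p = here (↭-empty-inv p)
    permutations-complete (x ∷ xs) p with ∈-∃++ (∈-resp-↭ (↭-sym p) (here refl))
    ... | as , bs , refl = ∈-concatMap⁺ (insertions x) (Any.map (λ { refl → insertions-complete x as bs })
        (permutations-complete xs (drop-mid as [] p)))

    extend : A → List (List⁺ A) → List (List (List⁺ A))
    extend x []                    = ((x List⁺.∷ []) ∷ []) ∷ []
    extend x ((y List⁺.∷ ys) ∷ L)  = ((x List⁺.∷ []) ∷ (y List⁺.∷ ys) ∷ L) ∷ ((x List⁺.∷ y ∷ ys) ∷ L) ∷ []

    splittings : List A → List (List (List⁺ A))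
    splittings []       = [] ∷ []
    splittings (x ∷ xs) = concatMap (extend x) (splittings xs)

    splittings-sound : ∀ xs → All (λ L → concat (map toList L) ≡ xs) (splittings xs)
    splittings-sound []       = refl ∷ []
    splittings-sound (x ∷ xs) = concatMap-All (extend x) (All.map (λ {L} → sound L) (splittings-sound xs))
      where
      sound : ∀ L → concat (map toList L) ≡ xs → All (λ L → concat (map toList L) ≡ x ∷ xs) (extend x L)
      sound []                   refl = refl ∷ []
      sound ((y List⁺.∷ ys) ∷ L) refl = refl ∷ refl ∷ []

    splittings-complete : ∀ L → L ∈ splittings (concat (map toList L))
    splittings-complete []                      = here refl
    splittings-complete ((x List⁺.∷ xs) ∷ L)    = go x xs
      where
      extend-single : ∀ x L → (x List⁺.∷ []) ∷ L ∈ extend x L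
      extend-single x []                   = here refl
      extend-single x ((y List⁺.∷ ys) ∷ L) = here refl
      go : ∀ x xs → (x List⁺.∷ xs) ∷ L ∈ splittings (x ∷ xs ++ concat (map toList L))
      go x []       = ∈-concatMap⁺ (extend x) (Any.map (λ { refl → extend-single x L }) (splittings-complete L))
      go x (y ∷ ys) = ∈-concatMap⁺ (extend x) (Any.map (λ { refl → there (here refl) }) (go y ys))

  module _ (I : CVRPInstance) where

    open CVRPInstance I renaming (customers to n)
    open MinimizationProblem CVRP using (cost; IsMinimum)

    private
      -- The tours of a solution, read one after another, form a permutation of the customers.
      -- Cutting all permutations in all ways thus covers every solution.
      candidates : List (List Tour)
      candidates = concatMap splittings (permutations (allFin n))

      candidates-sound : All (λ L → concat (map toList L) ↭ allFin n) candidates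
      candidates-sound = concatMap-All splittings (All.map (λ {ys} p → All.map (λ e → ↭-trans (↭-reflexive e) p)
          (splittings-sound ys)) (permutations-sound (allFin n)))

      capacity? : ∀ L → Dec (All (λ Q → tourDemand Q ≤ 1ℚ) L)
      capacity? = All.all? (λ Q → tourDemand Q ≤? 1ℚ)

      solutions : ∀ {Ls} → All (λ L → concat (map toList L) ↭ allFin n) Ls → List (CVRPSolution I)
      solutions []             = []
      solutions {L ∷ _} (p ∷ ps) with capacity? L
      ... | yes c = record { tours = L ; partition = p ; capacity = c } ∷ solutions ps
      ... | no  _ = solutions ps

      -- Only the tours are compared: solutions also contain proofs, on which the cost does not
      -- depend.
      solutions-complete : ∀ (O : CVRPSolution I) {Ls} (ps : All (λ L → concat (map toList L) ↭ allFin n) Ls) →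
        CVRPSolution.tours O ∈ Ls → Any (λ S → CVRPSolution.tours S ≡ CVRPSolution.tours O) (solutions ps)
      solutions-complete O {L ∷ _} (p ∷ ps) m with capacity? L
      solutions-complete O (p ∷ ps) (here refl) | yes c = here refl
      solutions-complete O (p ∷ ps) (there m)   | yes c = there (solutions-complete O ps m)
      solutions-complete O (p ∷ ps) (here refl) | no ¬c = contradiction (CVRPSolution.capacity O) ¬c
      solutions-complete O (p ∷ ps) (there m)   | no ¬c = solutions-complete O ps m

      -- A feasible solution is needed as the starting value of `argmin`.
      single-tours : CVRPSolution I
      single-tours = record
        { tours     = map (List⁺._∷ []) (allFin n)
        ; partition = ↭-reflexive (singles (allFin n))
        ; capacity  = Allₚ.map⁺ (All.universal (λ v → ℚₚ.≤-trans (ℚₚ.≤-reflexive (ℚₚ.+-identityʳ (demand v)))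
            (demand≤1 v)) (allFin n)) }
        where
        singles : ∀ (l : List (Fin n)) → concat (map toList (map (List⁺._∷ []) l)) ≡ l
        singles []      = refl
        singles (v ∷ l) = cong (v ∷_) (singles l)

    minimum-exists : ∃[ O ] IsMinimum {I} O
    minimum-exists = O , λ S → lookup-cost S (solutions-complete S candidates-sound
        (∈-concatMap⁺ splittings (Any.map (λ { refl → splittings-complete (CVRPSolution.tours S) })
            (permutations-complete (allFin n) (CVRPSolution.partition S)))))
      where
      ss : List (CVRPSolution I)
      ss = solutions candidates-sound
      O : CVRPSolution I
      O = argmin (λ S → cost {I} S) single-tours ss
      least : All (λ S → cost {I} O ≤ cost {I} S) ss
      least = f[argmin]≤f[xs] single-tours ss
      lookup-cost : ∀ S → Any (λ S′ → CVRPSolution.tours S′ ≡ CVRPSolution.tours S) ss → cost {I} O ≤ cost {I} S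
      lookup-cost S m = go least m
        where
        go : ∀ {l} → All (λ S → cost {I} O ≤ cost {I} S) l → Any (λ S′ → CVRPSolution.tours S′ ≡
            CVRPSolution.tours S) l → cost {I} O ≤ cost {I} S
        go (le ∷ _)   (here e)  = subst (λ L → cost {I} O ≤ sumℚ (map tourCost L)) e le
        go (_ ∷ les)  (there m) = go les m

  module _ (I : CVRPInstance) where

    open Solve I
    open MinimizationProblem using (cost; IsMinimum)

    private
      ratio : ℚ
      ratio = (+ 2 ℚ./ 1) ℚ.* (1ℚ ℚ.- (+ 1 ℚ./ 96))

      regroup : ∀ a r c e → a ℚ.* c ℚ.+ e ℚ.+ r ℚ.* c ≡ (a ℚ.+ r) ℚ.* c ℚ.+ e
      regroup = solve 4 (λ a r c e → a :* c :+ e :+ r :* c := (a :+ r) :* c :+ e) refl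
        where open +-*-Solver

    guarantee : (α : ℝ) → fromℚ 1ℚ <ℝ α → (T : TSPTour tspInstance) (T* : TSPTour tspInstance) → IsMinimum TSP
        {tspInstance} T* →
      fromℚ (cost TSP T) ≤ℝ α *ℝ fromℚ (cost TSP T*) → (O : CVRPSolution I) →
      fromℚ (cost CVRP (solution T)) ≤ℝ (α +ℝ fromℚ (+ 2 ℚ./ 1) *ℝ (fromℚ 1ℚ -ℝ fromℚ (+ 1 ℚ./ 96))) *ℝ fromℚ
          (cost CVRP O)
    -- From this index on, the sequence of α stays above 1 + δ and the estimate for T holds up to e.
    guarantee α (δ , 0<δ , N₁ , above) T T* minimal approx O e 0<e = N₁ ℕ.⊔ proj₁ (approx e 0<e) , λ n le →
        bound n
        (above n (ℕₚ.≤-trans (ℕₚ.m≤m⊔n N₁ _) le)) (proj₂ (approx e 0<e) n (ℕₚ.≤-trans (ℕₚ.m≤n⊔m N₁ _) le))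
      where
      cS cT cO : ℚ
      cS = cost CVRP (solution T)
      cT = cost TSP T
      cO = cost CVRP O
      cS≤ : cS ≤ cT ℚ.+ ratio ℚ.* cO
      cS≤ = ℚₚ.*-cancelˡ-≤-pos ⟪ 48 ⟫ (ℚₚ.≤-trans (solution-cost T O)
          (ℚₚ.≤-reflexive (sym (trans (ℚₚ.*-distribˡ-+ ⟪ 48 ⟫ cT (ratio ℚ.* cO))
        (cong (⟪ 48 ⟫ ℚ.* cT ℚ.+_) (sym (ℚₚ.*-assoc ⟪ 48 ⟫ ratio cO)))))))
      bound : ∀ n → 1ℚ ℚ.+ δ ≤ seq α n → cT ≤ seq α n ℚ.* cost TSP T* ℚ.+ e → cS ≤ (seq α n ℚ.+ ratio) ℚ.* cO
          ℚ.+ e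
      bound n 1+δ≤ cT≤ = ℚₚ.≤-trans cS≤ (ℚₚ.≤-trans (ℚₚ.+-monoˡ-≤ (ratio ℚ.* cO) (ℚₚ.≤-trans cT≤ (ℚₚ.+-monoˡ-≤ e
        (ℚₚ.*-monoˡ-≤-nonNeg (seq α n) {{ℚ.nonNegative 0≤α}} (ℚₚ.≤-trans (minimal (joined O))
            (joined-cost O))))))
        (ℚₚ.≤-reflexive (regroup (seq α n) ratio cO e)))
        where
        -- The inequality between T* and O is multiplied by the terms of α, which 1 < α makes
        -- nonnegative from that index on.
        0≤α : 0ℚ ≤ seq α n
        0≤α = ℚₚ.≤-trans (ℚₚ.+-mono-≤ {0ℚ} {1ℚ} {0ℚ} {δ} (ℚₚ.<⇒≤ (ℚₚ.positive⁻¹ 1ℚ)) (ℚₚ.<⇒≤ 0<δ)) 1+δ≤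

-- Polynomial-time access to instances and tours.

module PolyInstance where

  open StackMachine
  open PolyTime
  open PolyLists
  open PolyArithmetic
  open PolyWords
  open PolyRouting
  open Routing
  open Splitting
  open ScaledInstance
  open Approximation
  open import Data.Fin.Properties using (toℕ<n)
  open import Data.List.Relation.Unary.All as All using (All; []; _∷_)
  import Data.List.Relation.Unary.All.Properties as Allₚ
  open import Data.Nat using (ℕ; zero; suc; _+_; _*_; _≤_; z≤n; s≤s; _≡ᵇ_; pred)
  open import Data.Nat.Properties

  open MinimizationProblem using (encodeInstance; encodeSolution)
  open CVRPInstance using (customers)

  word-flat : ∀ qs → word (flat (map frac qs)) ≡ concatMap encodeℚ qs
  word-flat []       = refl
  word-flat (q ∷ qs) = trans (sym (++-assoc (encodeℕ (proj₁ (frac q))) (encodeℕ (proj₂ (frac q)))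
      (word (flat (map frac qs))))) (cong (encodeℚ q ++_) (word-flat qs))

  private
    concatMap² : ∀ {A B C : Set} (f : B → List C) (g : A → A → B) k l →
      concatMap f (concatMap (λ i → map (g i) l) k) ≡ concatMap (λ i → concatMap (λ j → f (g i j)) l) k
    concatMap² f g []      l = refl
    concatMap² f g (i ∷ k) l = trans (concatMap-++ f (map (g i) l) _) (cong₂ _++_ (concatMap-map f (g i) l)
        (concatMap² f g k l))

    length-concatMap : ∀ {A B : Set} (g : A → A → B) k l → length (concatMap (λ i → map (g i) l) k) ≡ length k *
        length l
    length-concatMap g []      l = refl
    length-concatMap g (i ∷ k) l = trans (length-++ (map (g i) l)) (cong₂ _+_ (length-map (g i) l)
        (length-concatMap g k l))

    replicate-* : ∀ k m → concatMap (λ _ → replicate m tt) (replicate k tt) ≡ replicate (k * m) tt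
    replicate-* zero    m = refl
    replicate-* (suc k) m = trans (cong (replicate m tt ++_) (replicate-* k m)) (++-replicate m)

      where
      ++-replicate : ∀ i → replicate i tt ++ replicate (k * m) tt ≡ replicate (i + k * m) tt
      ++-replicate zero    = refl
      ++-replicate (suc i) = cong (tt ∷_) (++-replicate i)

    length-allFin : ∀ m → length (allFin m) ≡ m
    length-allFin m = length-tabulate {n = m} (λ i → i)

    length-flat : ∀ ps → length ps ≤ length (flat ps)
    length-flat []       = z≤n
    length-flat (p ∷ ps) = s≤s (≤-trans (length-flat ps) (n≤1+n _))

  module _ (I : CVRPInstance) where

    open CVRPInstance I using (dist; demand)
    open Scaled I

    private
      n = customers I

    numbers : List ℕ
    numbers = n ∷ flat (map frac (distances ++ demands))

    matrix-word : concatMap encodeℚ distances ≡ encodeMatrix (suc n) dist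
    matrix-word = concatMap² encodeℚ dist (allFin (suc n)) (allFin (suc n))

    instance-word : encodeInstance CVRP I ≡ word numbers
    instance-word = cong (encodeℕ n ++_) (sym (trans (word-flat (distances ++ demands))
        (trans (concatMap-++ encodeℚ distances demands)
      (cong₂ _++_ matrix-word (concatMap-map encodeℚ demand (allFin n))))))

    tsp-word : word (suc n ∷ flat (map frac distances)) ≡ encodeInstance TSP (Solve.tspInstance I)
    tsp-word = cong (encodeℕ (suc n) ++_) (trans (word-flat distances) matrix-word)

    length-distances : length distances ≡ suc n * suc n
    length-distances = trans (length-concatMap dist (allFin (suc n)) (allFin (suc n)))
        (cong₂ _*_ (length-allFin (suc n)) (length-allFin (suc n)))

    -- The demands alone supply n entries, so `climb` obtains n in unary along the list of numbers.
    n≤numbers : n ≤ length numbers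
    n≤numbers = ≤-trans (≤-trans (≤-reflexive (sym (trans (length-map demand (allFin n)) (length-allFin n))))
      (≤-trans (m≤n+m (length demands) (length distances))
          (≤-reflexive (sym (trans (length-map frac (distances ++ demands)) (length-++ distances))))))
      (≤-trans (length-flat (map frac (distances ++ demands))) (n≤1+n _))

    row : Fin (suc n) → List ℕ
    row i = map (c i) (allFin (suc n))

    rows : List (List ℕ)
    rows = map row (allFin (suc n))

    scaled-distances : map (scaled D) distances ≡ concat rows
    scaled-distances = go (allFin (suc n))
      where
      go : ∀ k → map (scaled D) (concatMap (λ i → map (dist i) (allFin (suc n))) k) ≡ concat (map row k)
      go []      = refl
      go (i ∷ k) = trans (map-++ (scaled D) (map (dist i) (allFin (suc n))) _)
          (cong₂ _++_ (sym (map-∘ (allFin (suc n)))) (go k))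

    vertexDemand : Fin (suc n) → ℕ
    vertexDemand zero    = 0
    vertexDemand (suc v) = dem v

    vertexDemands : 0 ∷ map (scaled cap) demands ≡ map vertexDemand (allFin (suc n))
    vertexDemands = cong (0 ∷_) (trans (sym (map-∘ (allFin n))) (trans (map-tabulate (λ i → i) dem)
        (sym (map-tabulate suc vertexDemand))))

    -- The routing functions receive points but not the instance, so each vertex carries the data
    -- they ask for. The customer number is what the output needs.
    entry : Fin (suc n) → ℕ × (ℕ × (ℕ × (ℕ × List ℕ)))
    entry v = toℕ v , (pred (toℕ v) , (vertexDemand v , (cap , row v)))

  -- A vertex is represented by its number, the number of the customer, the demand, the capacity
  -- and the distances to all vertices.
  𝔼 𝕂 𝕍 𝕏 𝕀 𝕋 : Code CVRPInstance
  𝔼 = ℕ₂ ⊠ (ℕ₂ ⊠ (ℕ₂ ⊠ (ℕ₂ ⊠ 𝕃 ℕ₂)))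
  𝕂   = record { Car = λ I → Fin (suc (customers I)) ; enc = λ {I} v → enc ℕ₂ {I} (toℕ v) }
  𝕍   = record { Car = λ I → Fin (suc (customers I)) ; enc = λ {I} v → enc 𝔼 {I} (entry I v) }
  𝕏   = record { Car = λ I → Fin (customers I) ; enc = λ {I} v → enc 𝕍 {I} (suc v) }
  𝕀   = record { Car = λ _ → ⊤ ; enc = λ {I} _ → enc 𝕎 {I} (encodeInstance CVRP I) }
  𝕋   = record { Car = λ I → TSPTour (Solve.tspInstance I) ; enc = λ {I} T → enc 𝕎 {I}
      (encodeSolution TSP {Solve.tspInstance I} T) }

  private
    variable
      Γ : Code CVRPInstance

  abstract
    numbersOfP : Poly 𝕀 (𝕃 ℕ₂) (λ I _ → numbers I)
    numbersOfP = numbersP (retype idP (λ I _ → cong (enc 𝕎 {I}) (instance-word I)))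

    sizeP : Poly 𝕀 ℕ₂ (λ I _ → customers I)
    sizeP = caseP numbersOfP (numP 0) v1

    fractionsP : Poly 𝕀 (𝕃 (ℕ₂ ⊠ ℕ₂)) (λ I _ → map frac (Scaled.distances I ++ Scaled.demands I))
    fractionsP = unflatP (tailP numbersOfP)

    unarySizeP : Poly 𝕀 (𝕃 𝟙) (λ I _ → replicate (suc (customers I)) tt)
    unarySizeP = ext (λ I _ → cong (λ s → tt ∷ proj₂ s) (climb-reaches (customers I) (numbers I) (n≤numbers I)))
      (consP unitP (sndP ∘P climbP sizeP numbersOfP))

    partsP : Poly 𝕀 (𝕃 (ℕ₂ ⊠ ℕ₂) ⊠ 𝕃 (ℕ₂ ⊠ ℕ₂)) (λ I _ → reverse (map frac (Scaled.distances I)) , map frac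
        (Scaled.demands I))
    -- The distances are the first (n + 1)² fractions; this count arises in unary by concatenating n
    -- + 1 copies of n + 1.
    partsP = ext eq (chopP (concatMapP unarySizeP (unarySizeP ∘P fstP)) fractionsP)
      where
      eq : ∀ I (_ : ⊤) → chop (concatMap (λ _ → replicate (suc (customers I)) tt)
          (replicate (suc (customers I)) tt)) (map frac (Scaled.distances I ++ Scaled.demands I)) ≡
        (reverse (map frac (Scaled.distances I)) , map frac (Scaled.demands I))
      eq I _ = trans (cong₂ chop
          (trans (replicate-* (suc (customers I)) (suc (customers I)))
              (cong (λ k → replicate k tt) (trans (sym (length-distances I))
              (sym (length-map frac (Scaled.distances I))))))
          (map-++ frac (Scaled.distances I) (Scaled.demands I)))
        (chop-++ (map frac (Scaled.distances I)) (map frac (Scaled.demands I)))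

    distanceFractionsP : Poly 𝕀 (𝕃 (ℕ₂ ⊠ ℕ₂)) (λ I _ → map frac (Scaled.distances I))
    distanceFractionsP = ext (λ I _ → reverse-involutive _) (reverseP (fstP ∘P partsP))

    tspWordP : Poly 𝕀 𝕎 (λ I _ → encodeInstance TSP (Solve.tspInstance I))
    tspWordP = ext (λ I _ → tsp-word I) (wordP (consP (+P (numP 1) sizeP) (flatP distanceFractionsP)))

    rowsP : Poly 𝕀 (𝕃 (𝕃 ℕ₂)) (λ I _ → rows I)
    rowsP = ext eq (chunksP unarySizeP unarySizeP (ext
        (λ I _ → trans (cong proj₁ (scale-frac (Scaled.distances I))) (scaled-distances I))
        (fstP ∘P scaleP distanceFractionsP)))
      where
      eq : ∀ I (_ : ⊤) → chunks (replicate (suc (customers I)) tt) (replicate (suc (customers I)) tt)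
          (concat (rows I)) ≡ rows I
      eq I _ = trans (cong (λ k → chunks (replicate (suc (customers I)) tt) (replicate k tt) (concat (rows I)))
          (sym (trans (length-map (row I) (allFin (suc (customers I)))) (length-allFin (suc (customers I))))))
        (chunks-concat (suc (customers I)) (rows I) (Allₚ.map⁺
            (All.universal (λ i → trans (length-map (Scaled.c I i) (allFin (suc (customers I))))
            (length-allFin (suc (customers I)))) (allFin (suc (customers I))))))

    demandsP : Poly 𝕀 (𝕃 ℕ₂ ⊠ ℕ₂) (λ I _ → map (vertexDemand I) (allFin (suc (customers I))) , Scaled.cap I)
    demandsP = ext (λ I _ → cong₂ _,_ (trans (cong (λ s → 0 ∷ proj₁ s) (scale-frac (Scaled.demands I)))
        (vertexDemands I)) (cong proj₂ (scale-frac (Scaled.demands I))))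
      (letP (scaleP (sndP ∘P partsP)) ⟨ consP (numP 0) (fstP ∘P v0) , sndP ∘P v0 ⟩P)

    keysP : Poly 𝕋 (𝕃 𝕂) (λ I T → TSPTour.order T)
    keysP = retype {f = λ I T → map toℕ (TSPTour.order T)}
      (numbersP (retype idP (λ I T → cong (enc 𝕎 {I}) (sym (concatMap-map encodeℕ toℕ (TSPTour.order T))))))
      (λ I T → encList-map (enc ℕ₂ {I}) toℕ (TSPTour.order T))

    entryP : (k : ∀ I → Car Γ I → Fin (suc (customers I))) → Poly Γ 𝕀 (λ _ _ → tt) → Poly Γ ℕ₂
        (λ I γ → toℕ (k I γ)) → Poly Γ 𝔼 (λ I γ → entry I (k I γ))
    entryP {Γ} k P N = ext (λ I γ → cong (toℕ (k I γ) ,_) (cong₂ _,_ (pred≡ I γ)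
        (cong₂ _,_ (nth-allFin 0 (vertexDemand I) (k I γ))
            (cong (Scaled.cap I ,_) (nth-allFin [] (row I) (k I γ))))))
      -- The predecessor is formed in unary, by dropping one element.
      ⟨ N , ⟨ lengthP (tailP (sndP ∘P climbP N (unarySizeP ∘P P)))
          , ⟨ nthP (numP 0) N (fstP ∘P demandsP ∘P P) , ⟨ sndP ∘P demandsP ∘P P , nthP nilP N (rowsP ∘P P) ⟩P ⟩P
              ⟩P ⟩P
      where
      pred≡ : ∀ I γ → length (tail (proj₂ (climb (toℕ (k I γ)) (replicate (suc (customers I)) tt)))) ≡ pred
          (toℕ (k I γ))
      pred≡ I γ = trans (cong (λ s → length (tail (proj₂ s)))
          (climb-reaches (toℕ (k I γ)) (replicate (suc (customers I)) tt)
          (≤-trans (<⇒≤ (toℕ<n (k I γ))) (≤-reflexive (sym (length-replicate (suc (customers I)) {tt}))))))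
        (length-tail (toℕ (k I γ)))
        where
        length-tail : ∀ m → length (tail (replicate m tt)) ≡ pred m
        length-tail zero    = refl
        length-tail (suc m) = length-replicate m

    orderP : Poly (𝕋 ⊠ 𝕀) (𝕃 𝕍) (λ I γ → TSPTour.order (proj₁ γ))
    orderP = retype (mapP (keysP ∘P fstP) (entryP (λ I γ → proj₂ γ) (sndP ∘P fstP) (retype v0 (λ _ _ → refl))))
      (λ I γ → encList-map (enc 𝔼 {I}) (entry I) (TSPTour.order (proj₁ γ)))

    vertexEntryP : Poly 𝕍 𝔼 (λ I → entry I)
    vertexEntryP = recode (λ _ _ → refl)

    -- A customer has the same code as its vertex, so only the type changes; the depot is recognized
    -- by its number 0.
    asCustomerP : Poly 𝕍 (𝕃 𝕏) (λ _ → asCustomer)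
    asCustomerP = retype (ifP (≡P (fstP ∘P vertexEntryP) (numP 0)) nilP (consP idP nilP)) same
      where
      same : ∀ I (v : Fin (suc (customers I))) → enc (𝕃 𝕍) {I} (if toℕ v ≡ᵇ 0 then [] else [ v ]) ≡ enc (𝕃 𝕏)
          {I} (asCustomer v)
      same I zero    = refl
      same I (suc v) = refl

    rotateP : ∀ {l} → Poly Γ (𝕃 𝕍) l → Poly Γ (𝕃 𝕏) (λ I γ → rotate (l I γ))
    rotateP {Γ} {l} L = reverseP (letP (foldP⁺ {S = 𝕃 𝕏 ⊠ 𝕃 𝕏} {st = λ I γ → rotate-step (proj₂ γ)
        (proj₂ (proj₁ γ))} L ⟨ nilP , nilP ⟩P
        (caseP (asCustomerP ∘P v1) ⟨ sndP ∘P v0 , nilP ⟩P ⟨ fstP ∘P v2 , consP v1 (sndP ∘P v2) ⟩P)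
        (K 1 ⊕ X) (λ I γ v s → grows I (sz Γ γ) v s)) (++P (fstP ∘P v0) (sndP ∘P v0)))
      where
      grows : ∀ I g v (s : List (Fin (customers I)) × List (Fin (customers I))) → sz (𝕃 𝕏 ⊠ 𝕃 𝕏) {I}
          (rotate-step s v) ≤ sz (𝕃 𝕏 ⊠ 𝕃 𝕏) {I} s + suc (g + sz 𝕍 {I} v)
      grows I g zero (p , a) = s≤s (≤-trans (≤-reflexive (+-comm (sz (𝕃 𝕏) {I} a) 1))
          (≤-trans (+-monoˡ-≤ (sz (𝕃 𝕏) {I} a) (1≤sz (𝕃 𝕏) {I} p)) (m≤m+n _ _)))
      grows I g (suc v) (p , a) = s≤s (≤-trans (≤-reflexive (move (sz (𝕃 𝕏) {I} p) (sz (𝕃 𝕏) {I} a)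
          (sz 𝕏 {I} v)))
        (+-monoʳ-≤ (sz (𝕃 𝕏) {I} p + sz (𝕃 𝕏) {I} a) (s≤s (m≤n+m _ g))))
        where
        move : ∀ p a x → p + suc (x + a) ≡ p + a + suc x
        move p a x = trans (cong (λ z → p + suc z) (+-comm x a)) (trans (cong (p +_) (sym (+-suc a x)))
            (sym (+-assoc p a (suc x))))

    customerEntryP : Poly 𝕏 𝔼 (λ I v → entry I (suc v))
    customerEntryP = recode (λ _ _ → refl)

    distanceP : Poly (𝕏 ⊠ 𝕏) ℕ₂ (λ I p → Scaled.d I (proj₁ p) (proj₂ p))
    distanceP = ext (λ I p → nth-allFin 0 (Scaled.c I (suc (proj₁ p))) (suc (proj₂ p)))
      (nthP (numP 0) (fstP ∘P customerEntryP ∘P sndP) (sndP ∘P sndP ∘P sndP ∘P sndP ∘P customerEntryP ∘P fstP))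

    -- By symmetry the distance can be read from the row that the customer carries.
    depotDistanceP : Poly 𝕏 ℕ₂ (λ I → Scaled.w I)
    depotDistanceP = ext (λ I v → trans (nth-allFin 0 (Scaled.c I (suc v)) zero) (Scaled.c-sym I (suc v) zero))
      (nthP (numP 0) (numP 0) (sndP ∘P sndP ∘P sndP ∘P sndP ∘P customerEntryP))

    demandP : Poly 𝕏 ℕ₂ (λ I → Scaled.dem I)
    demandP = fstP ∘P sndP ∘P sndP ∘P customerEntryP

    capacityP : Poly 𝕏 ℕ₂ (λ I _ → Scaled.cap I)
    capacityP = fstP ∘P sndP ∘P sndP ∘P sndP ∘P customerEntryP

  private
    partitions-shape : ∀ I xs → let L = proj₁ (Algorithm.partitions (Scaled.w I) (Scaled.d I) (Scaled.dem I) (Scaled.cap I) xs) in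
      concat L ≡ xs × All (_≢ []) L
    partitions-shape I xs = proj₁ correct , All.map (λ t → Scaled.nonempty⇒≢[] I (proj₁ t)) (proj₂ correct)
      where
      correct = Scaled.partitions-correct I xs (All.universal (Scaled.dem≤cap I) xs)

  open PolyRouting.PolyRouting 𝕏 (λ I → Scaled.w I) (λ I → Scaled.d I) (λ I → Scaled.dem I) (λ I → Scaled.cap I)
    depotDistanceP distanceP demandP capacityP partitions-shape using (solveP)

  abstract
    solutionWordP : Poly (𝕋 ⊠ 𝕀) 𝕎 (λ I γ → encodeSolution CVRP (Solve.solution I (proj₁ γ)))
    solutionWordP = ext eq (concatMapP (solveP ∘P rotateP orderP)
        (++P (wordP (mapP v0 (fstP ∘P sndP ∘P customerEntryP ∘P v0))) (consP (symbolP semicolon) nilP)))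
      where
      eq : ∀ I (γ : Car (𝕋 ⊠ 𝕀) I) → concatMap (λ Q → word (map toℕ Q) ++ [ semicolon ])
          (Scaled.solve I (rotate (TSPTour.order (proj₁ γ)))) ≡
        encodeSolution CVRP (Solve.solution I (proj₁ γ))
      eq I (T , _) = trans (cong (concatMap (λ Q → word (map toℕ Q) ++ [ semicolon ]))
          (sym (Solve.solution-tours I T)))
        (trans (concatMap-map _ toList (CVRPSolution.tours (Solve.solution I T)))
          (concatMap-cong (λ Q → cong (_++ [ semicolon ]) (concatMap-map encodeℕ toℕ (toList Q)))
              (CVRPSolution.tours (Solve.solution I T))))
        where open import Data.List.Properties using (concatMap-cong)

-- Calling the given algorithm as a subroutine.

module Subroutine where

  open StackMachine
  open PolyTime
  open PolyLists
  open PolyWords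
  open import Data.Nat using (ℕ; zero; suc; _+_; _*_; _^_; _≤_; s≤s)
  open import Data.Nat.Properties
  open import Data.Vec as Vec using ([]; _∷_; lookup; updateAt)

  rename : ∀ {j k} → (Fin j → Fin k) → Command j → Command k
  rename ρ skip          = skip
  rename ρ (push i a)    = push (ρ i) a
  rename ρ (pop i)       = pop (ρ i)
  rename ρ (p ⨾ q)       = rename ρ p ⨾ rename ρ q
  rename ρ (if i b p q)  = if (ρ i) b (rename ρ p) (rename ρ q)
  rename ρ (while i b p) = while (ρ i) b (rename ρ p)

  module _ {j k} (ρ : Fin j → Fin k) (F : Store j → Store k)
    (lookup-F : ∀ σ i → lookup (F σ) (ρ i) ≡ lookup σ i)
    (update-F : ∀ σ i f → updateAt (F σ) (ρ i) f ≡ F (updateAt σ i f)) where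

    private
      top-F : ∀ {b} (c : Test) σ i → c (top σ i) ≡ b → c (top (F σ) (ρ i)) ≡ b
      top-F c σ i e = trans (cong (λ u → c (Data.List.head u)) (lookup-F σ i)) e

    -- The embedding F of stores is kept abstract in order to cover both the addition of stacks
    -- behind the working stacks and in front of those of P.
    rename-⇓ : ∀ {p σ τ t} → ⟨ p , σ ⟩⇓ τ in[ t ] → ⟨ rename ρ p , F σ ⟩⇓ F τ in[ t ]
    rename-⇓ ⇓skip = ⇓skip
    rename-⇓ {σ = σ} (⇓push {i = i} {a}) = subst (λ τ → ⟨ push (ρ i) a , F σ ⟩⇓ τ in[ 1 ]) (update-F σ i (a ∷_))
        ⇓push
    rename-⇓ {σ = σ} (⇓pop {i = i}) = subst (λ τ → ⟨ pop (ρ i) , F σ ⟩⇓ τ in[ 1 ])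
        (update-F σ i (Data.List.drop 1)) ⇓pop
    rename-⇓ (⇓seq r s) = ⇓seq (rename-⇓ r) (rename-⇓ s)
    rename-⇓ {σ = σ} (⇓then {i = i} {b} e r) = ⇓then (top-F b σ i e) (rename-⇓ r)
    rename-⇓ {σ = σ} (⇓else {i = i} {b} e r) = ⇓else (top-F b σ i e) (rename-⇓ r)
    rename-⇓ {σ = σ} (⇓loop {i = i} {b} e r s) = ⇓loop (top-F b σ i e) (rename-⇓ r) (rename-⇓ s)
    rename-⇓ {σ = σ} (⇓exit {i = i} {b} e) = ⇓exit (top-F b σ i e)

    rename-run : ∀ {p σ τ b} → Run p σ τ b → Run (rename ρ p) (F σ) (F τ) b
    rename-run (t , r , t≤) = t , rename-⇓ r , t≤

  wordTree : Word → Tree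
  wordTree = encList symbolTree

  size-wordTree : ∀ u → size (wordTree u) ≡ 1 + length u * 12
  size-wordTree []              = refl
  size-wordTree (bit0 ∷ u)      = cong (12 +_) (size-wordTree u)
  size-wordTree (bit1 ∷ u)      = cong (12 +_) (size-wordTree u)
  size-wordTree (comma ∷ u)     = cong (12 +_) (size-wordTree u)
  size-wordTree (semicolon ∷ u) = cong (12 +_) (size-wordTree u)

  length≤size : ∀ u → length u ≤ size (wordTree u)
  length≤size u = ≤-trans (m≤m*n (length u) 12) (≤-trans (n≤1+n _) (≤-reflexive (sym (size-wordTree u))))

  -- Conversions between the content of stack 1, reversed, and the code of a word on stack 0.

  load-loop load : Command 3
  load-loop = while #1 nonEmpty (by-symbol #1 λ a → pop #1 ⨾ (pushTree (symbolTree a) ⨾ push #0 bit1))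
  load      = push #0 bit0 ⨾ load-loop

  load-loop-run : ∀ r {w u} → Run load-loop (St (wordTree w ◂ u) r []) (St (wordTree (r ʳ++ w) ◂ u) [] [])
      (length r * 17 + 1)
  load-loop-run []              = exit-run refl
  load-loop-run (bit1 ∷ r)      = within (≤-trans (+-monoˡ-≤ _ (m≤m+n 15 2))
      (≤-reflexive (sym (+-assoc 17 (length r * 17) 1))))
    (loop-run refl (then-run refl (pop-run ⨾ʳ pushTree-run (symbolTree bit1) ⨾ʳ push-run)) (load-loop-run r))
  load-loop-run (bit0 ∷ r)      = within (≤-trans (+-monoˡ-≤ _ (m≤m+n 16 1))
      (≤-reflexive (sym (+-assoc 17 (length r * 17) 1))))
    (loop-run refl (else-run refl (then-run refl (pop-run ⨾ʳ pushTree-run (symbolTree bit0) ⨾ʳ push-run)))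
        (load-loop-run r))
  load-loop-run (comma ∷ r)     = within (≤-reflexive (sym (+-assoc 17 (length r * 17) 1)))
    (loop-run refl (else-run refl (else-run refl (then-run refl (pop-run ⨾ʳ pushTree-run (symbolTree comma) ⨾ʳ
        push-run)))) (load-loop-run r))
  load-loop-run (semicolon ∷ r) = within (≤-reflexive (sym (+-assoc 17 (length r * 17) 1)))
    (loop-run refl (else-run refl (else-run refl (else-run refl (pop-run ⨾ʳ pushTree-run (symbolTree semicolon)
        ⨾ʳ push-run)))) (load-loop-run r))

  private
    ʳ++-involutive : ∀ (u : Word) → (u ʳ++ []) ʳ++ [] ≡ u
    ʳ++-involutive u = trans (trans (ʳ++-defn (u ʳ++ [])) (++-identityʳ _))
      (trans (cong reverse (trans (ʳ++-defn u) (++-identityʳ _))) (reverse-involutive u))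

    length-ʳ++ : ∀ (u : Word) → length (u ʳ++ []) ≡ length u
    length-ʳ++ u = trans (cong length (trans (ʳ++-defn u) (++-identityʳ _))) (length-reverse u)

  load-run : ∀ w {u} → Run load (St u (w ʳ++ []) []) (St (wordTree w ◂ u) [] []) (2 + length w * 17)
  load-run w {u} = subst₂ (λ x n → Run load (St u (w ʳ++ []) []) (St (wordTree x ◂ u) [] []) n)
      (ʳ++-involutive w)
    (cong suc (trans (+-comm _ 1) (cong (λ n → suc (n * 17)) (length-ʳ++ w))))
    (push-run ⨾ʳ load-loop-run (w ʳ++ []))

  pop₄ : Command 3
  pop₄ = pop #0 ⨾ (pop #0 ⨾ (pop #0 ⨾ pop #0))

  readBit : Command 3 → Command 3 → Command 3
  readBit p q = pop #0 ⨾ if #0 is1 (pop₄ ⨾ p) (pop₄ ⨾ q)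

  readBit-run : ∀ {p q u v σ n} b → Run (if b then p else q) (St u v []) σ n → Run (readBit p q)
      (St (bitTree b ◂ u) v []) σ (6 + n)
  readBit-run true  r = pop-run ⨾ʳ then-run refl ((pop-run ⨾ʳ pop-run ⨾ʳ pop-run ⨾ʳ pop-run) ⨾ʳ r)
  readBit-run false r = pop-run ⨾ʳ else-run refl ((pop-run ⨾ʳ pop-run ⨾ʳ pop-run ⨾ʳ pop-run) ⨾ʳ r)

  readSymbol unload : Command 3
  readSymbol = pop #0 ⨾ (pop #0 ⨾ readBit (readBit (push #1 semicolon) (push #1 comma))
      (readBit (push #1 bit1) (push #1 bit0)))
  unload     = while #0 is1 readSymbol ⨾ pop #0

  readSymbol-run : ∀ a {t u v} → Run readSymbol (St (node (symbolTree a) t ◂ u) v []) (St (t ◂ u) (a ∷ v) []) 15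
  readSymbol-run bit0      = pop-run ⨾ʳ pop-run ⨾ʳ readBit-run false (readBit-run false push-run)
  readSymbol-run bit1      = pop-run ⨾ʳ pop-run ⨾ʳ readBit-run false (readBit-run true push-run)
  readSymbol-run comma     = pop-run ⨾ʳ pop-run ⨾ʳ readBit-run true (readBit-run false push-run)
  readSymbol-run semicolon = pop-run ⨾ʳ pop-run ⨾ʳ readBit-run true (readBit-run true push-run)

  unload-run : ∀ w {u} → Run unload (St (wordTree w ◂ u) [] []) (St u (w ʳ++ []) []) (2 + length w * 16)
  unload-run w {u} = within (≤-reflexive (cong suc (+-comm _ 1))) (go w [])
    where
    loop-time : ∀ w r → Run (while #0 is1 readSymbol) (St (wordTree w ◂ u) r []) (St (leaf ◂ u) (w ʳ++ r) [])
        (1 + length w * 16)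
    loop-time []      r = exit-run refl
    loop-time (a ∷ w) r = within (≤-reflexive (+-suc 16 (length w * 16))) (loop-run refl (readSymbol-run a)
        (loop-time w (a ∷ r)))
    go : ∀ w r → Run unload (St (wordTree w ◂ u) r []) (St u (w ʳ++ r) []) (1 + length w * 16 + 1)
    go w r = loop-time w r ⨾ʳ pop-run

  module _ {k} (i j : Fin k) (S : Word → Word → Store k)
    (topS  : ∀ u v → lookup (S u v) i ≡ u)
    (popS  : ∀ a u v → updateAt (S (a ∷ u) v) i (Data.List.drop 1) ≡ S u v)
    (pushS : ∀ a u v → updateAt (S u v) j (a ∷_) ≡ S u (a ∷ v)) where

    open Pour i j nonEmpty S topS popS pushS

    pour-word : ∀ u {v} → Run (pour i j nonEmpty) (S u v) (S [] (u ʳ++ v)) (1 + length u * 6)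
    pour-word []      = stop refl
    pour-word (a ∷ u) = within (≤-reflexive (+-suc 6 (length u * 6))) (step refl (pour-word u))

  -- A polynomial-time reduction to a problem solved by the program P: P runs on its own stacks,
  -- next to the three working stacks.
  module Reduction {Ix : Set} (input query : Ix → Word) (Answer : Ix → Set)
    (answer : ∀ {ι} → Answer ι → Word) (output : ∀ ι → Answer ι → Word) where

    𝕀ₙ 𝔸ₙ : Code Ix
    𝕀ₙ = record { Car = λ _ → ⊤ ; enc = λ {ι} _ → wordTree (input ι) }
    𝔸ₙ = record { Car = Answer ; enc = λ a → wordTree (answer a) }

    module _ (pre : Poly 𝕀ₙ 𝕎 (λ ι _ → query ι)) (post : Poly (𝔸ₙ ⊠ 𝕀ₙ) 𝕎 (λ ι γ → output ι (proj₁ γ)))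
      (P : Program) (c k : ℕ) where

      open Program P renaming (extraStacks to e; body to p)

      private
        -- Pairing the query with the input preserves the input, whose code stays on stack 0 while P
        -- runs and is read by `post` afterwards.
        ask : Poly 𝕀ₙ (𝕎 ⊠ 𝕀ₙ) (λ ι x → query ι , x)
        ask = ⟨ pre , idP ⟩P

        left : Command 3 → Command (3 + suc e)
        left = rename (_↑ˡ suc e)

        Full : Word → Word → Store (suc e) → Store (3 + suc e)
        Full u v ρ = u ∷ v ∷ [] ∷ ρ

        #3 : Fin (3 + suc e)
        #3 = suc (suc (suc zero))

      -- Pouring reverses a word, and `load` and `unload` expect or leave reversed words on stack 1,
      -- so all words arrive in the right order. `pop #0` strips the pair `ask` returns, and
      -- `push #0 bit1` pairs the answer with the input.
      program′ : Program
      program′ = record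
        { extraStacks = 2 + suc e
        ; body = left (pour #0 #1 nonEmpty ⨾ (load ⨾ (prog ask ⨾ (pop #0 ⨾ unload)))) ⨾
                 (pour (suc zero) #3 nonEmpty ⨾
                 (rename (3 ↑ʳ_) p ⨾
                 (pour #3 (suc zero) nonEmpty ⨾
                 left (load ⨾ (push #0 bit1 ⨾ (prog post ⨾ (unload ⨾ pour #1 #0 nonEmpty))))))) }

      private
        left-run : ∀ {q u v u′ v′ b} ρ → Run q (St u v []) (St u′ v′ []) b → Run (left q) (Full u v ρ)
            (Full u′ v′ ρ) b
        left-run ρ = rename-run (_↑ˡ suc e) extend look upd
          where
          extend : Store 3 → Store (3 + suc e)
          extend (u ∷ v ∷ w ∷ []) = u ∷ v ∷ w ∷ ρ
          look : ∀ σ i → lookup (extend σ) (i ↑ˡ suc e) ≡ lookup σ i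
          look (u ∷ v ∷ w ∷ []) zero             = refl
          look (u ∷ v ∷ w ∷ []) (suc zero)       = refl
          look (u ∷ v ∷ w ∷ []) (suc (suc zero)) = refl
          upd : ∀ σ i f → updateAt (extend σ) (i ↑ˡ suc e) f ≡ extend (updateAt σ i f)
          upd (u ∷ v ∷ w ∷ []) zero             f = refl
          upd (u ∷ v ∷ w ∷ []) (suc zero)       f = refl
          upd (u ∷ v ∷ w ∷ []) (suc (suc zero)) f = refl

        I A B V N O : Bound
        I = K 1 ⊕ X ⊗ K 12
        A = growth ask ⊙ I
        B = K c ⊗ power k ⊙ (K 1 ⊕ A)
        V = A ⊕ B
        N = K 1 ⊕ ((K 1 ⊕ V ⊗ K 12) ⊕ I)
        O = growth post ⊙ N

        time : Bound
        time = ((K 1 ⊕ X ⊗ K 6) ⊕ ((K 2 ⊕ X ⊗ K 17) ⊕ (bound ask ⊙ I ⊕ (K 1 ⊕ (K 2 ⊕ A ⊗ K 16))))) ⊕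
               ((K 1 ⊕ A ⊗ K 6) ⊕ (B ⊕ ((K 1 ⊕ V ⊗ K 6) ⊕
               ((K 2 ⊕ V ⊗ K 17) ⊕ (K 1 ⊕ (bound post ⊙ N ⊕ ((K 2 ⊕ O ⊗ K 16) ⊕ (K 1 ⊕ O ⊗ K 6))))))))

        first : ∀ ι ρ → let n = length (input ι) in
          Run (left (pour #0 #1 nonEmpty ⨾ (load ⨾ (prog ask ⨾ (pop #0 ⨾ unload))))) (Full (input ι) [] ρ)
              (Full (wordTree (input ι) ◂ []) (query ι ʳ++ []) ρ)
              (⟦ (K 1 ⊕ X ⊗ K 6) ⊕ ((K 2 ⊕ X ⊗ K 17) ⊕ (bound ask ⊙ I ⊕ (K 1 ⊕ (K 2 ⊕ A ⊗ K 16)))) ⟧ n) × length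
                  (query ι) ≤ ⟦ A ⟧ n
        first ι ρ = left-run ρ
             (pour-word #0 #1 (λ u v → St u v []) (λ _ _ → refl) (λ _ _ _ → refl) (λ _ _ _ → refl) (input ι)
          ⨾ʳ load-run (input ι)
          ⨾ʳ within (mono (bound ask) (≤-reflexive (size-wordTree (input ι)))) (run ask ι tt [] [])
          ⨾ʳ pop-run
          ⨾ʳ within (+-monoʳ-≤ 2 (*-monoˡ-≤ 16 q≤)) (unload-run (query ι))) , q≤
          where
          q≤ : length (query ι) ≤ ⟦ A ⟧ (length (input ι))
          q≤ = ≤-trans (length≤size (query ι)) (≤-trans (≤-trans (m≤m+n _ _) (n≤1+n _))
              (≤-trans (out-size ask ι tt)
            (mono (growth ask) (≤-reflexive (size-wordTree (input ι))))))

        last : ∀ ι a ρ n → length (answer a) ≤ ⟦ V ⟧ n → length (input ι) ≤ n →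
          Run (left (load ⨾ (push #0 bit1 ⨾ (prog post ⨾ (unload ⨾ pour #1 #0 nonEmpty)))))
              (Full (wordTree (input ι) ◂ []) (answer {ι} a ʳ++ []) ρ) (Full (output ι a) [] ρ)
              (⟦ (K 2 ⊕ V ⊗ K 17) ⊕ (K 1 ⊕ (bound post ⊙ N ⊕ ((K 2 ⊕ O ⊗ K 16) ⊕ (K 1 ⊕ O ⊗ K 6)))) ⟧ n)
        last ι a ρ n a≤ i≤ = left-run ρ
             (within (+-monoʳ-≤ 2 (*-monoˡ-≤ 17 a≤)) (load-run (answer a))
          ⨾ʳ push-run
          ⨾ʳ within (mono (bound post) size≤) (run post ι (a , tt) [] [])
          ⨾ʳ within (+-monoʳ-≤ 2 (*-monoˡ-≤ 16 o≤)) (unload-run (output ι a))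
          ⨾ʳ subst (λ w → Run (pour #1 #0 nonEmpty) (St [] (output ι a ʳ++ []) []) (St w [] [])
              (⟦ K 1 ⊕ O ⊗ K 6 ⟧ n)) (ʳ++-involutive (output ι a))
               (within (s≤s (*-monoˡ-≤ 6 (≤-trans (≤-reflexive (length-ʳ++ (output ι a))) o≤)))
                 (pour-word #1 #0 (λ u v → St v u []) (λ _ _ → refl) (λ _ _ _ → refl) (λ _ _ _ → refl)
                     (output ι a ʳ++ []))))
          where
          size≤ : size (node (wordTree (answer a)) (wordTree (input ι))) ≤ ⟦ N ⟧ n
          size≤ = s≤s (+-mono-≤ (≤-trans (≤-reflexive (size-wordTree (answer a))) (s≤s (*-monoˡ-≤ 12 a≤)))
            (≤-trans (≤-reflexive (size-wordTree (input ι))) (s≤s (*-monoˡ-≤ 12 i≤))))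
          o≤ : length (output ι a) ≤ ⟦ O ⟧ n
          o≤ = ≤-trans (length≤size (output ι a)) (≤-trans (out-size post ι (a , tt))
              (mono (growth post) size≤))

      coefficient′ degree′ : ℕ
      coefficient′ = proj₁ (monomial time)
      degree′      = proj₁ (proj₂ (monomial time))

      reduction : ∀ ι (a : Answer ι) t → P on query ι outputs answer a in[ t ] → t ≤ c * suc (length (query ι))
          ^ k →
        ∃[ t′ ] program′ on input ι outputs output ι a in[ t′ ] × t′ ≤ coefficient′ * suc (length (input ι)) ^
            degree′
      reduction ι a t (v ∷ τ , r , refl) t≤ = finish
        (proj₁ (first ι ([] ∷ Vec.replicate e []))
          ⨾ʳ within (s≤s (*-monoˡ-≤ 6 (≤-trans (≤-reflexive (length-ʳ++ (query ι))) q≤))) to-P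
          ⨾ʳ (t , rename-⇓ (3 ↑ʳ_) (λ ρ → (wordTree (input ι) ◂ []) ∷ [] ∷ [] ∷ ρ) (λ _ _ → refl)
              (λ _ _ _ → refl) r , t≤B)
          ⨾ʳ within (s≤s (*-monoˡ-≤ 6 v≤))
               (pour-word #3 (suc zero) (λ u w → (wordTree (input ι) ◂ []) ∷ w ∷ [] ∷ u ∷ τ) (λ _ _ → refl)
                   (λ _ _ _ → refl) (λ _ _ _ → refl) (answer a))
          ⨾ʳ last ι a ([] ∷ τ) n v≤ ≤-refl)
        where
        n = length (input ι)
        q≤ : length (query ι) ≤ ⟦ A ⟧ n
        q≤ = proj₂ (first ι ([] ∷ Vec.replicate e []))
        to-P : Run (pour (suc zero) #3 nonEmpty) (Full (wordTree (input ι) ◂ []) (query ι ʳ++ [])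
            ([] ∷ Vec.replicate e []))
                 (Full (wordTree (input ι) ◂ []) [] (query ι ∷ Vec.replicate e []))
                     (1 + length (query ι ʳ++ []) * 6)
        to-P = subst (λ w → Run (pour (suc zero) #3 nonEmpty) (Full (wordTree (input ι) ◂ []) (query ι ʳ++ [])
            ([] ∷ Vec.replicate e []))
                 (Full (wordTree (input ι) ◂ []) [] (w ∷ Vec.replicate e [])) (1 + length (query ι ʳ++ []) * 6))
                     (ʳ++-involutive (query ι))
          (pour-word (suc zero) #3 (λ u w → (wordTree (input ι) ◂ []) ∷ u ∷ [] ∷ w ∷ Vec.replicate e [])
              (λ _ _ → refl) (λ _ _ _ → refl) (λ _ _ _ → refl) (query ι ʳ++ []))
        t≤B : t ≤ ⟦ B ⟧ n
        t≤B = ≤-trans t≤ (*-monoʳ-≤ c (≤-trans (^-monoˡ-≤ k (s≤s q≤))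
            (≤-reflexive (sym (⟦power⟧ k (suc (⟦ A ⟧ n)))))))
        total-empty : ∀ e → total (Vec.replicate e []) ≡ 0
        total-empty zero    = refl
        total-empty (suc e) = total-empty e
        -- Nothing is known about the stacks of P except its running time, which bounds what it can
        -- have written.
        v≤ : length (answer a) ≤ ⟦ V ⟧ n
        v≤ = ≤-trans (m≤m+n (length (answer a)) (total τ)) (≤-trans (total-grows r)
          (+-mono-≤ (≤-trans (≤-reflexive (trans (cong (length (query ι) +_) (total-empty e)) (+-identityʳ _)))
              q≤) t≤B))
        finish : Run (Program.body program′) (Full (input ι) [] ([] ∷ Vec.replicate e []))
            (Full (output ι a) [] ([] ∷ τ)) (⟦ time ⟧ n) →
          ∃[ t′ ] program′ on input ι outputs output ι a in[ t′ ] × t′ ≤ coefficient′ * suc n ^ degree′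
        finish (t′ , r′ , t′≤) = t′ , (_ , r′ , refl) , ≤-trans t′≤ (proj₂ (proj₂ (monomial time)) n)

-- The approximation algorithm for vehicle routing.

open Approximation
open Minimum
open PolyInstance
open Subroutine
open import Data.Integer using (+_)
open import Data.Rational as ℚ using (0ℚ; 1ℚ; _/_)
import Data.Rational.Properties as ℚₚ
open import Data.Rational.Solver using (module +-*-Solver)
open import Relation.Nullary.Decidable using (toWitness)

module Routing-by-TSP = Reduction {CVRPInstance} (MinimizationProblem.encodeInstance CVRP)
  (λ I → MinimizationProblem.encodeInstance TSP (Solve.tspInstance I)) (λ I → TSPTour (Solve.tspInstance I))
  (λ {I} → MinimizationProblem.encodeSolution TSP {Solve.tspInstance I})
  (λ I T → MinimizationProblem.encodeSolution CVRP (Solve.solution I T))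

routing-algorithm : (α : ℝ) → fromℚ 1ℚ <ℝ α → ApproximationAlgorithm α TSP →
  ApproximationAlgorithm (α +ℝ fromℚ (+ 2 / 1) *ℝ (fromℚ 1ℚ -ℝ fromℚ (+ 1 / 96))) CVRP
routing-algorithm α 1<α A = record
  { program     = Routing-by-TSP.program′ tspWordP solutionWordP program coefficient degree
  ; coefficient = Routing-by-TSP.coefficient′ tspWordP solutionWordP program coefficient degree
  ; degree      = Routing-by-TSP.degree′ tspWordP solutionWordP program coefficient degree
  ; correct     = λ I →
      let (T , t , run , t≤ , T* , minimal , approx) = correct (Solve.tspInstance I)
          (t′ , run′ , t′≤) = Routing-by-TSP.reduction tspWordP solutionWordP program coefficient degree I T t
              run t≤
          (O , optimal) = minimum-exists I
      in Solve.solution I T , t′ , run′ , t′≤ , O , optimal , guarantee I α 1<α T T* minimal approx O }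
  where open ApproximationAlgorithm A

fromℚ-< : ∀ {p q} → p ℚ.< q → fromℚ p <ℝ fromℚ q
fromℚ-< {p} {q} p<q = q ℚ.- p , subst (ℚ._< q ℚ.- p) (ℚₚ.+-inverseʳ p) (ℚₚ.+-monoˡ-< (ℚ.- p) p<q) , 0 , λ _ _ →
    ℚₚ.≤-reflexive (p+[q-p] p q)
  where
  p+[q-p] : ∀ p q → p ℚ.+ (q ℚ.- p) ≡ q
  p+[q-p] = solve 2 (λ p q → p :+ (q :- p) := q) refl
    where open +-*-Solver

theorem1 :
    ((α : ℝ) → fromℚ 1ℚ <ℝ α →
      ∃[ ε ] fromℚ 0ℚ <ℝ ε ×
        (ApproximationAlgorithm α TSP →
         ApproximationAlgorithm (α +ℝ fromℚ (+ 2 / 1) *ℝ (fromℚ 1ℚ -ℝ ε)) CVRP))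
    ×
    (∃[ ε ] fromℚ (+ 1 / 3000) <ℝ ε ×
        (ApproximationAlgorithm (fromℚ (+ 3 / 2)) TSP →
         ApproximationAlgorithm (fromℚ (+ 3 / 2) +ℝ fromℚ (+ 2 / 1) *ℝ (fromℚ 1ℚ -ℝ ε)) CVRP))
theorem1 =
    (λ α 1<α → fromℚ (+ 1 / 96) , fromℚ-< (toWitness {a? = 0ℚ ℚ.<? (+ 1 / 96)} _) , routing-algorithm α 1<α)
  , (fromℚ (+ 1 / 96) , fromℚ-< (toWitness {a? = (+ 1 / 3000) ℚ.<? (+ 1 / 96)} _) ,
     routing-algorithm (fromℚ (+ 3 / 2)) (fromℚ-< (toWitness {a? = 1ℚ ℚ.<? (+ 3 / 2)} _)))
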